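{- For every $n\ge1$, the set $\mathcal{M}_n$ of (rooted) simple outerplanar maps with $n+1$ vertices is in one-to-one correspondence with the set $\mathfrak{D}^{\mathbf{s}}_n(1,1)$; in particular $\#\mathcal{M}_n=\#\mathfrak{D}^{\mathbf{s}}_n(1,1)$.
   Context: An outerplanar map is a (connected) planar map all of whose vertices lie on the outer face; it is simple if it has no loops or multiple edges; maps are rooted, with root on the outer face. $s_m$ ($m\ge0$) denotes the little Schröder number: the number of lattice paths from $(0,0)$ to $(m,m)$ with steps $(1,0),(0,1),(1,1)$ staying weakly above $y=x$ and with no $(1,1)$-step on $y=x$ (equivalently the number of dissections of a convex $(m+2)$-gon by nonintersecting diagonals). $\mathfrak{D}^{\mathbf{s}}_n(1,1)$ is the set of colored Dyck paths of semilength $2n$ that are concatenations of down-steps $d$ and blocks $u^{2j}d^{j}$ ($j=1,\dots,n$) — equivalently every maximal ascent has even length $2j$ and is immediately followed by at least $j$ down-steps — where each maximal ascent of length $2j$ is assigned one of $s_{j-1}$ colors. -}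

module Defs where

open import Data.Nat using (ℕ; zero; suc; _+_; _*_; _≤_; _≤ᵇ_)
open import Data.Nat.Properties using (_≟_)
open import Data.Bool using (Bool; true; false)
open import Data.Fin using (Fin; toℕ)
open import Data.Fin.Permutation using (Permutation′; _⟨$⟩ʳ_)
open import Data.List using (List; []; _∷_; upTo; allFin; filter; length)
open import Data.Bool using (_∧_)
open import Data.Empty using (⊥)
open import Data.Product using (Σ; ∃; _×_; _,_; proj₁)
open import Function using (_∘_)
open import Function.Bundles using (_↔_; Inverse)
open import Relation.Binary.PropositionalEquality using (_≡_; _≢_)
open import Relation.Nullary.Decidable using (False)
open import Relation.Nullary using (¬_)
open import Data.Bool using (T)
open import Relation.Nullary.Decidable using (T?)

-- Little Schröder numbers, via their lattice paths.
-- Steps E=(1,0), N=(0,1), D=(1,1); paths (0,0) → (m,m) staying weakly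
-- above y = x, no D-step starting on y = x.  s_m = # SchröderPath m.

data LStep : Set where
  east north diag : LStep

SValid : ℕ → ℕ → ℕ → List LStep → Set
SValid m x y []      = (x ≡ m) × (y ≡ m)
SValid m x y (east ∷ w) = (suc x ≤ y) × SValid m (suc x) y w
SValid m x y (north ∷ w) = SValid m x (suc y) w
SValid m x y (diag ∷ w) = False (x ≟ y) × SValid m (suc x) (suc y) w

SchröderPath : ℕ → Set
SchröderPath m = Σ (List LStep) (SValid m 0 0)

-- Colored Dyck paths 𝔇ˢ_n(1,1).
-- A path is a word in the letters  d  and  block k c  where
-- block k c = u^{2(k+1)} d^{k+1} (i.e. j = k+1) whose maximal ascent
-- carries the color c, one of s_{j-1} = s_k colors (the colors are the
-- Schröder paths counted by s_k).

data DStep : Set where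
  dn    : DStep
  block : (k : ℕ) → SchröderPath k → DStep

ups : List DStep → ℕ
ups []              = 0
ups (dn ∷ w)        = ups w
ups (block k _ ∷ w) = 2 * suc k + ups w

-- DyckFrom h w : starting at height h, the path w never goes below 0
-- and ends at height 0.  (Inside a block the height never drops below
-- its starting height.)
DyckFrom : ℕ → List DStep → Set
DyckFrom h []              = h ≡ 0
DyckFrom zero (dn ∷ w)     = ⊥
DyckFrom (suc h) (dn ∷ w)  = DyckFrom h w
DyckFrom h (block k _ ∷ w) = DyckFrom (h + suc k) w

ColoredDyck : ℕ → Set
ColoredDyck n = Σ (List DStep) λ w → (ups w ≡ 2 * n) × DyckFrom 0 w

-- Combinatorial maps (rotation systems).
-- Darts Fin N; σ = vertex rotation (a permutation), α = edge involution
-- (fixed-point free), faces = cycles of φ = σ ∘ α.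

iter : {N : ℕ} → (Fin N → Fin N) → ℕ → Fin N → Fin N
iter f zero    d = d
iter f (suc k) d = f (iter f k d)

SameCycle : {N : ℕ} → (Fin N → Fin N) → Fin N → Fin N → Set
SameCycle f d e = ∃ λ k → iter f k d ≡ e

-- number of cycles of a permutation f of Fin N: count darts that are
-- the least element (w.r.t. toℕ) of their orbit {f^k d | k < N}
allB : {A : Set} → (A → Bool) → List A → Bool
allB p []       = true
allB p (x ∷ xs) = p x ∧ allB p xs

isCycleRep : {N : ℕ} → (Fin N → Fin N) → Fin N → Bool
isCycleRep {N} f d = allB (λ k → toℕ d ≤ᵇ toℕ (iter f k d)) (upTo N)

nCycles : {N : ℕ} → (Fin N → Fin N) → ℕ
nCycles {N} f = length (filter (λ d → T? (isCycleRep f d)) (allFin N))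

-- reachability under σ and α (σ is a permutation of a finite set, so
-- σ⁻¹ is a power of σ; this is transitivity of ⟨σ, α⟩)
data Reach {N : ℕ} (σ α : Fin N → Fin N) : Fin N → Fin N → Set where
  here : ∀ {d} → Reach σ α d d
  viaσ : ∀ {d e} → Reach σ α (σ d) e → Reach σ α d e
  viaα : ∀ {d e} → Reach σ α (α d) e → Reach σ α d e

record RootedMap : Set where
  field
    N         : ℕ
    σ         : Permutation′ N
    α         : Fin N → Fin N
    root      : Fin N
    α-invol   : ∀ d → α (α d) ≡ d
    α-fpf     : ∀ d → α d ≢ d
    connected : ∀ d e → Reach (σ ⟨$⟩ʳ_) α d e

  σf : Fin N → Fin N
  σf = σ ⟨$⟩ʳ_

  φ : Fin N → Fin N
  φ = σf ∘ α

  nVertices : ℕ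
  nVertices = nCycles σf

  nFaces : ℕ
  nFaces = nCycles φ

  field
    -- Euler: V − E + F = 2 with E = N/2, i.e. 2(V + F) = N + 4
    planar : 2 * (nVertices + nFaces) ≡ N + 4

open RootedMap public

-- a simple outerplanar rooted map with n+1 vertices; the outer face is
-- the root face (the face, i.e. φ-cycle, containing the root dart)
record SimpleOuterplanar (n : ℕ) (M : RootedMap) : Set where
  field
    vertices : nVertices M ≡ suc n
    noLoop   : ∀ d → ¬ SameCycle (σf M) d (α M d)
    noMulti  : ∀ d e → SameCycle (σf M) d e → SameCycle (σf M) (α M d) (α M e) → d ≡ e
    outer    : ∀ d → ∃ λ e → SameCycle (σf M) d e × SameCycle (φ M) (root M) e

_≅_ : RootedMap → RootedMap → Set
M ≅ M′ = Σ (Fin (N M) ↔ Fin (N M′)) λ f →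
           (∀ d → Inverse.to f (σf M d) ≡ σf M′ (Inverse.to f d))
         × (∀ d → Inverse.to f (α M d) ≡ α M′ (Inverse.to f d))
         × (Inverse.to f (root M) ≡ root M′)

-- 𝓜_n as a type of representatives (to be taken up to _≅_)
OuterplanarMap : ℕ → Set
OuterplanarMap n = Σ RootedMap (SimpleOuterplanar n)

{-# OPTIONS --safe #-}

-- Walk around the outer face from the root and let v be the vertex discovered last, e₀ the dart leaving v
-- at its first visit. Either v is a leaf, or e₀ separates the outer face from an inner one: otherwise
-- deleting its edge would keep the map connected and contradict Euler's inequality. Removing the edge
-- gives a smaller map of the same kind, whose last vertex is v again in the second case. So every map is
-- built in a unique way from a single edge by attaching leaves and closing faces along the outer walk, and
-- maps correspond to words in which, above height 0, an ascent is of one of two kinds (pass or close).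
-- Cutting such a word at its returns gives trees satisfying k = 1 + t k² g, g = 1 + t k a g and
-- a = 1 + t k a + t k a², and these are the colored Dyck paths whose colors, as Schröder paths, are cut in
-- the same way.

module Submission where

open import Defs using
  ( iter; SameCycle; nCycles; isCycleRep; allB; Reach; here; viaσ; viaα
  ; RootedMap; SimpleOuterplanar; _≅_; OuterplanarMap
  ; LStep; east; north; diag; SValid; SchröderPath
  ; DStep; dn; block; ups; DyckFrom; ColoredDyck )
open import Data.Bool using (Bool; true; T)
open import Data.Empty using (⊥; ⊥-elim)
open import Data.Unit using (tt)
open import Data.Nat using (ℕ; zero; suc; _+_; _*_; _∸_; _≤_; _<_; z≤n; s≤s)
import Data.Nat.Properties as ℕₚ
open import Data.Nat.Solver using (module +-*-Solver)
open import Data.Fin using (Fin; zero; suc; toℕ; punchIn; punchOut)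
import Data.Fin.Properties as Fₚ
open import Data.List using (List; []; _∷_; _++_; map; length; lookup; allFin; upTo; filter; take; drop)
import Data.List.Properties as Listₚ
open import Data.List.Membership.Propositional using (_∈_; _∉_; find; lose)
import Data.List.Membership.Propositional.Properties as ∈ₚ
open import Data.List.Relation.Unary.Any as Any using (Any; here; there; index)
import Data.List.Relation.Unary.Any.Properties as Anyₚ
open import Data.List.Relation.Unary.All as All using (All; []; _∷_)
import Data.List.Relation.Unary.All.Properties as Allₚ
open import Data.List.Relation.Unary.AllPairs as AllPairs using (AllPairs; []; _∷_)
import Data.List.Relation.Unary.AllPairs.Properties as AllPairsₚ
open import Data.List.Relation.Unary.Unique.Propositional using (Unique)
import Data.List.Relation.Unary.Unique.Propositional.Properties as Uniqueₚ
open import Data.Product using (Σ; ∃; _×_; _,_; proj₁; proj₂)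
open import Data.Sum using (_⊎_; inj₁; inj₂; [_,_]′)
open import Function using (_∘_; id; case_of_)
open import Relation.Nullary using (¬_; Dec; yes; no)
open import Relation.Nullary.Decidable using (T?; ¬?; _×-dec_; toWitnessFalse; fromWitnessFalse)
open import Relation.Binary.PropositionalEquality
open import Data.Bool.Properties using (T-irrelevant)
open import Data.Maybe as Maybe using (Maybe; just; nothing; maybe′)
import Data.Maybe.Properties as Maybeₚ
open import Data.Fin.Permutation using (permutation)
open import Function.Bundles using (mk↔ₛ′; Inverse)

-- The obstacle is that deleting an edge must be shown to leave a planar map. Vertices and faces are
-- therefore not counted as cycles: a map carries invariant labellings onto `Fin V` and `Fin F` with
-- V + F = E + 2, which are easy to carry through an insertion or a deletion. Euler's inequality
-- holds for such labellings too, so equality forces each label to be a single orbit and nothing is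
-- lost. Connectedness is likewise stated by invariants, not by paths. Building needs more than a
-- map records: the outer vertices still ahead must be distinct, and those a chord may reach must
-- not yet be joined to the last vertex. Both are invariants of the construction only. For a given
-- map they are never proved: the induction yields a word for the smaller map, and the word supplies
-- them. A word describes a map together with a pointer into its outer walk. Moving the pointer
-- leaves the map alone but is an instruction, because it makes the number of darts from the pointer
-- on a height.

-- Walks and orbits of an injective function on a finite set.

Inj : {A B : Set} → (A → B) → Set
Inj f = ∀ {x y} → f x ≡ f y → x ≡ y

-- The list contains the start but not the end, so walks concatenate without overlap and one turn
-- around a cycle lists each of its points once.
data Walk {A : Set} (f : A → A) : A → List A → A → Set where
  stop : ∀ {x} → Walk f x [] x
  step : ∀ {x xs y} → Walk f (f x) xs y → Walk f x (x ∷ xs) y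

Orb : {A : Set} → (A → A) → A → A → Set
Orb f x y = ∃ λ xs → Walk f x xs y

module _ {A : Set} {f : A → A} where

  walk-++ : ∀ {x xs y ys z} → Walk f x xs y → Walk f y ys z → Walk f x (xs ++ ys) z
  walk-++ stop     w = w
  walk-++ (step v) w = step (walk-++ v w)

  walk-split : ∀ xs {x ys z} → Walk f x (xs ++ ys) z → ∃ λ y → Walk f x xs y × Walk f y ys z
  walk-split []       w = _ , stop , w
  walk-split (_ ∷ xs) (step w) with y , v , v′ ← walk-split xs w = y , step v , v′

  walk-split-at : ∀ xs {x y ys z} → Walk f x (xs ++ y ∷ ys) z → Walk f x xs y × Walk f y (y ∷ ys) z
  walk-split-at xs w with walk-split xs w
  ... | _ , v , step v′ = v , step v′

  walk-head : ∀ {x y xs z} → Walk f x (y ∷ xs) z → x ≡ y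
  walk-head (step _) = refl

  walk-next : ∀ {x xs y z} → Walk f x xs y → z ∈ xs → f z ∈ xs ⊎ f z ≡ y
  walk-next (step stop)     (here refl) = inj₂ refl
  walk-next (step (step w)) (here refl) = inj₁ (there (here refl))
  walk-next (step w)        (there z∈)  with walk-next w z∈
  ... | inj₁ fz∈ = inj₁ (there fz∈)
  ... | inj₂ fz≡ = inj₂ fz≡

  arrive : ∀ {x xs y v} → Walk f x xs y → v ∈ xs ++ y ∷ [] → v ≡ x ⊎ ∃ λ t → t ∈ xs × v ≡ f t
  arrive stop     (here refl) = inj₁ refl
  arrive (step w) (here refl) = inj₁ refl
  arrive (step w) (there v∈) with arrive w v∈
  ... | inj₁ refl         = inj₂ (_ , here refl , refl)
  ... | inj₂ (t , t∈ , e) = inj₂ (t , there t∈ , e)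

  walk-last : ∀ {x z zs y} → Walk f x (z ∷ zs) y → ∃ λ l → l ∈ z ∷ zs × f l ≡ y
  walk-last (step stop) = _ , here refl , refl
  walk-last (step w@(step _)) with walk-last w
  ... | l , l∈ , e = l , there l∈ , e

  walk-map : ∀ {B : Set} {f′ : B → B} {h : A → B} → (∀ x → h (f x) ≡ f′ (h x)) →
             ∀ {x xs y} → Walk f x xs y → Walk f′ (h x) (map h xs) (h y)
  walk-map comm stop = stop
  walk-map {f′ = f′} {h} comm {xs = x ∷ xs} {y} (step w) =
    step (subst (λ z → Walk f′ z (map h xs) (h y)) (comm x) (walk-map comm w))

  orb-trans : ∀ {x y z} → Orb f x y → Orb f y z → Orb f x z
  orb-trans (xs , v) (ys , w) = xs ++ ys , walk-++ v w

  orb-inv : ∀ {B : Set} {ℓ : A → B} → (∀ x → ℓ (f x) ≡ ℓ x) → ∀ {x y} → Orb f x y → ℓ x ≡ ℓ y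
  orb-inv inv (_ , stop)   = refl
  orb-inv inv (_ , step w) = trans (sym (inv _)) (orb-inv inv (_ , w))

unique-lookup-inj : ∀ {A : Set} {xs : List A} → Unique xs → Inj (lookup xs)
unique-lookup-inj {xs = _ ∷ _}  _          {zero}  {zero}  _  = refl
unique-lookup-inj {xs = _ ∷ _} (x∉ ∷ u)   {zero}  {suc j} eq = ⊥-elim (All.lookup x∉ (∈ₚ.∈-lookup j) eq)
unique-lookup-inj {xs = _ ∷ _} (x∉ ∷ u)   {suc i} {zero}  eq = ⊥-elim (All.lookup x∉ (∈ₚ.∈-lookup i) (sym eq))
unique-lookup-inj {xs = _ ∷ _} (_ ∷ u)    {suc i} {suc j} eq = cong suc (unique-lookup-inj u eq)

module _ {N : ℕ} where

  unique-length : {xs : List (Fin N)} → Unique xs → length xs ≤ N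
  unique-length u = Fₚ.injective⇒≤ (unique-lookup-inj u)

  open import Data.List.Membership.DecPropositional (Fₚ._≟_ {N}) using (_∈?_) public

module _ {N : ℕ} {f : Fin N → Fin N} where

  iter-shift : ∀ k x → iter f k (f x) ≡ f (iter f k x)
  iter-shift zero    x = refl
  iter-shift (suc k) x = cong f (iter-shift k x)

  iter-walk : ∀ k x → ∃ λ xs → Walk f x xs (iter f k x)
  iter-walk zero    x = [] , stop
  iter-walk (suc k) x with xs , w ← iter-walk k (f x) =
    x ∷ xs , step (subst (Walk f (f x) xs) (iter-shift k x) w)

  walk-iter : ∀ {x xs y} → Walk f x xs y → iter f (length xs) x ≡ y
  walk-iter stop = refl
  walk-iter {x} {_ ∷ xs} (step w) = trans (sym (iter-shift (length xs) x)) (walk-iter w)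

  orb⇒cycle : ∀ {x y} → Orb f x y → SameCycle f x y
  orb⇒cycle (xs , w) = length xs , walk-iter w

  cycle⇒orb : ∀ {x y} → SameCycle f x y → Orb f x y
  cycle⇒orb (k , refl) = iter-walk k _

  module _ (inj : Inj f) where

    private
      unique-snoc : ∀ {y : Fin N} {xs} → Unique (y ∷ xs) → Unique (xs ++ y ∷ [])
      unique-snoc (y∉ ∷ u) = Uniqueₚ.++⁺ u ([] ∷ []) λ { (z∈ , here refl) → All.lookup y∉ z∈ refl }

      close : ∀ xs {x y} → Walk f x (xs ++ y ∷ []) x → Unique (xs ++ y ∷ []) →
              ∃ λ ys → Walk f x (x ∷ ys) x × Unique (x ∷ ys)
      close []       (step w) u = _ , step w , u
      close (_ ∷ xs) (step w) u = _ , step w , u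

      -- The walk is prolonged until it returns to its start. A return to any other listed point
      -- would give that point two preimages, against injectivity; and a list without repetitions
      -- has at most `N` entries, so the fuel suffices.
      grow : ∀ fuel {x xs y} → N ≤ fuel + length xs → Walk f x xs y → Unique (y ∷ xs) →
             ∃ λ ys → Walk f x (x ∷ ys) x × Unique (x ∷ ys)
      grow zero le w u = ⊥-elim (ℕₚ.<-irrefl refl (ℕₚ.≤-trans (unique-length u) le))
      grow (suc fuel) {x} {xs} {y} le w u with f y Fₚ.≟ x
      ... | yes fy≡x = close xs (walk-++ w (step (subst (λ z → Walk f z [] x) (sym fy≡x) stop))) (unique-snoc u)
      ... | no fy≢x = grow fuel (subst (N ≤_) lengths le) (walk-++ w (step stop)) (fresh ∷ unique-snoc u)
        where
        lengths : suc fuel + length xs ≡ fuel + length (xs ++ y ∷ [])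
        lengths = trans (sym (ℕₚ.+-suc fuel (length xs)))
                    (cong (fuel +_) (sym (trans (Listₚ.length-++ xs) (ℕₚ.+-comm (length xs) 1))))
        fresh : All (f y ≢_) (xs ++ y ∷ [])
        fresh = All.tabulate λ { v∈ refl → case arrive w v∈ of λ where
                  (inj₁ fy≡x) → fy≢x fy≡x
                  (inj₂ (t , t∈ , e)) → case inj e of λ { refl → All.lookup (AllPairs.head u) t∈ refl } }

    abstract
      cycle : ∀ x → ∃ λ xs → Walk f x (x ∷ xs) x × Unique (x ∷ xs)
      cycle x = grow N (ℕₚ.m≤m+n N 0) stop ([] ∷ [])

      orb-∈ : ∀ {x xs y} → Walk f x (x ∷ xs) x → Orb f x y → y ∈ x ∷ xs
      orb-∈ {x} {xs} loop (_ , w) = go w (here refl)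
        where
        go : ∀ {z zs y} → Walk f z zs y → z ∈ x ∷ xs → y ∈ x ∷ xs
        go stop z∈ = z∈
        go (step w) z∈ with walk-next loop z∈
        ... | inj₁ fz∈ = go w fz∈
        ... | inj₂ fz≡ = go w (here fz≡)

      orb-sym : ∀ {x y} → Orb f x y → Orb f y x
      orb-sym {x} o with cycle x
      ... | xs , loop , _ with ∈ₚ.∈-∃++ (orb-∈ loop o)
      ... | as , bs , eq = _ , proj₂ (walk-split-at as (subst (λ zs → Walk f x zs x) eq loop))

      orb? : ∀ x y → Dec (Orb f x y)
      orb? x y with cycle x
      ... | xs , loop , _ with y ∈? (x ∷ xs)
      ... | no y∉ = no (y∉ ∘ orb-∈ loop)
      ... | yes y∈ with ∈ₚ.∈-∃++ y∈
      ... | as , bs , eq = yes (_ , proj₁ (walk-split-at as (subst (λ zs → Walk f x zs x) eq loop)))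

    inj⇒onto : ∀ y → ∃ λ x → f x ≡ y
    inj⇒onto y with _ , loop , _ ← cycle y with l , _ , e ← walk-last loop = l , e

-- Counting cycles by labellings and by representatives.

-- An invariant labelling onto Fin c is a lower bound c for the number of cycles; a Cover is an upper bound.
record Lab {N : ℕ} (f : Fin N → Fin N) (c : ℕ) : Set where
  field
    lab  : Fin N → Fin c
    inv  : ∀ x → lab (f x) ≡ lab x
    onto : ∀ i → ∃ λ x → lab x ≡ i

  lab-orb : ∀ {x y} → Orb f x y → lab x ≡ lab y
  lab-orb = orb-inv inv

open Lab

Cover : {N : ℕ} → (Fin N → Fin N) → List (Fin N) → Set
Cover f rs = ∀ x → ∃ λ r → r ∈ rs × Orb f x r

∈-index-inj : ∀ {A : Set} {xs : List A} {x y} (p : x ∈ xs) (q : y ∈ xs) → index p ≡ index q → x ≡ y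
∈-index-inj {xs = xs} p q eq =
  trans (Anyₚ.lookup-index p) (trans (cong (lookup xs) eq) (sym (Anyₚ.lookup-index q)))

-- Pick a point for each label and then its representative: this is injective, because the
-- representative carries the label of the point.
lab≤cover : ∀ {N c} {f : Fin N → Fin N} {rs} → Lab f c → Cover f rs → c ≤ length rs
lab≤cover {f = f} {rs} L cov = Fₚ.injective⇒≤ {f = pick} λ {i} {j} → pick-inj i j
  where
  rep = λ i → cov (proj₁ (onto L i))
  pick : Fin _ → Fin (length rs)
  pick i = index (proj₁ (proj₂ (rep i)))
  label : ∀ i → lab L (proj₁ (rep i)) ≡ i
  label i = trans (sym (lab-orb L (proj₂ (proj₂ (rep i))))) (proj₂ (onto L i))
  pick-inj : ∀ i j → pick i ≡ pick j → i ≡ j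
  pick-inj i j eq =
    trans (sym (label i)) (trans (cong (lab L) (∈-index-inj (proj₁ (proj₂ (rep i))) _ eq)) (label j))

module CycleReps {N : ℕ} {f : Fin N → Fin N} (inj : Inj f) where

  reps : List (Fin N)
  reps = filter (λ d → T? (isCycleRep f d)) (allFin N)

  private
    allB-intro : ∀ {A : Set} (p : A → Bool) xs → (∀ x → x ∈ xs → T (p x)) → T (allB p xs)
    allB-intro p [] h = tt
    allB-intro p (x ∷ xs) h with p x | h x (here refl)
    ... | true | _ = allB-intro p xs (λ y y∈ → h y (there y∈))

    allB-elim : ∀ {A : Set} (p : A → Bool) xs → T (allB p xs) → ∀ {x} → x ∈ xs → T (p x)
    allB-elim p (x ∷ xs) t (here refl) with true ← p x = tt
    allB-elim p (x ∷ xs) t (there y∈) with true ← p x = allB-elim p xs t y∈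

    least : ∀ (x : Fin N) xs → ∃ λ m → m ∈ x ∷ xs × (∀ {z} → z ∈ x ∷ xs → toℕ m ≤ toℕ z)
    least x [] = x , here refl , λ { (here refl) → ℕₚ.≤-refl }
    least x (y ∷ ys) with least y ys
    ... | m , m∈ , min with ℕₚ.≤-total (toℕ x) (toℕ m)
    ... | inj₁ x≤m = x , here refl , λ { (here refl) → ℕₚ.≤-refl ; (there z∈) → ℕₚ.≤-trans x≤m (min z∈) }
    ... | inj₂ m≤x = m , there m∈ , λ { (here refl) → m≤x ; (there z∈) → min z∈ }

    -- `isCycleRep` only tests exponents below `N`. They reach the whole orbit, since a cycle
    -- without repetitions has at most `N` points.
    rep-min : ∀ {r} → r ∈ reps → ∀ {z} → Orb f r z → toℕ r ≤ toℕ z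
    rep-min {r} r∈ {z} o with cycle inj r
    ... | xs , loop , u with ∈ₚ.∈-∃++ (orb-∈ inj loop o)
    ... | as , bs , eq =
      subst (λ t → toℕ r ≤ toℕ t) (walk-iter (proj₁ (walk-split-at as (subst (λ zs → Walk f r zs r) eq loop))))
        (ℕₚ.≤ᵇ⇒≤ _ _ (allB-elim _ (upTo N)
          (proj₂ (∈ₚ.∈-filter⁻ (λ d → T? (isCycleRep f d)) {xs = allFin N} r∈)) (∈ₚ.∈-upTo⁺ short)))
      where
      short : length as < N
      short = ℕₚ.≤-trans (subst (suc (length as) ≤_)
                (sym (trans (cong length eq) (trans (Listₚ.length-++ as) (ℕₚ.+-suc (length as) (length bs)))))
                (s≤s (ℕₚ.m≤m+n _ _))) (unique-length u)

  abstract
    cover : Cover f reps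
    cover x with cycle inj x
    ... | xs , loop , u with least x xs
    ... | m , m∈ , min with ∈ₚ.∈-∃++ m∈
    ... | as , bs , eq = m , ∈ₚ.∈-filter⁺ (λ d → T? (isCycleRep f d)) (∈ₚ.∈-allFin m) isRep , o
      where
      o : Orb f x m
      o = as , proj₁ (walk-split-at as (subst (λ zs → Walk f x zs x) eq loop))
      isRep : T (isCycleRep f m)
      isRep = allB-intro _ (upTo N) λ k _ → ℕₚ.≤⇒≤ᵇ (min (orb-∈ inj loop (orb-trans o (iter-walk k m))))

  private
    rep-unique : ∀ {r r′} → r ∈ reps → r′ ∈ reps → Orb f r r′ → r ≡ r′
    rep-unique r∈ r′∈ o = Fₚ.toℕ-injective (ℕₚ.≤-antisym (rep-min r∈ o) (rep-min r′∈ (orb-sym inj o)))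

    unique : Unique reps
    unique = Uniqueₚ.filter⁺ (λ d → T? (isCycleRep f d)) (Uniqueₚ.allFin⁺ N)

    ix : Fin N → Fin (nCycles f)
    ix x = index (proj₁ (proj₂ (cover x)))

    index-cong : ∀ {x y r r′} (r∈ : r ∈ reps) (r′∈ : r′ ∈ reps) →
                 Orb f x r → Orb f y r′ → Orb f x y → index r∈ ≡ index r′∈
    index-cong r∈ r′∈ p q o = unique-lookup-inj unique
      (trans (sym (Anyₚ.lookup-index r∈))
      (trans (rep-unique r∈ r′∈ (orb-trans (orb-sym inj p) (orb-trans o q))) (Anyₚ.lookup-index r′∈)))

    ix-cong : ∀ {x y} → Orb f x y → ix x ≡ ix y
    ix-cong {x} {y} = index-cong (proj₁ (proj₂ (cover x))) (proj₁ (proj₂ (cover y)))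
                                 (proj₂ (proj₂ (cover x))) (proj₂ (proj₂ (cover y)))

  cycleLab : Lab f (nCycles f)
  cycleLab .lab = ix
  cycleLab .inv x = sym (ix-cong (x ∷ [] , step stop))
  cycleLab .onto i = lookup reps i , unique-lookup-inj unique
    (trans (sym (Anyₚ.lookup-index (proj₁ (proj₂ (cover _)))))
           (sym (rep-unique (∈ₚ.∈-lookup i) (proj₁ (proj₂ (cover _))) (proj₂ (proj₂ (cover _))))))

  cycleLab-tight : ∀ {x y} → lab cycleLab x ≡ lab cycleLab y → Orb f x y
  cycleLab-tight {x} {y} e = orb-trans (proj₂ (proj₂ (cover x)))
    (subst (λ r → Orb f r y) (sym (∈-index-inj (proj₁ (proj₂ (cover x))) (proj₁ (proj₂ (cover y))) e))
      (orb-sym inj (proj₂ (proj₂ (cover y)))))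

-- Products with transpositions and Euler's inequality.

merge : ∀ {n} (i j : Fin (suc n)) → i ≢ j → Fin (suc n) → Fin n
merge i j i≢j x with j Fₚ.≟ x
... | yes _   = punchOut {i = j} {j = i} (i≢j ∘ sym)
... | no  j≢x = punchOut j≢x

merge-identifies : ∀ {n} (i j : Fin (suc n)) (i≢j : i ≢ j) → merge i j i≢j i ≡ merge i j i≢j j
merge-identifies i j i≢j with j Fₚ.≟ i | j Fₚ.≟ j
... | yes j≡i | _       = ⊥-elim (i≢j (sym j≡i))
... | no  _   | yes _   = Fₚ.punchOut-cong j refl
... | no  _   | no  j≢j = ⊥-elim (j≢j refl)

merge-punchIn : ∀ {n} (i j : Fin (suc n)) (i≢j : i ≢ j) k → merge i j i≢j (punchIn j k) ≡ k
merge-punchIn i j i≢j k with j Fₚ.≟ punchIn j k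
... | yes eq = ⊥-elim (Fₚ.punchInᵢ≢i j k (sym eq))
... | no  _  = trans (Fₚ.punchOut-cong j refl) (Fₚ.punchOut-punchIn j)

swap : ∀ {N} → Fin N → Fin N → Fin N → Fin N
swap a b x with x Fₚ.≟ a | x Fₚ.≟ b
... | yes _ | _     = b
... | no  _ | yes _ = a
... | no  _ | no  _ = x

swap-elim : ∀ {N} (P : Fin N → Fin N → Set) (a b : Fin N) → P a b → P b a →
            ∀ x → (x ≢ a → x ≢ b → P x x) → P x (swap a b x)
swap-elim P a b pa pb x px with x Fₚ.≟ a | x Fₚ.≟ b
... | yes refl | _        = pa
... | no  _    | yes refl = pb
... | no  x≢a  | no  x≢b  = px x≢a x≢b

swap-inv : ∀ {N} {A : Set} {κ : Fin N → A} {a b} → κ a ≡ κ b → ∀ x → κ (swap a b x) ≡ κ x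
swap-inv {κ = κ} {a} {b} e x = swap-elim (λ x y → κ y ≡ κ x) a b (sym e) e x (λ _ _ → refl)

swap-inj : ∀ {N} (a b : Fin N) → Inj (swap a b)
swap-inj a b {x} {y} eq with x Fₚ.≟ a | x Fₚ.≟ b | y Fₚ.≟ a | y Fₚ.≟ b
... | yes refl | _        | yes refl | _        = refl
... | yes refl | _        | no  _    | yes refl = sym eq
... | yes refl | _        | no  _    | no  y≢b  = ⊥-elim (y≢b (sym eq))
... | no  _    | yes refl | yes refl | _        = sym eq
... | no  _    | yes refl | no  _    | yes refl = refl
... | no  _    | yes refl | no  y≢a  | no  _    = ⊥-elim (y≢a (sym eq))
... | no  _    | no  x≢b  | yes refl | _        = ⊥-elim (x≢b eq)
... | no  x≢a  | no  _    | no  _    | yes refl = ⊥-elim (x≢a eq)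
... | no  _    | no  _    | no  _    | no  _    = eq

swap-fst : ∀ {N} (a b : Fin N) → swap a b a ≡ b
swap-fst a b with a Fₚ.≟ a | a Fₚ.≟ b
... | yes _   | _ = refl
... | no  a≢a | _ = ⊥-elim (a≢a refl)

swap-snd : ∀ {N} (a b : Fin N) → swap a b b ≡ a
swap-snd a b with b Fₚ.≟ a | b Fₚ.≟ b
... | yes b≡a | _       = b≡a
... | no  _   | yes _   = refl
... | no  _   | no  b≢b = ⊥-elim (b≢b refl)

swap-other : ∀ {N} {a b x : Fin N} → x ≢ a → x ≢ b → swap a b x ≡ x
swap-other {a = a} {b} {x} x≢a x≢b with x Fₚ.≟ a | x Fₚ.≟ b
... | yes e | _     = ⊥-elim (x≢a e)
... | no  _ | yes e = ⊥-elim (x≢b e)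
... | no  _ | no  _ = refl

remove : ∀ {A : Set} {r : A} {rs} → r ∈ rs →
         ∃ λ rs′ → length rs ≡ suc (length rs′) × (∀ {z} → z ∈ rs → z ≡ r ⊎ z ∈ rs′)
remove {rs = _ ∷ rs} (here refl) = rs , refl , λ { (here refl) → inj₁ refl ; (there z∈) → inj₂ z∈ }
remove {rs = x ∷ rs} (there r∈) with remove r∈
... | rs′ , len , cov = x ∷ rs′ , cong suc len , λ where
        (here refl) → inj₂ (here refl)
        (there z∈)  → [ inj₁ , inj₂ ∘ there ]′ (cov z∈)

-- A transposition splits one cycle or merges two. Only upper bounds on the number of cycles are
-- kept: at most one more in general, one less when some invariant separates `a` from `b`.
module Transposition {N : ℕ} {f : Fin N → Fin N} (inj : Inj f) (a b : Fin N) where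

  f′ : Fin N → Fin N
  f′ = f ∘ swap a b

  private
    orb-cons : ∀ {x y} → x ≢ a → x ≢ b → Orb f′ (f x) y → Orb f′ x y
    orb-cons {x} {y} x≢a x≢b (xs , w) =
      x ∷ xs , step (subst (λ t → Walk f′ (f t) xs y) (sym (swap-other x≢a x≢b)) w)

  -- `f` and `f′` agree away from `a` and `b`, so a walk of `f` can be followed by `f′` until it
  -- first meets one of them.
  hit : ∀ {x xs y} → Walk f x xs y → Orb f′ x a ⊎ Orb f′ x b ⊎ Orb f′ x y
  hit stop = inj₂ (inj₂ (_ , stop))
  hit {x} (step w) with x Fₚ.≟ a | x Fₚ.≟ b
  ... | yes refl | _        = inj₁ (_ , stop)
  ... | no _     | yes refl = inj₂ (inj₁ (_ , stop))
  ... | no x≢a   | no x≢b   with hit w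
  ...   | inj₁ o        = inj₁ (orb-cons x≢a x≢b o)
  ...   | inj₂ (inj₁ o) = inj₂ (inj₁ (orb-cons x≢a x≢b o))
  ...   | inj₂ (inj₂ o) = inj₂ (inj₂ (orb-cons x≢a x≢b o))

  -- The representative of the cycle of `a` is exchanged for `a` and `b`: a walk into that cycle can
  -- be prolonged to `a`, and so meets `a` or `b`.
  split-cover : ∀ {rs} → Cover f rs → ∃ λ rs′ → Cover f′ rs′ × length rs′ ≡ suc (length rs)
  split-cover {rs} cov with cov a
  ... | r₀ , r₀∈ , a⇝r₀ with remove r₀∈
  ... | rs₀ , len , rest = a ∷ b ∷ rs₀ , cov′ , cong suc (sym len)
    where
    cov′ : Cover f′ (a ∷ b ∷ rs₀)
    cov′ x with cov x
    ... | r , r∈ , x⇝r with rest r∈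
    ...   | inj₁ refl with hit (proj₂ (orb-trans x⇝r (orb-sym inj a⇝r₀)))
    ...     | inj₁ o        = a , here refl , o
    ...     | inj₂ (inj₁ o) = b , there (here refl) , o
    ...     | inj₂ (inj₂ o) = a , here refl , o
    cov′ x | r , r∈ , x⇝r | inj₂ r∈′ with hit (proj₂ x⇝r)
    ...     | inj₁ o        = a , here refl , o
    ...     | inj₂ (inj₁ o) = b , there (here refl) , o
    ...     | inj₂ (inj₂ o) = r , there (there r∈′) , o

  module _ {A : Set} {κ : Fin N → A} (inv : ∀ x → κ (f x) ≡ κ x) (κa≢κb : κ a ≢ κ b) where

    private
      avoid : ∀ {x xs} → κ x ≡ κ a → Walk f x xs a → Orb f′ x a
      avoid _ stop = _ , stop
      avoid {x} e (step w) with x Fₚ.≟ a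
      ... | yes refl = _ , stop
      ... | no x≢a   = orb-cons x≢a (λ { refl → κa≢κb (sym e) }) (avoid (trans (inv x) e) w)

      -- `f′` sends `b` to `f a`, and from there the old cycle leads back to `a` without meeting
      -- `b`, whose value under `κ` is different.
      b⇝a : Orb f′ b a
      b⇝a with avoid (inv a) (proj₂ (orb-sym inj (_ , step stop)))
      ... | _ , w = _ , step (subst (λ t → Walk f′ (f t) _ a) (sym (swap-snd a b)) w)

    -- `κ` makes the representatives of `a` and `b` distinct. Both are replaced by the single `a`,
    -- which `b` now reaches.
    merge-cover : ∀ {rs} → Cover f rs → ∃ λ rs′ → Cover f′ rs′ × suc (length rs′) ≡ length rs
    merge-cover {rs} cov with cov a | cov b
    ... | r , r∈ , a⇝r | s , s∈ , b⇝s with remove r∈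
    ... | rs₁ , len₁ , rest₁ with rest₁ s∈
    ...   | inj₁ refl = ⊥-elim (κa≢κb (trans (orb-inv inv a⇝r) (sym (orb-inv inv b⇝s))))
    ...   | inj₂ s∈₁ with remove s∈₁
    ...     | rs₂ , len₂ , rest₂ = a ∷ rs₂ , cov′ , sym (trans len₁ (cong suc len₂))
      where
      to-a : ∀ {x} → Orb f x a ⊎ Orb f x b → Orb f′ x a
      to-a (inj₁ o) with hit (proj₂ o)
      ... | inj₁ o′        = o′
      ... | inj₂ (inj₁ o′) = orb-trans o′ b⇝a
      ... | inj₂ (inj₂ o′) = o′
      to-a (inj₂ o) with hit (proj₂ o)
      ... | inj₁ o′        = o′
      ... | inj₂ (inj₁ o′) = orb-trans o′ b⇝a
      ... | inj₂ (inj₂ o′) = orb-trans o′ b⇝a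
      cov′ : Cover f′ (a ∷ rs₂)
      cov′ x with cov x
      ... | t , t∈ , x⇝t with rest₁ t∈
      ... | inj₁ refl = a , here refl , to-a (inj₁ (orb-trans x⇝t (orb-sym inj a⇝r)))
      ... | inj₂ t∈₁ with rest₂ t∈₁
      ... | inj₁ refl = a , here refl , to-a (inj₂ (orb-trans x⇝t (orb-sym inj b⇝s)))
      ... | inj₂ t∈₂ with hit (proj₂ x⇝t)
      ... | inj₁ o        = a , here refl , o
      ... | inj₂ (inj₁ o) = a , here refl , orb-trans o b⇝a
      ... | inj₂ (inj₂ o) = t , there t∈₂ , o

-- With the list of edges as transpositions this leads, one edge at a time, from the vertex
-- permutation to the face permutation.
swaps : ∀ {N} {A : Set} → (Fin N → A) → List (Fin N × Fin N) → Fin N → A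
swaps f []             = f
swaps f ((a , b) ∷ ps) = swaps f ps ∘ swap a b

Joined : ∀ {N} {A : Set} → (Fin N → A) → List (Fin N × Fin N) → Set
Joined κ = All (λ p → κ (proj₁ p) ≡ κ (proj₂ p))

module Euler {N : ℕ} {σ : Fin N → Fin N} (inj : Inj σ) where

  swaps-inj : ∀ ps → Inj (swaps σ ps)
  swaps-inj []             eq = inj eq
  swaps-inj ((a , b) ∷ ps) eq = swap-inj a b (swaps-inj ps eq)

  swaps-inv : ∀ {A : Set} {κ : Fin N → A} → (∀ x → κ (σ x) ≡ κ x) →
              ∀ {ps} → Joined κ ps → ∀ x → κ (swaps σ ps x) ≡ κ x
  swaps-inv         inv []      x = inv x
  swaps-inv {κ = κ} inv (e ∷ j) x = trans (swaps-inv {κ = κ} inv j _) (swap-inv {κ = κ} e x)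

  -- Multiplying σ by one transposition after another, the number of cycles drops by one whenever two
  -- components are joined and grows by at most one otherwise; this is the invariant bound.
  record Components (ps : List (Fin N × Fin N)) : Set where
    field
      k      : ℕ
      comp   : Lab σ k
      joined : Joined (lab comp) ps
      rs     : List (Fin N)
      cov    : Cover (swaps σ ps) rs
      bound  : length rs + nCycles σ ≤ 2 * k + length ps

  open Components

  components : ∀ ps → Components ps
  components [] .k = nCycles σ
  components [] .comp = CycleReps.cycleLab inj
  components [] .joined = []
  components [] .rs = CycleReps.reps inj
  components [] .cov = CycleReps.cover inj
  components [] .bound = ℕₚ.≤-reflexive (solve 1 (λ v → v :+ v := con 2 :* v :+ con 0) refl (nCycles σ))
    where open +-*-Solver
  components ((a , b) ∷ ps) with components ps
  ... | C with lab (comp C) a Fₚ.≟ lab (comp C) b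
  ...   | yes e with Transposition.split-cover (swaps-inj ps) a b (cov C)
  ...     | rs′ , cov′ , len = record
    { k = k C ; comp = comp C ; joined = e ∷ joined C ; rs = rs′ ; cov = cov′
    ; bound = subst₂ _≤_ (cong (_+ nCycles σ) (sym len)) (sym (ℕₚ.+-suc (2 * k C) (length ps))) (s≤s (bound C)) }
  components ((a , b) ∷ ps)
      | record { k = zero ; comp = κ } | no ne = ⊥-elim (Fₚ.¬Fin0 (lab κ a))
  components ((a , b) ∷ ps)
      | record { k = suc k′ ; comp = κ ; joined = j ; rs = rs₀ ; cov = cov₀ ; bound = bound₀ } | no ne
      with Transposition.merge-cover (swaps-inj ps) a b (swaps-inv {κ = lab κ} (inv κ) j) ne cov₀
  ...     | rs′ , cov′ , len = record
    { k = k′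
    ; comp = record
      { lab = glue ∘ lab κ ; inv = λ x → cong glue (inv κ x)
      ; onto = λ i → proj₁ (onto κ (punchIn _ i))
                   , trans (cong glue (proj₂ (onto κ (punchIn _ i)))) (merge-punchIn _ _ ne i) }
    ; joined = merge-identifies _ _ ne ∷ All.map (cong glue) j
    ; rs = rs′ ; cov = cov′
    ; bound = ℕₚ.≤-pred (subst₂ _≤_ (cong (_+ nCycles σ) (sym len))
                (solve 2 (λ k p → con 2 :* (con 1 :+ k) :+ p := con 1 :+ (con 2 :* k :+ (con 1 :+ p))) refl k′ (length ps))
                bound₀) }
    where
    open +-*-Solver
    glue = merge (lab κ a) (lab κ b) ne

  abstract
    -- The component labelling is invariant and constant on edges, so connectedness leaves at most
    -- one component; and labels are never more numerous than representatives. With `ps` the edges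
    -- this is V + F ≤ E + 2, for arbitrary labellings.
    euler-≤ : ∀ {V F} ps → Lab σ V → Lab (swaps σ ps) F →
              (∀ (κ : Fin N → ℕ) → (∀ x → κ (σ x) ≡ κ x) → Joined κ ps → ∀ x y → κ x ≡ κ y) →
              V + F ≤ 2 + length ps
    euler-≤ {V} {F} ps vl fl conn = begin
      V + F                             ≡⟨ ℕₚ.+-comm V F ⟩
      F + V                             ≤⟨ ℕₚ.+-mono-≤ (lab≤cover fl (cov C)) (lab≤cover vl (CycleReps.cover inj)) ⟩
      length (rs C) + nCycles σ         ≤⟨ bound C ⟩
      2 * k C + length ps               ≤⟨ ℕₚ.+-monoˡ-≤ (length ps) (ℕₚ.*-monoʳ-≤ 2 k≤1) ⟩
      2 + length ps                     ∎
      where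
      open ℕₚ.≤-Reasoning
      C : Components ps
      C = components ps
      single : ∀ {k} → (κ : Lab σ k) → (∀ x y → lab κ x ≡ lab κ y) → k ≤ 1
      single {zero}        κ const = z≤n
      single {suc zero}    κ const = s≤s z≤n
      single {suc (suc _)} κ const =
        case trans (sym (proj₂ (onto κ zero))) (trans (const _ _) (proj₂ (onto κ (suc zero)))) of λ ()
      k≤1 : k C ≤ 1
      k≤1 = single (comp C) λ x y → Fₚ.toℕ-injective
              (conn (toℕ ∘ lab (comp C)) (cong toℕ ∘ inv (comp C)) (All.map (cong toℕ) (joined C)) x y)

-- Darts numbered edge by edge: the edge involution as a product of transpositions.

e₀ e₁ : ∀ {N} → Fin (2 + N)
e₀ = zero
e₁ = suc zero

↑ : ∀ {N} → Fin N → Fin (2 + N)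
↑ x = suc (suc x)

-- The edges are {0 , 1}, {2 , 3}, …
flip : ∀ E → Fin (E * 2) → Fin (E * 2)
flip (suc E) zero    = e₁
flip (suc E) (suc zero)    = e₀
flip (suc E) (suc (suc x)) = ↑ (flip E x)

flip-invol : ∀ E x → flip E (flip E x) ≡ x
flip-invol (suc E) zero    = refl
flip-invol (suc E) (suc zero)    = refl
flip-invol (suc E) (suc (suc x)) = cong ↑ (flip-invol E x)

flip-fpf : ∀ E x → flip E x ≢ x
flip-fpf (suc E) zero       ()
flip-fpf (suc E) (suc zero) ()
flip-fpf (suc E) (suc (suc x)) eq = flip-fpf E x (Fₚ.suc-injective (Fₚ.suc-injective eq))

↑-inj : ∀ {N} {x y : Fin N} → ↑ x ≡ ↑ y → x ≡ y
↑-inj refl = refl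

module _ {N : ℕ} where

  shift : List (Fin N × Fin N) → List (Fin (2 + N) × Fin (2 + N))
  shift = map λ p → ↑ (proj₁ p) , ↑ (proj₂ p)

  swap-shift : ∀ (a b x : Fin N) → swap (↑ a) (↑ b) (↑ x) ≡ ↑ (swap a b x)
  swap-shift a b x = swap-elim (λ x y → swap (↑ a) (↑ b) (↑ x) ≡ ↑ y) a b (swap-fst (↑ a) (↑ b)) (swap-snd (↑ a) (↑ b)) x
    (λ x≢a x≢b → swap-other (x≢a ∘ ↑-inj) (x≢b ∘ ↑-inj))

  module _ {A : Set} (f : Fin (2 + N) → A) where

    swaps-shift-e₀ : ∀ ps → swaps f (shift ps) e₀ ≡ f e₀
    swaps-shift-e₀ []             = refl
    swaps-shift-e₀ ((a , b) ∷ ps) = 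
      trans (cong (swaps f (shift ps)) (swap-other {a = ↑ a} {↑ b} (λ ()) (λ ()))) (swaps-shift-e₀ ps)

    swaps-shift-e₁ : ∀ ps → swaps f (shift ps) e₁ ≡ f e₁
    swaps-shift-e₁ []             = refl
    swaps-shift-e₁ ((a , b) ∷ ps) = 
      trans (cong (swaps f (shift ps)) (swap-other {a = ↑ a} {↑ b} (λ ()) (λ ()))) (swaps-shift-e₁ ps)

    swaps-shift-↑ : ∀ ps x → swaps f (shift ps) (↑ x) ≡ swaps (λ y → f (↑ y)) ps x
    swaps-shift-↑ []             x = refl
    swaps-shift-↑ ((a , b) ∷ ps) x = trans (cong (swaps f (shift ps)) (swap-shift a b x)) (swaps-shift-↑ ps (swap a b x))

pairs : ∀ E → List (Fin (E * 2) × Fin (E * 2))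
pairs zero    = []
pairs (suc E) = (e₀ , e₁) ∷ shift (pairs E)

length-pairs : ∀ E → length (pairs E) ≡ E
length-pairs zero    = refl
length-pairs (suc E) = cong suc (trans (Listₚ.length-map _ (pairs E)) (length-pairs E))

-- The transpositions of the edges are disjoint, so their product is the involution itself.
swaps-pairs : ∀ E {A : Set} (f : Fin (E * 2) → A) x → swaps f (pairs E) x ≡ f (flip E x)
swaps-pairs (suc E) f zero    = swaps-shift-e₁ f (pairs E)
swaps-pairs (suc E) f (suc zero)    = swaps-shift-e₀ f (pairs E)
swaps-pairs (suc E) f (suc (suc x)) = trans (swaps-shift-↑ f (pairs E) x) (swaps-pairs E (λ y → f (↑ y)) x)

joined-pairs : ∀ E {A : Set} {κ : Fin (E * 2) → A} → Joined κ (pairs E) → ∀ x → κ (flip E x) ≡ κ x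
joined-pairs (suc E) (e ∷ j) zero    = sym e
joined-pairs (suc E) (e ∷ j) (suc zero)    = e
joined-pairs (suc E) (e ∷ j) (suc (suc x)) = joined-pairs E (Allₚ.map⁻ j) x

-- Labelled planar maps with a marked last vertex.

module _ {N : ℕ} where

  lab-cong : ∀ {c} {f g : Fin N → Fin N} → (∀ x → f x ≡ g x) → Lab f c → Lab g c
  lab-cong f≗g L .lab    = lab L
  lab-cong f≗g L .inv x  = trans (cong (lab L) (sym (f≗g x))) (inv L x)
  lab-cong f≗g L .onto   = onto L

  -- Formulated by invariants because after a deletion it is enough to extend an invariant to the
  -- deleted darts; no path has to be rerouted.
  Connected : (σ α : Fin N → Fin N) → Set
  Connected σ α = ∀ (κ : Fin N → ℕ) → (∀ x → κ (σ x) ≡ κ x) → (∀ x → κ (α x) ≡ κ x) → ∀ x y → κ x ≡ κ y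

  module _ {f : Fin N → Fin N} (inj : Inj f) {c} (L : Lab f c) where

    -- The orbit of `x` is split off under the new label `zero`. Its old label is still attained,
    -- namely at `y`.
    refine : ∀ {x y} → lab L x ≡ lab L y → ¬ Orb f x y → Lab f (suc c)
    refine {x} {y} x~y x≁y = record { lab = ℓ ; inv = ℓ-inv ; onto = ℓ-onto }
      where
      ℓ : Fin N → Fin (suc c)
      ℓ z with orb? inj x z
      ... | yes _ = zero
      ... | no  _ = suc (lab L z)
      ℓ-inv : ∀ z → ℓ (f z) ≡ ℓ z
      ℓ-inv z with orb? inj x z | orb? inj x (f z)
      ... | yes _ | yes _ = refl
      ... | yes o | no ¬o = ⊥-elim (¬o (orb-trans o (_ , step stop)))
      ... | no ¬o | yes o = ⊥-elim (¬o (orb-trans o (orb-sym inj (_ , step stop))))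
      ... | no _  | no _  = cong suc (inv L z)
      ℓ-yes : ∀ {z} → Orb f x z → ℓ z ≡ zero
      ℓ-yes {z} o with orb? inj x z
      ... | yes _ = refl
      ... | no ¬o = ⊥-elim (¬o o)
      ℓ-no : ∀ {z} → ¬ Orb f x z → ℓ z ≡ suc (lab L z)
      ℓ-no {z} ¬o with orb? inj x z
      ... | yes o = ⊥-elim (¬o o)
      ... | no _  = refl
      ℓ-onto : ∀ i → ∃ λ z → ℓ z ≡ i
      ℓ-onto zero = x , ℓ-yes (_ , stop)
      ℓ-onto (suc i) with onto L i
      ... | z , refl with orb? inj x z
      ... | no ¬o = z , ℓ-no ¬o
      ... | yes o = y , trans (ℓ-no x≁y) (cong suc (trans (sym x~y) (lab-orb L o)))

-- A connected planar map without loops or multiple edges. The outer walk from the root is cut at the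
-- first visit of the vertex discovered last: the darts before the cut are root ∷ bef, those after it
-- are top ∷ stk, and top starts at that last vertex.
record OMap {N : ℕ} (α : Fin N → Fin N) : Set where
  field
    σ       : Fin N → Fin N
    σ-inj   : Inj σ
    V F     : ℕ
    vl      : Lab σ V
    fl      : Lab (σ ∘ α) F
    euler   : 2 * (V + F) ≡ N + 4
    conn    : Connected σ α

  φ : Fin N → Fin N
  φ = σ ∘ α

  vert : Fin N → Fin V
  vert = lab vl

  face : Fin N → Fin F
  face = lab fl

  field
    noLoop  : ∀ x → vert x ≢ vert (α x)
    noMulti : ∀ x y → vert x ≡ vert y → vert (α x) ≡ vert (α y) → x ≡ y
    root    : Fin N
    top     : Fin N
    bef     : List (Fin N)
    stk     : List (Fin N)
    walk₁   : Walk φ root (root ∷ bef) top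
    walk₂   : Walk φ top (top ∷ stk) root
    uniq    : Unique ((root ∷ bef) ++ top ∷ stk)
    new     : All (λ d → vert d ≢ vert top) (root ∷ bef)
    all     : ∀ x → vert x ≡ vert top ⊎ Any (λ d → vert x ≡ vert d) (root ∷ bef)

open OMap

module _ {E : ℕ} {σ : Fin (E * 2) → Fin (E * 2)} (inj : Inj σ) (conn : Connected σ (flip E)) where

  φ-inj : Inj (σ ∘ flip E)
  φ-inj {x} {y} eq = trans (sym (flip-invol E x)) (trans (cong (flip E) (inj eq)) (flip-invol E y))

  euler-flip : ∀ {V F} → Lab σ V → Lab (σ ∘ flip E) F → V + F ≤ 2 + E
  euler-flip vl fl = subst (λ l → _ ≤ 2 + l) (length-pairs E)
    (Euler.euler-≤ inj (pairs E) vl (lab-cong (sym ∘ swaps-pairs E σ) fl)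
      (λ κ κσ j → conn κ κσ (joined-pairs E j)))

  module _ {V F} (vl : Lab σ V) (fl : Lab (σ ∘ flip E) F) (eq : V + F ≡ 2 + E) where

    abstract
      -- A label shared by two orbits could be refined to V + 1 labels, exceeding Euler's bound,
      -- which is already attained.
      vert-tight : ∀ {x y} → lab vl x ≡ lab vl y → Orb σ x y
      vert-tight {x} {y} x~y with orb? inj x y
      ... | yes o = o
      ... | no ¬o = ⊥-elim (ℕₚ.<-irrefl eq (euler-flip (refine inj vl x~y ¬o) fl))

      face-tight : ∀ {x y} → lab fl x ≡ lab fl y → Orb (σ ∘ flip E) x y
      face-tight {x} {y} x~y with orb? φ-inj x y
      ... | yes o = o
      ... | no ¬o = ⊥-elim (ℕₚ.<-irrefl eq (subst (_≤ 2 + E) (ℕₚ.+-suc V F) (euler-flip vl (refine φ-inj fl x~y ¬o))))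

module Planar {E : ℕ} (X : OMap (flip E)) where

  eulerE : V X + F X ≡ 2 + E
  eulerE = ℕₚ.*-cancelˡ-≡ (V X + F X) (2 + E) 2 (trans (euler X) (trans (ℕₚ.+-comm (E * 2) 4) (ℕₚ.*-comm (2 + E) 2)))

  v-orb : ∀ {x y} → vert X x ≡ vert X y → Orb (σ X) x y
  v-orb = vert-tight {E} (σ-inj X) (conn X) (vl X) (fl X) eulerE

  f-orb : ∀ {x y} → face X x ≡ face X y → Orb (φ X) x y
  f-orb = face-tight {E} (σ-inj X) (conn X) (vl X) (fl X) eulerE

euler-half : ∀ {E V F} → V + F ≡ 2 + E → 2 * (V + F) ≡ E * 2 + 4
euler-half {E} eq = trans (cong (2 *_) eq) (trans (ℕₚ.*-comm 2 (2 + E)) (ℕₚ.+-comm 4 (E * 2)))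

-- Inserting an edge into a rotation.

-- Insertion of an edge {e₀ , e₁}: e₁ enters the vertex of c immediately before c in the rotation, and e₀
-- likewise before m, or at a new vertex if m = nothing. Redirecting the darts that led to m or c is mark.
module Insert {N : ℕ} (m : Maybe (Fin N)) (c : Fin N) (m≢c : m ≢ just c) where

  mark : Fin N → Fin (2 + N)
  mark x with Maybeₚ.≡-dec Fₚ._≟_ m (just x) | x Fₚ.≟ c
  ... | yes _ | _     = e₀
  ... | no  _ | yes _ = e₁
  ... | no  _ | no  _ = ↑ x

  mark-elim : ∀ (P : Fin N → Fin (2 + N) → Set) x → (m ≡ just x → P x e₀) → (x ≡ c → P x e₁) →
              (m ≢ just x → x ≢ c → P x (↑ x)) → P x (mark x)
  mark-elim P x p₀ p₁ p with Maybeₚ.≡-dec Fₚ._≟_ m (just x) | x Fₚ.≟ c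
  ... | yes e | _     = p₀ e
  ... | no  _ | yes e = p₁ e
  ... | no  a | no  b = p a b

  mark-e₀ : ∀ {x} → m ≡ just x → mark x ≡ e₀
  mark-e₀ {x} e = mark-elim (λ _ y → y ≡ e₀) x (λ _ → refl) (λ { refl → ⊥-elim (m≢c e) }) (λ ne _ → ⊥-elim (ne e))

  mark-c : mark c ≡ e₁
  mark-c = mark-elim (λ _ y → y ≡ e₁) c (λ e → ⊥-elim (m≢c e)) (λ _ → refl) (λ _ ne → ⊥-elim (ne refl))

  mark-↑ : ∀ {x} → m ≢ just x → x ≢ c → mark x ≡ ↑ x
  mark-↑ {x} a b = mark-elim (λ x y → y ≡ ↑ x) x (λ e → ⊥-elim (a e)) (λ e → ⊥-elim (b e)) (λ _ _ → refl)

  e₀-mark : ∀ {x} → mark x ≡ e₀ → m ≡ just x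
  e₀-mark {x} = mark-elim (λ x y → y ≡ e₀ → m ≡ just x) x (λ e _ → e) (λ _ ()) (λ _ _ ())

  e₁-mark : ∀ {x} → mark x ≡ e₁ → x ≡ c
  e₁-mark {x} = mark-elim (λ x y → y ≡ e₁ → x ≡ c) x (λ _ ()) (λ e _ → e) (λ _ _ ())

  ↑-mark : ∀ {x z} → mark x ≡ ↑ z → x ≡ z
  ↑-mark {x} {z} = mark-elim (λ x y → y ≡ ↑ z → x ≡ z) x (λ _ ()) (λ _ ()) (λ { _ _ refl → refl })

  ↑-mark-c : ∀ {x z} → mark x ≡ ↑ z → z ≢ c
  ↑-mark-c {x} {z} = mark-elim (λ x y → y ≡ ↑ z → z ≢ c) x (λ _ ()) (λ _ ()) (λ { _ b refl → b })

  mark-inj : Inj mark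
  mark-inj {x} {y} eq = mark-elim (λ y z → mark x ≡ z → x ≡ y) y
    (λ e eq → Maybeₚ.just-injective (trans (sym (e₀-mark eq)) e))
    (λ e eq → trans (e₁-mark eq) (sym e))
    (λ _ _ → ↑-mark) eq

  ins : (Fin N → Fin N) → Fin (2 + N) → Fin (2 + N)
  ins σ zero    = maybe′ ↑ e₀ m
  ins σ (suc zero)    = ↑ c
  ins σ (suc (suc x)) = mark (σ x)

  module _ {σ : Fin N → Fin N} (inj : Inj σ) where

    private
      up≢e₁ : ∀ (m : Maybe (Fin N)) → maybe′ ↑ e₀ m ≢ e₁
      up≢e₁ (just _) ()
      up≢e₁ nothing  ()

      up-e₁ : ∀ (m : Maybe (Fin N)) {c} → m ≢ just c → maybe′ ↑ e₀ m ≢ ↑ c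
      up-e₁ (just _) ne refl = ne refl
      up-e₁ nothing  ne ()

      up-mark : ∀ x → maybe′ ↑ e₀ m ≢ mark x
      up-mark x eq = mark-elim (λ x y → maybe′ ↑ e₀ m ≢ y) x
        (λ e eq′ → case subst (λ m → maybe′ ↑ e₀ m ≡ e₀) e eq′ of λ ())
        (λ _ → up≢e₁ m)
        (λ a _ → up-e₁ m a) eq

    ins-inj : Inj (ins σ)
    ins-inj {zero}  {zero}  eq = refl
    ins-inj {zero}  {suc zero}  eq = ⊥-elim (up-e₁ m m≢c eq)
    ins-inj {zero}  {suc (suc y)} eq = ⊥-elim (up-mark _ eq)
    ins-inj {suc zero}  {zero}  eq = ⊥-elim (up-e₁ m m≢c (sym eq))
    ins-inj {suc zero}  {suc zero}  eq = refl
    ins-inj {suc zero}  {suc (suc y)} eq = ⊥-elim (↑-mark-c (sym eq) refl)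
    ins-inj {suc (suc x)} {zero}  eq = ⊥-elim (up-mark _ (sym eq))
    ins-inj {suc (suc x)} {suc zero}  eq = ⊥-elim (↑-mark-c eq refl)
    ins-inj {suc (suc x)} {suc (suc y)} eq = cong ↑ (inj (mark-inj eq))

  module _ {A : Set} {ℓ : Fin (2 + N) → A} {σ : Fin N → Fin N} (inv : ∀ x → ℓ (ins σ x) ≡ ℓ x) where

    private
      inv-e₀ : ∀ {x} → m ≡ just x → ℓ e₀ ≡ ℓ (↑ x)
      inv-e₀ e = trans (sym (inv e₀)) (cong (λ m → ℓ (maybe′ ↑ e₀ m)) e)

    inv-mark : ∀ x → ℓ (mark x) ≡ ℓ (↑ x)
    inv-mark x = mark-elim (λ x y → ℓ y ≡ ℓ (↑ x)) x inv-e₀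
      (λ { refl → sym (inv e₁) }) (λ _ _ → refl)

  module _ {f : Fin N → Fin N} {g : Fin (2 + N) → Fin (2 + N)} (fg : ∀ x → g (↑ x) ≡ mark (f x)) where

    -- A walk survives the insertion up to the first redirected dart, where it turns into the new
    -- edge. The start is exempt, since it does not matter how it is entered.
    walk⁺ : ∀ {x xs y} → Walk f x (x ∷ xs) y → All (λ z → mark z ≡ ↑ z) xs →
            Walk g (↑ x) (map ↑ (x ∷ xs)) (mark y)
    walk⁺ {x} (step stop) [] = step (subst (λ z → Walk g z [] (mark (f x))) (sym (fg x)) stop)
    walk⁺ {x} {_ ∷ xs} {y} (step w@(step _)) (p ∷ ps) =
      step (subst (λ z → Walk g z (map ↑ (f x ∷ xs)) (mark y)) (sym (trans (fg x) p)) (walk⁺ w ps))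

    walk⁻ : ∀ {x} xs {y} → Walk g (↑ x) (map ↑ (x ∷ xs)) y →
            ∃ λ z → Walk f x (x ∷ xs) z × y ≡ mark z
    walk⁻ {x} [] (step stop) = f x , step stop , fg x
    walk⁻ {x} (z ∷ xs) (step w) with trans (sym (fg x)) (walk-head w)
    ... | eq with walk⁻ xs (subst (λ t → Walk g t _ _) (trans (fg x) eq) w)
    ...   | t , v , e = t , step (subst (λ u → Walk f u (z ∷ xs) t) (sym (↑-mark eq)) v) , e

-- With `r` the root this is the dart at the pointer: beyond the end of the list the outer walk is
-- back at the root.
hd : {A : Set} → List A → A → A
hd []      r = r
hd (x ∷ _) _ = x

hd-∷ : ∀ {A : Set} xs {r : A} → xs ++ r ∷ [] ≡ hd xs r ∷ drop 1 (xs ++ r ∷ [])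
hd-∷ []      = refl
hd-∷ (_ ∷ _) = refl

walk-hd : ∀ {A : Set} {f : A → A} {x xs r} → Walk f x xs r → x ≡ hd xs r
walk-hd stop     = refl
walk-hd (step _) = refl

allPairs-++⁻ : ∀ {A : Set} {R : A → A → Set} xs {ys} → AllPairs R (xs ++ ys) →
               AllPairs R xs × AllPairs R ys × All (λ x → All (R x) ys) xs
allPairs-++⁻ []       p        = [] , p , []
allPairs-++⁻ (x ∷ xs) (px ∷ p) with allPairs-++⁻ xs p
... | a , b , c = Allₚ.++⁻ˡ xs px ∷ a , b , Allₚ.++⁻ʳ xs px ∷ c

unique-++⁻ : ∀ {A : Set} (xs : List A) {ys} → Unique (xs ++ ys) →
             Unique xs × Unique ys × (∀ {z} → z ∈ xs → z ∈ ys → ⊥)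
unique-++⁻ xs p with allPairs-++⁻ xs p
... | a , b , c = a , b , λ z∈ z∈′ → All.lookup (All.lookup c z∈) z∈′ refl

∈-map-↑ : ∀ {N} {x : Fin N} {xs} → ↑ x ∈ map ↑ xs → x ∈ xs
∈-map-↑ x∈ with ∈ₚ.∈-map⁻ ↑ x∈
... | _ , y∈ , refl = y∈

unique-insert : ∀ {N} (xs ys : List (Fin N)) zs → Unique (xs ++ ys) → Unique zs →
                (∀ {x} → ↑ x ∉ zs) → Unique (map ↑ xs ++ zs ++ map ↑ ys)
unique-insert xs ys zs u uz fresh with unique-++⁻ xs u
... | ux , uy , dis = Uniqueₚ.++⁺ (Uniqueₚ.map⁺ ↑-inj ux)
  (Uniqueₚ.++⁺ uz (Uniqueₚ.map⁺ ↑-inj uy) λ { (p , q) → case ∈ₚ.∈-map⁻ ↑ q of λ { (_ , _ , refl) → fresh p } })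
  λ { (p , q) → case ∈ₚ.∈-map⁻ ↑ p of λ { (_ , x∈ , refl) → case ∈ₚ.∈-++⁻ zs q of λ
      { (inj₁ x∈zs) → fresh x∈zs ; (inj₂ x∈ys) → dis x∈ (∈-map-↑ x∈ys) } } }

Distinct : ∀ {N} {α : Fin N → Fin N} → OMap α → List (Fin N) → Set
Distinct X = AllPairs (λ x y → vert X x ≢ vert X y)

module _ {E : ℕ} (m : Maybe (Fin (E * 2))) (c : Fin (E * 2)) (m≢c : m ≢ just c) where

  open Insert m c m≢c

  ins-conn : ∀ {σ} → Connected σ (flip E) → Connected (ins σ) (flip (suc E))
  ins-conn {σ} conn κ κσ κα x y = trans (to-c x) (sym (to-c y))
    where
    to-c : ∀ x → κ x ≡ κ (↑ c)
    to-c zero          = trans (sym (κα e₀)) (sym (κσ e₁))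
    to-c (suc zero)    = sym (κσ e₁)
    to-c (suc (suc x)) = conn (λ x → κ (↑ x)) (λ x → trans (sym (inv-mark κσ (σ x))) (κσ (↑ x))) (λ x → κα (↑ x)) x c

  module _ {σ : Fin (E * 2) → Fin (E * 2)} (inj : Inj σ) (reach : ∀ x y → Reach σ (flip E) x y) where

    private
      R = Reach (ins σ) (flip (suc E))

      R-trans : ∀ {x y z} → R x y → R y z → R x z
      R-trans here     q = q
      R-trans (viaσ p) q = viaσ (R-trans p q)
      R-trans (viaα p) q = viaα (R-trans p q)

      R-mark : ∀ x {y} → R (↑ x) y → R (mark x) y
      R-mark x {y} r = mark-elim (λ _ z → R z y) x
        (λ e → viaσ (subst (λ m → R (maybe′ ↑ e₀ m) y) (sym e) r)) (λ { refl → viaσ r }) (λ _ _ → r)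

      lift : ∀ {x y} → Reach σ (flip E) x y → R (↑ x) (↑ y)
      lift here     = here
      lift (viaσ r) = viaσ (R-mark _ (lift r))
      lift (viaα r) = viaα (lift r)

      c⇝ : ∀ y → R (↑ c) y
      -- The dart that used to precede `c` in its rotation now leads to `e₁`.
      c⇝e₁ : R (↑ c) e₁
      c⇝e₁ with inj⇒onto inj c
      ... | x , refl = R-trans (lift (reach c x)) (viaσ (subst (λ z → R z e₁) (sym mark-c) here))
      c⇝ zero          = R-trans c⇝e₁ (viaα here)
      c⇝ (suc zero)    = c⇝e₁
      c⇝ (suc (suc y)) = lift (reach c y)

    ins-reach : ∀ x y → R x y
    ins-reach zero          y = viaα (viaσ (c⇝ y))
    ins-reach (suc zero)    y = viaσ (c⇝ y)
    ins-reach (suc (suc x)) y = R-trans (lift (reach x c)) (c⇝ y)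

  tail-walk : ∀ {f g root rest} → (∀ x → g (↑ x) ≡ mark (f x)) → Walk f c rest root →
              (∀ {z} → z ∈ root ∷ rest → z ≢ c → mark z ≡ ↑ z) → Unique (root ∷ rest) →
              Walk g (↑ c) (map ↑ rest) (↑ root)
  tail-walk fg stop plain u = stop
  tail-walk {rest = _ ∷ rest} fg w@(step _) plain ((r≢c ∷ _) ∷ c∉ ∷ u) =
    subst (Walk _ (↑ c) (map ↑ (c ∷ rest))) (plain (here refl) r≢c)
      (walk⁺ fg w (All.tabulate λ z∈ → plain (there (there z∈)) λ { refl → All.lookup c∉ z∈ refl }))

-- Attaching a leaf and closing a face at the pointer.

module Pointer {E : ℕ} (X : OMap (flip E)) (as rest : List (Fin (E * 2)))
               (split : top X ∷ stk X ≡ as ++ rest) (dist : Distinct X ((top X ∷ stk X) ++ root X ∷ [])) where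

  c : Fin (E * 2)
  c = hd rest (root X)

  U : Unique (root X ∷ ((bef X ++ as) ++ rest))
  U = subst Unique (trans (cong ((root X ∷ bef X) ++_) split) (sym (Listₚ.++-assoc (root X ∷ bef X) as rest))) (uniq X)

  walk-c : Walk (φ X) (top X) as c
  walk-c with walk-split as (subst (λ xs → Walk (φ X) (top X) xs (root X)) split (walk₂ X))
  ... | _ , v , w = subst (Walk (φ X) (top X) as) (walk-hd w) v

  walk-rest : Walk (φ X) c rest (root X)
  walk-rest with walk-split as (subst (λ xs → Walk (φ X) (top X) xs (root X)) split (walk₂ X))
  ... | _ , v , w = subst (λ z → Walk (φ X) z rest (root X)) (walk-hd w) w

  before-c : ∀ {z} → z ∈ bef X ++ as → z ≢ c
  before-c z∈ = go rest U z∈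
    where
    go : ∀ rest → Unique (root X ∷ ((bef X ++ as) ++ rest)) → ∀ {z} → z ∈ bef X ++ as → z ≢ hd rest (root X)
    go []      (r∉ ∷ u) z∈ refl = All.lookup r∉ (∈ₚ.∈-++⁺ˡ z∈) refl
    go (_ ∷ _) (r∉ ∷ u) z∈ refl = proj₂ (proj₂ (unique-++⁻ (bef X ++ as) u)) z∈ (here refl)

  U-rest : Unique (root X ∷ rest)
  U-rest with r∉ ∷ u ← U = Allₚ.++⁻ʳ (bef X ++ as) r∉ ∷ proj₁ (proj₂ (unique-++⁻ (bef X ++ as) u))

  private
    dist-all : Distinct X (as ++ (rest ++ root X ∷ []))
    dist-all = subst (Distinct X) (trans (cong (_++ root X ∷ []) split) (Listₚ.++-assoc as rest _)) dist

  dist-rest : Distinct X (rest ++ root X ∷ [])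
  dist-rest = proj₁ (proj₂ (allPairs-++⁻ as dist-all))

  dist-as : ∀ {a} → a ∈ as → All (λ y → vert X a ≢ vert X y) (rest ++ root X ∷ [])
  dist-as = All.lookup (proj₂ (proj₂ (allPairs-++⁻ as dist-all)))

  dist-c : All (λ y → vert X c ≢ vert X y) (drop 1 (rest ++ root X ∷ []))
  dist-c = AllPairs.head (subst (Distinct X) (hd-∷ rest) dist-rest)

  c∈ : c ∈ rest ++ root X ∷ []
  c∈ = subst (c ∈_) (sym (hd-∷ rest)) (here refl)

-- At the pointer the outer walk now takes `e₁` to the leaf and `e₀` back. So all that lies before
-- the pointer moves into the part before the cut, and the leaf becomes the last vertex.
module Leaf {E : ℕ} (X : OMap (flip E)) (as rest : List (Fin (E * 2)))
            (split : top X ∷ stk X ≡ as ++ rest) (dist : Distinct X ((top X ∷ stk X) ++ root X ∷ [])) where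

  open Pointer X as rest split dist
  open Insert nothing c (λ ())

  private
    σ⁺ = ins (σ X)

    vl⁺ : Lab σ⁺ (suc (V X))
    vl⁺ .lab zero          = zero
    vl⁺ .lab (suc zero)    = suc (vert X c)
    vl⁺ .lab (suc (suc x)) = suc (vert X x)
    vl⁺ .inv zero          = refl
    vl⁺ .inv (suc zero)    = refl
    vl⁺ .inv (suc (suc x)) = trans (mark-elim (λ y z → lab vl⁺ z ≡ suc (vert X y)) (σ X x)
                               (λ ()) (λ e → cong (suc ∘ vert X) (sym e)) (λ _ _ → refl))
                               (cong suc (inv (vl X) x))
    vl⁺ .onto zero         = zero , refl
    vl⁺ .onto (suc i)      = ↑ (proj₁ (onto (vl X) i)) , cong suc (proj₂ (onto (vl X) i))

    fl⁺ : Lab (σ⁺ ∘ flip (suc E)) (F X)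
    fl⁺ .lab zero          = face X c
    fl⁺ .lab (suc zero)    = face X c
    fl⁺ .lab (suc (suc x)) = face X x
    fl⁺ .inv zero          = refl
    fl⁺ .inv (suc zero)    = refl
    fl⁺ .inv (suc (suc x)) = trans (mark-elim (λ y z → lab fl⁺ z ≡ face X y) (φ X x)
                               (λ ()) (λ e → cong (face X) (sym e)) (λ _ _ → refl)) (inv (fl X) x)
    fl⁺ .onto i            = ↑ (proj₁ (onto (fl X) i)) , proj₂ (onto (fl X) i)

    v⁺ = lab vl⁺

    bef⁺ = map ↑ (bef X ++ as) ++ e₁ ∷ []

    plain : ∀ {z} → z ≢ c → mark z ≡ ↑ z
    plain = mark-↑ λ ()

    noMulti⁺ : ∀ x y → v⁺ x ≡ v⁺ y → v⁺ (flip (suc E) x) ≡ v⁺ (flip (suc E) y) → x ≡ y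
    noMulti⁺ zero          zero          p q = refl
    noMulti⁺ (suc zero)    (suc zero)    p q = refl
    noMulti⁺ (suc (suc x)) (suc (suc y)) p q = cong ↑ (noMulti X x y (Fₚ.suc-injective p) (Fₚ.suc-injective q))
    noMulti⁺ zero          (suc zero)    () q
    noMulti⁺ zero          (suc (suc y)) () q
    noMulti⁺ (suc zero)    zero          () q
    noMulti⁺ (suc zero)    (suc (suc y)) p ()
    noMulti⁺ (suc (suc x)) zero          () q
    noMulti⁺ (suc (suc x)) (suc zero)    p ()

    noLoop⁺ : ∀ x → v⁺ x ≢ v⁺ (flip (suc E) x)
    noLoop⁺ zero          ()
    noLoop⁺ (suc zero)    ()
    noLoop⁺ (suc (suc x)) = noLoop X x ∘ Fₚ.suc-injective

    -- The only vertex that could be missed is the former last one. It is visited at the old `top`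
    -- or, if the pointer still stands there, at `e₁`, which starts at the same vertex.
    all-old : ∀ x → Any (λ d → suc (vert X x) ≡ v⁺ d) (↑ (root X) ∷ bef⁺)
    all-old x with all X x
    ... | inj₂ x∈ = Anyₚ.++⁺ˡ {xs = map ↑ ((root X ∷ bef X) ++ as)} (Anyₚ.map⁺ (Anyₚ.++⁺ˡ (Any.map (cong suc) x∈)))
    ... | inj₁ x~top = go as split
      where
      go : ∀ as → top X ∷ stk X ≡ as ++ rest →
           Any (λ d → suc (vert X x) ≡ v⁺ d) (↑ (root X) ∷ map ↑ (bef X ++ as) ++ e₁ ∷ [])
      go [] eq = Anyₚ.++⁺ʳ (map ↑ ((root X ∷ bef X) ++ []))
        (here (cong suc (trans x~top (cong (λ xs → vert X (hd xs (root X))) eq))))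
      go (a ∷ as) eq = Anyₚ.++⁺ˡ {xs = map ↑ ((root X ∷ bef X) ++ a ∷ as)}
        (Anyₚ.map⁺ (Anyₚ.++⁺ʳ (root X ∷ bef X) (here (cong suc (trans x~top (cong (vert X) (Listₚ.∷-injectiveˡ eq)))))))

  leaf : OMap (flip (suc E))
  leaf .σ       = σ⁺
  leaf .σ-inj   = ins-inj (σ-inj X)
  leaf .V       = suc (V X)
  leaf .F       = F X
  leaf .vl      = vl⁺
  leaf .fl      = fl⁺
  leaf .euler   = euler-half {suc E} {suc (V X)} (cong suc (Planar.eulerE X))
  leaf .conn    = ins-conn {E} nothing c (λ ()) (conn X)
  leaf .noLoop  = noLoop⁺
  leaf .noMulti = noMulti⁺
  leaf .root    = ↑ (root X)
  leaf .top     = e₀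
  leaf .bef     = bef⁺
  leaf .stk     = map ↑ rest
  leaf .walk₁   = walk-++ (subst (Walk _ _ _) mark-c
                    (walk⁺ (λ _ → refl) (walk-++ (walk₁ X) walk-c)
                      (All.tabulate λ z∈ → plain (before-c z∈))))
                    (step stop)
  leaf .walk₂   = step (tail-walk {E} nothing c (λ ()) (λ _ → refl) walk-rest (λ _ → plain) U-rest)
  leaf .uniq    = subst Unique (sym (Listₚ.++-assoc (map ↑ ((root X ∷ bef X) ++ as)) (e₁ ∷ []) _))
                    (unique-insert ((root X ∷ bef X) ++ as) rest (e₁ ∷ e₀ ∷ []) U
                      (((λ ()) ∷ []) ∷ [] ∷ []) λ { (here ()) ; (there (here ())) })
  leaf .new     = Allₚ.++⁺ {xs = map ↑ ((root X ∷ bef X) ++ as)} (Allₚ.map⁺ (All.universal (λ _ ()) _)) ((λ ()) ∷ [])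
  leaf .all     zero          = inj₁ refl
  leaf .all     (suc zero)    = inj₂ (all-old c)
  leaf .all     (suc (suc x)) = inj₂ (all-old x)

  private
    map-snoc : ∀ xs → map ↑ (xs ++ root X ∷ []) ≡ map ↑ xs ++ ↑ (root X) ∷ []
    map-snoc xs = Listₚ.map-++ ↑ xs _

  leaf-distinct : Distinct leaf ((e₀ ∷ map ↑ rest) ++ ↑ (root X) ∷ [])
  leaf-distinct = subst (Distinct leaf) (cong (e₀ ∷_) (map-snoc rest))
    (Allₚ.map⁺ (All.universal (λ _ ()) _) ∷ AllPairsₚ.map⁺ (AllPairs.map (_∘ Fₚ.suc-injective) dist-rest))

  leaf-adj : ∀ d → v⁺ d ≡ v⁺ e₀ → All (λ y → v⁺ (flip (suc E) d) ≢ v⁺ y) (drop 1 (map ↑ rest ++ ↑ (root X) ∷ []))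
  leaf-adj (suc zero)    ()
  leaf-adj (suc (suc _)) ()
  leaf-adj zero _ = subst (All _) (trans (sym (Listₚ.drop-map 1 (rest ++ root X ∷ []))) (cong (drop 1) (map-snoc rest)))
    (Allₚ.map⁺ (All.map (_∘ Fₚ.suc-injective) dist-c))

-- The chord cuts the darts from `top` up to the pointer off the outer face; together with `e₁` they
-- bound the new inner face. As at least the two darts `a` and `b` are hidden, the far end of the
-- chord is among the vertices that `adj` forbids as neighbours, so no multiple edge arises.
module Chord {E : ℕ} (X : OMap (flip E)) (a b : Fin (E * 2)) (hid rest : List (Fin (E * 2)))
             (split : top X ∷ stk X ≡ (a ∷ b ∷ hid) ++ rest)
             (dist : Distinct X ((top X ∷ stk X) ++ root X ∷ []))
             (adj : ∀ d → vert X d ≡ vert X (top X) →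
                    All (λ y → vert X (flip E d) ≢ vert X y) (drop 1 (stk X ++ root X ∷ []))) where

  private
    hidden : List (Fin (E * 2))
    hidden = a ∷ b ∷ hid

  open Pointer X hidden rest split dist

  private
    top∈ : top X ∈ hidden
    top∈ = here (Listₚ.∷-injectiveˡ split)

    top-rest : All (λ y → vert X (top X) ≢ vert X y) (rest ++ root X ∷ [])
    top-rest = dist-as top∈

    top≁c : vert X (top X) ≢ vert X c
    top≁c = All.lookup top-rest c∈

    adj-rest : ∀ d → vert X d ≡ vert X (top X) → All (λ y → vert X (flip E d) ≢ vert X y) (rest ++ root X ∷ [])
    adj-rest d e = Allₚ.++⁻ʳ hid (subst (All _)
      (trans (cong (λ xs → drop 1 (xs ++ root X ∷ [])) (Listₚ.∷-injectiveʳ split)) (Listₚ.++-assoc hid rest _)) (adj d e))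

  m≢c : just (top X) ≢ just c
  m≢c eq = top≁c (cong (vert X) (Maybeₚ.just-injective eq))

  open Insert (just (top X)) c m≢c

  private
    σ⁺ = ins (σ X)

    vl⁺ : Lab σ⁺ (V X)
    vl⁺ .lab zero          = vert X (top X)
    vl⁺ .lab (suc zero)    = vert X c
    vl⁺ .lab (suc (suc x)) = vert X x
    vl⁺ .inv zero          = refl
    vl⁺ .inv (suc zero)    = refl
    vl⁺ .inv (suc (suc x)) = trans (mark-elim (λ y z → lab vl⁺ z ≡ vert X y) (σ X x)
                               (λ e → cong (vert X) (Maybeₚ.just-injective e)) (λ e → cong (vert X) (sym e)) (λ _ _ → refl))
                               (inv (vl X) x)
    vl⁺ .onto i            = ↑ (proj₁ (onto (vl X) i)) , proj₂ (onto (vl X) i)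

    v⁺ = lab vl⁺

    rest∉hidden : ∀ {z} → z ∈ root X ∷ rest → z ∉ hidden
    rest∉hidden (here refl) z∈ = All.lookup (AllPairs.head U) (∈ₚ.∈-++⁺ˡ (∈ₚ.∈-++⁺ʳ (bef X) z∈)) refl
    rest∉hidden (there z∈′) z∈ = proj₂ (proj₂ (unique-++⁻ (bef X ++ hidden) (AllPairs.tail U))) (∈ₚ.∈-++⁺ʳ (bef X) z∈) z∈′

    bef∉hidden : ∀ {z} → z ∈ root X ∷ bef X → z ∉ hidden
    bef∉hidden z∈ z∈′ = proj₂ (proj₂ (unique-++⁻ (root X ∷ bef X) (proj₁ (unique-++⁻ (root X ∷ (bef X ++ hidden)) U)))) z∈ z∈′

    c∈′ : c ∈ root X ∷ rest
    c∈′ with ∈ₚ.∈-++⁻ rest c∈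
    ... | inj₁ c∈rest     = there c∈rest
    ... | inj₂ (here c≡r) = here c≡r

    φ-inj′ : Inj (φ X)
    φ-inj′ = φ-inj {E} (σ-inj X) (conn X)

    pre-top : ∀ {x} → φ X x ≡ top X → x ∉ hidden
    pre-top eq with walk-last (walk₁ X)
    ... | l , l∈ , e with φ-inj′ (trans eq (sym e))
    ... | refl = bef∉hidden l∈

    pre-c : ∀ {x} → φ X x ≡ c → x ∈ hidden
    pre-c eq with walk-last walk-c
    ... | l , l∈ , e with φ-inj′ (trans eq (sym e))
    ... | refl = l∈

    out-hidden : ∀ {x} → φ X x ≢ c → x ∈ hidden → φ X x ∈ hidden
    out-hidden ne x∈ with walk-next walk-c x∈
    ... | inj₁ φx∈ = φx∈
    ... | inj₂ e   = ⊥-elim (ne e)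

    into-hidden : ∀ {x} → φ X x ≢ top X → φ X x ∈ hidden → x ∈ hidden
    into-hidden ne φx∈ with arrive walk-c (∈ₚ.∈-++⁺ˡ φx∈)
    ... | inj₁ e = ⊥-elim (ne e)
    ... | inj₂ (t , t∈ , e) = subst (_∈ hidden) (sym (φ-inj′ e)) t∈

    hidden-face : ∀ {x} → x ∈ hidden → face X x ≡ face X (top X)
    hidden-face x∈ with ∈ₚ.∈-∃++ x∈
    ... | ys , zs , eq = sym (lab-orb (fl X) (_ , proj₁ (walk-split-at ys (subst (λ xs → Walk (φ X) (top X) xs c) eq walk-c))))

    -- `zero` labels the new inner face and the other darts keep their label. The decision is an
    -- argument so that invariance can be proved by cases on it.
    side : ∀ {x} → Dec (x ∈ hidden) → Fin (suc (F X))
    side (yes _)     = zero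
    side {x} (no _)  = suc (face X x)

    side-in : ∀ {x} (d : Dec (x ∈ hidden)) → x ∈ hidden → side d ≡ zero
    side-in (yes _) _  = refl
    side-in (no ¬p) x∈ = ⊥-elim (¬p x∈)

    side-out : ∀ {x} (d : Dec (x ∈ hidden)) → x ∉ hidden → side d ≡ suc (face X x)
    side-out (yes p) x∉ = ⊥-elim (x∉ p)
    side-out (no _)  _  = refl

    fl⁺ : Lab (σ⁺ ∘ flip (suc E)) (suc (F X))
    fl⁺ .lab zero          = suc (face X (top X))
    fl⁺ .lab (suc zero)    = zero
    fl⁺ .lab (suc (suc x)) = side (x ∈? hidden)
    fl⁺ .inv zero          = trans (side-out (c ∈? hidden) (rest∉hidden c∈′))
                               (cong suc (sym (lab-orb (fl X) (_ , walk-c))))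
    fl⁺ .inv (suc zero)    = side-in (top X ∈? hidden) top∈
    fl⁺ .inv (suc (suc x)) = mark-elim (λ y z → φ X x ≡ y → lab fl⁺ z ≡ side (x ∈? hidden)) (φ X x)
      (λ e _ → case Maybeₚ.just-injective e of λ top≡ →
        sym (trans (side-out (x ∈? hidden) (pre-top (sym top≡)))
                   (cong suc (trans (sym (inv (fl X) x)) (cong (face X) (sym top≡))))))
      (λ e _ → sym (side-in (x ∈? hidden) (pre-c e)))
      (λ ne₀ ne₁ _ → plain-step (λ e → ne₀ (cong just (sym e))) ne₁ (x ∈? hidden)) refl
      where
      plain-step : φ X x ≢ top X → φ X x ≢ c → (d : Dec (x ∈ hidden)) → side (φ X x ∈? hidden) ≡ side d
      plain-step ne₀ ne₁ (yes x∈) = side-in (φ X x ∈? hidden) (out-hidden ne₁ x∈)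
      plain-step ne₀ ne₁ (no x∉)  = trans (side-out (φ X x ∈? hidden) (x∉ ∘ into-hidden ne₀)) (cong suc (inv (fl X) x))
    fl⁺ .onto zero    = e₁ , refl
    fl⁺ .onto (suc i) with onto (fl X) i
    ... | x , refl = choose (x ∈? hidden)
      where
      choose : Dec (x ∈ hidden) → ∃ λ y → lab fl⁺ y ≡ suc (face X x)
      -- A hidden witness belonged to the outer face, whose label `e₀` still carries.
      choose (yes x∈) = e₀ , cong suc (sym (hidden-face x∈))
      choose (no x∉)  = ↑ x , side-out (x ∈? hidden) x∉

    noLoop⁺ : ∀ x → v⁺ x ≢ v⁺ (flip (suc E) x)
    noLoop⁺ zero          = top≁c
    noLoop⁺ (suc zero)    = top≁c ∘ sym
    noLoop⁺ (suc (suc x)) = noLoop X x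

    not-adjacent : ∀ d → vert X (top X) ≡ vert X d → vert X c ≢ vert X (flip E d)
    not-adjacent d p q = All.lookup (adj-rest d (sym p)) c∈ (sym q)

    not-adjacent′ : ∀ d → vert X c ≡ vert X d → vert X (top X) ≢ vert X (flip E d)
    not-adjacent′ d p q = not-adjacent (flip E d) q (trans p (cong (vert X) (sym (flip-invol E d))))

    noMulti⁺ : ∀ x y → v⁺ x ≡ v⁺ y → v⁺ (flip (suc E) x) ≡ v⁺ (flip (suc E) y) → x ≡ y
    noMulti⁺ zero          zero          p q = refl
    noMulti⁺ (suc zero)    (suc zero)    p q = refl
    noMulti⁺ (suc (suc x)) (suc (suc y)) p q = cong ↑ (noMulti X x y p q)
    noMulti⁺ zero          (suc zero)    p q = ⊥-elim (top≁c p)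
    noMulti⁺ (suc zero)    zero          p q = ⊥-elim (top≁c q)
    noMulti⁺ zero          (suc (suc y)) p q = ⊥-elim (not-adjacent y p q)
    noMulti⁺ (suc (suc x)) zero          p q = ⊥-elim (not-adjacent x (sym p) (sym q))
    noMulti⁺ (suc zero)    (suc (suc y)) p q = ⊥-elim (not-adjacent′ y p q)
    noMulti⁺ (suc (suc x)) (suc zero)    p q = ⊥-elim (not-adjacent′ x (sym p) (sym q))

    plain : ∀ {z} → z ≢ top X → z ≢ c → mark z ≡ ↑ z
    plain ne₀ = mark-↑ (λ e → ne₀ (sym (Maybeₚ.just-injective e)))

    all⁺ : ∀ x → vert X x ≡ vert X (top X) ⊎ Any (λ d → vert X x ≡ v⁺ d) (map ↑ (root X ∷ bef X))
    all⁺ x with all X x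
    ... | inj₁ e  = inj₁ e
    ... | inj₂ x∈ = inj₂ (Anyₚ.map⁺ x∈)

  chord : OMap (flip (suc E))
  chord .σ       = σ⁺
  chord .σ-inj   = ins-inj (σ-inj X)
  chord .V       = V X
  chord .F       = suc (F X)
  chord .vl      = vl⁺
  chord .fl      = fl⁺
  chord .euler   = euler-half {suc E} {V X} (trans (ℕₚ.+-suc (V X) (F X)) (cong suc (Planar.eulerE X)))
  chord .conn    = ins-conn {E} (just (top X)) c m≢c (conn X)
  chord .noLoop  = noLoop⁺
  chord .noMulti = noMulti⁺
  chord .root    = ↑ (root X)
  chord .top     = e₀
  chord .bef     = map ↑ (bef X)
  chord .stk     = map ↑ rest
  chord .walk₁   = subst (Walk _ _ _) (mark-e₀ refl) (walk⁺ (λ _ → refl) (walk₁ X)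
                     (All.tabulate λ z∈ → plain (λ { refl → bef∉hidden (there z∈) top∈ }) (before-c (∈ₚ.∈-++⁺ˡ z∈))))
  chord .walk₂   = step (tail-walk {E} (just (top X)) c m≢c (λ _ → refl) walk-rest
                     (λ z∈ → plain λ { refl → rest∉hidden z∈ top∈ }) U-rest)
  chord .uniq    = unique-insert (root X ∷ bef X) rest (e₀ ∷ []) U′ ([] ∷ []) λ { (here ()) }
    where
    U′ : Unique ((root X ∷ bef X) ++ rest)
    U′ with unique-++⁻ (root X ∷ (bef X ++ hidden)) U
    ... | u₁ , u₂ , dis = Uniqueₚ.++⁺ (proj₁ (unique-++⁻ (root X ∷ bef X) u₁)) u₂ λ (p , q) → dis (∈ₚ.∈-++⁺ˡ p) q
  chord .new     = Allₚ.map⁺ (new X)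
  chord .all     zero          = inj₁ refl
  chord .all     (suc zero)    = all⁺ c
  chord .all     (suc (suc x)) = all⁺ x

  private
    map-snoc : ∀ xs → map ↑ (xs ++ root X ∷ []) ≡ map ↑ xs ++ ↑ (root X) ∷ []
    map-snoc xs = Listₚ.map-++ ↑ xs _

    drop-snoc : map ↑ (drop 1 (rest ++ root X ∷ [])) ≡ drop 1 (map ↑ rest ++ ↑ (root X) ∷ [])
    drop-snoc = trans (sym (Listₚ.drop-map 1 (rest ++ root X ∷ []))) (cong (drop 1) (map-snoc rest))

  chord-distinct : Distinct chord ((e₀ ∷ map ↑ rest) ++ ↑ (root X) ∷ [])
  chord-distinct = subst (Distinct chord) (cong (e₀ ∷_) (map-snoc rest))
    (Allₚ.map⁺ top-rest ∷ AllPairsₚ.map⁺ dist-rest)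

  -- The new neighbour, the vertex of `c`, is the next one on the outer walk and hence just the one
  -- that `drop 1` spares. By `dist` it does not occur again, and the older neighbours stay
  -- excluded.
  chord-adj : ∀ d → v⁺ d ≡ v⁺ e₀ → All (λ y → v⁺ (flip (suc E) d) ≢ v⁺ y) (drop 1 (map ↑ rest ++ ↑ (root X) ∷ []))
  chord-adj zero          _ = subst (All _) drop-snoc (Allₚ.map⁺ dist-c)
  chord-adj (suc zero)    e = ⊥-elim (top≁c (sym e))
  chord-adj (suc (suc d)) e = subst (All _) drop-snoc (Allₚ.map⁺ (Allₚ.drop⁺ 1 (adj-rest d e)))

-- Words and the maps they build.

-- Instructions for a map with a pointer into top ∷ stk; the index counts the darts from the pointer on.
-- pass moves the pointer one dart on, grow attaches a leaf at the pointer, and close joins the last vertex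
-- to the vertex two darts beyond the pointer.
data Word : ℕ → Set where
  edge  : Word 1
  pass  : ∀ {p} → Word (suc p) → Word p
  close : ∀ {p} → Word (suc (suc p)) → Word (suc p)
  grow  : ∀ {p} → Word p → Word (suc p)

-- `dist` includes the root because the pointer is there when `rest` is empty. By `adj` no edge at
-- the last vertex ends beyond the next vertex of the outer walk. `reach` keeps connectedness in the
-- form of paths, in which the finished map must supply it.
record State (p : ℕ) : Set where
  field
    E        : ℕ
    X        : OMap (flip E)
    psd rest : List (Fin (E * 2))
    split    : top X ∷ stk X ≡ psd ++ rest
    len      : length rest ≡ p
    dist     : Distinct X ((top X ∷ stk X) ++ root X ∷ [])
    adj      : ∀ d → vert X d ≡ vert X (top X) →
               All (λ y → vert X (flip E d) ≢ vert X y) (drop 1 (stk X ++ root X ∷ []))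
    reach    : ∀ x y → Reach (σ X) (flip E) x y

open State

single : OMap (flip 1)
single .σ       = id
single .σ-inj e = e
single .V       = 2
single .F       = 1
single .vl      = record { lab = id ; inv = λ _ → refl ; onto = λ i → i , refl }
single .fl      = record { lab = λ _ → zero ; inv = λ _ → refl ; onto = λ { zero → e₀ , refl } }
single .euler   = refl
single .conn κ _ κα zero       zero       = refl
single .conn κ _ κα zero       (suc zero) = κα e₁
single .conn κ _ κα (suc zero) zero       = κα e₀
single .conn κ _ κα (suc zero) (suc zero) = refl
single .noLoop  zero       ()
single .noLoop  (suc zero) ()
single .noMulti x y e _ = e
single .root    = e₁
single .top     = e₀
single .bef     = []
single .stk     = []
single .walk₁   = step stop
single .walk₂   = step stop
single .uniq    = ((λ ()) ∷ []) ∷ [] ∷ []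
single .new     = (λ ()) ∷ []
single .all zero       = inj₁ refl
single .all (suc zero) = inj₂ (here refl)

init : State 1
init .E     = 1
init .X     = single
init .psd   = []
init .rest  = e₀ ∷ []
init .split = refl
init .len   = refl
init .dist  = ((λ ()) ∷ []) ∷ [] ∷ []
init .adj d _ = []
init .reach zero       zero       = here
init .reach zero       (suc zero) = viaα here
init .reach (suc zero) zero       = viaα here
init .reach (suc zero) (suc zero) = here

passS : ∀ {p} → State (suc p) → State p
passS S = record
  { E = E S ; X = X S ; psd = psd S ++ take 1 (rest S) ; rest = drop 1 (rest S)
  ; split = trans (split S) (trans (cong (psd S ++_) (sym (Listₚ.take++drop≡id 1 (rest S))))
                                   (sym (Listₚ.++-assoc (psd S) (take 1 (rest S)) _)))
  ; len = trans (Listₚ.length-drop 1 (rest S)) (cong (_∸ 1) (len S))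
  ; dist = dist S ; adj = adj S ; reach = reach S }

growS : ∀ {p} → State p → State (suc p)
growS S = record
  { E = suc (E S) ; X = leaf ; psd = [] ; rest = e₀ ∷ map ↑ (rest S) ; split = refl
  ; len = cong suc (trans (Listₚ.length-map ↑ (rest S)) (len S))
  ; dist = leaf-distinct ; adj = leaf-adj
  ; reach = ins-reach {E S} nothing (Pointer.c (X S) (psd S) (rest S) (split S) (dist S)) (λ ()) (σ-inj (X S)) (reach S) }
  where open Leaf (X S) (psd S) (rest S) (split S) (dist S)

-- A closed face has degree at least three, since there are no multiple edges.
two-hidden : ∀ {A : Set} {p} (psd rest : List A) → length rest ≡ suc (suc p) →
             ∃ λ a → ∃ λ b → ∃ λ hid → psd ++ rest ≡ (a ∷ b ∷ hid) ++ drop 2 rest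
two-hidden []            (x ∷ y ∷ zs) _ = x , y , [] , refl
two-hidden (a ∷ [])      (x ∷ y ∷ zs) _ = a , x , y ∷ [] , refl
two-hidden (a ∷ b ∷ psd) (x ∷ y ∷ zs) _ = a , b , psd ++ x ∷ y ∷ [] ,
  cong (λ xs → a ∷ b ∷ xs) (sym (Listₚ.++-assoc psd (x ∷ y ∷ []) zs))

module Close {p} (S : State (suc (suc p))) where

  hid₂ = two-hidden (psd S) (rest S) (len S)

  open Chord (X S) (proj₁ hid₂) (proj₁ (proj₂ hid₂)) (proj₁ (proj₂ (proj₂ hid₂))) (drop 2 (rest S))
    (trans (split S) (proj₂ (proj₂ (proj₂ hid₂)))) (dist S) (adj S) public

closeS : ∀ {p} → State (suc (suc p)) → State (suc p)
closeS S = record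
  { E = suc (E S) ; X = chord ; psd = [] ; rest = e₀ ∷ map ↑ (drop 2 (rest S)) ; split = refl
  ; len = cong suc (trans (Listₚ.length-map ↑ (drop 2 (rest S)))
                          (trans (Listₚ.length-drop 2 (rest S)) (cong (_∸ 2) (len S))))
  ; dist = chord-distinct ; adj = chord-adj
  ; reach = ins-reach {E S} (just (top (X S))) _ m≢c (σ-inj (X S)) (reach S) }
  where open Close S

build : ∀ {p} → Word p → State p
build edge      = init
build (pass w)  = passS (build w)
build (close w) = closeS (build w)
build (grow w)  = growS (build w)

-- Isomorphic maps come from equal words.

-- Stated for bare rotations and involutions, so that it compares labelled maps with each other and
-- with rooted maps.
record Iso {N N′ : ℕ} (σ α : Fin N → Fin N) (r : Fin N) (σ′ α′ : Fin N′ → Fin N′) (r′ : Fin N′) : Set where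
  field
    to   : Fin N → Fin N′
    inj  : Inj to
    sur  : ∀ y → ∃ λ x → to x ≡ y
    to-σ : ∀ x → to (σ x) ≡ σ′ (to x)
    to-α : ∀ x → to (α x) ≡ α′ (to x)
    to-r : to r ≡ r′

module _ {N N′ : ℕ} {σ α : Fin N → Fin N} {r : Fin N} {σ′ α′ : Fin N′ → Fin N′} {r′ : Fin N′} where

  iso-size : Iso σ α r σ′ α′ r′ → N ≡ N′
  iso-size I = ℕₚ.≤-antisym (Fₚ.injective⇒≤ inj) (Fₚ.injective⇒≤ {f = λ y → proj₁ (sur y)}
    λ {y} {z} e → trans (sym (proj₂ (sur y))) (trans (cong to e) (proj₂ (sur z))))
    where open Iso I

  iso-sym : Iso σ α r σ′ α′ r′ → Iso σ′ α′ r′ σ α r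
  iso-sym I = record
    { to   = from
    ; inj  = λ {y} {z} e → trans (sym (proj₂ (sur y))) (trans (cong to e) (proj₂ (sur z)))
    ; sur  = λ x → to x , inj (proj₂ (sur (to x)))
    ; to-σ = λ y → inj (trans (proj₂ (sur (σ′ y))) (trans (cong σ′ (sym (proj₂ (sur y)))) (sym (to-σ (from y)))))
    ; to-α = λ y → inj (trans (proj₂ (sur (α′ y))) (trans (cong α′ (sym (proj₂ (sur y)))) (sym (to-α (from y)))))
    ; to-r = inj (trans (proj₂ (sur r′)) (sym to-r)) }
    where
    open Iso I
    from = λ y → proj₁ (sur y)

  iso-trans : ∀ {N″} {σ″ α″ : Fin N″ → Fin N″} {r″} →
              Iso σ α r σ′ α′ r′ → Iso σ′ α′ r′ σ″ α″ r″ → Iso σ α r σ″ α″ r″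
  iso-trans I J = record
    { to   = J.to ∘ I.to
    ; inj  = I.inj ∘ J.inj
    ; sur  = λ z → proj₁ (I.sur (proj₁ (J.sur z))) , trans (cong J.to (proj₂ (I.sur _))) (proj₂ (J.sur z))
    ; to-σ = λ x → trans (cong J.to (I.to-σ x)) (J.to-σ _)
    ; to-α = λ x → trans (cong J.to (I.to-α x)) (J.to-α _)
    ; to-r = trans (cong J.to I.to-r) J.to-r }
    where
    module I = Iso I
    module J = Iso J

-- A walk is determined by its start, so two of them differ only in length, and the longer lists the
-- end of the shorter.
walk-compare : ∀ {A : Set} {f : A → A} {x xs y ys z} → Walk f x xs y → Walk f x ys z →
               (xs ≡ ys × y ≡ z) ⊎ (∃ λ t → xs ≡ ys ++ z ∷ t) ⊎ (∃ λ t → ys ≡ xs ++ y ∷ t)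
walk-compare stop     stop     = inj₁ (refl , refl)
walk-compare stop     (step w) = inj₂ (inj₂ (_ , refl))
walk-compare (step v) stop     = inj₂ (inj₁ (_ , refl))
walk-compare (step v) (step w) with walk-compare v w
... | inj₁ (refl , refl)     = inj₁ (refl , refl)
... | inj₂ (inj₁ (t , refl)) = inj₂ (inj₁ (t , refl))
... | inj₂ (inj₂ (t , refl)) = inj₂ (inj₂ (t , refl))

MapIso : ∀ {E E′} → OMap (flip E) → OMap (flip E′) → Set
MapIso {E} {E′} X Y = Iso (σ X) (flip E) (root X) (σ Y) (flip E′) (root Y)

module Zipper {E E′ : ℕ} (X : OMap (flip E)) (Y : OMap (flip E′)) (I : MapIso X Y) where

  open Iso I

  to-φ : ∀ x → to (φ X x) ≡ φ Y (to x)
  to-φ x = trans (to-σ _) (cong (σ Y) (to-α x))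

  vert-to : ∀ {x y} → vert X x ≡ vert X y → vert Y (to x) ≡ vert Y (to y)
  vert-to e = lab-orb (vl Y) (_ , walk-map to-σ (proj₂ (Planar.v-orb X e)))

  vert-from : ∀ {x y} → vert Y (to x) ≡ vert Y (to y) → vert X x ≡ vert X y
  vert-from e = reflect (proj₂ (Planar.v-orb Y e)) refl refl
    where
    reflect : ∀ {z zs w x y} → Walk (σ Y) z zs w → z ≡ to x → w ≡ to y → vert X x ≡ vert X y
    reflect stop     refl e = cong (vert X) (inj e)
    reflect {x = x} (step w) refl e = trans (sym (inv (vl X) x)) (reflect w (sym (to-σ x)) e)

  private
    walk₁′ : Walk (φ Y) (root Y) (map to (root X ∷ bef X)) (to (top X))
    walk₁′ = subst (λ r → Walk (φ Y) r (map to (root X ∷ bef X)) (to (top X))) to-r (walk-map to-φ (walk₁ X))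

    not-old : ∀ {z} → z ∈ map to (root X ∷ bef X) → vert Y (to (top X)) ≢ vert Y z
    not-old z∈ e with ∈ₚ.∈-map⁻ to z∈
    ... | d , d∈ , refl = All.lookup (new X) d∈ (sym (vert-from e))

  -- The cut is intrinsic. If one of the two lists ran past the end of the other, it would already
  -- contain a dart at every vertex, its own last vertex included, contradicting `new`.
  zipper₁ : map to (root X ∷ bef X) ≡ root Y ∷ bef Y × to (top X) ≡ top Y
  zipper₁ with walk-compare walk₁′ (walk₁ Y)
  ... | inj₁ eqs = eqs
  ... | inj₂ (inj₁ (t , eq)) with all Y (to (top X))
  ...   | inj₁ e = ⊥-elim (not-old (subst (top Y ∈_) (sym eq) (∈ₚ.∈-insert (root Y ∷ bef Y))) e)
  ...   | inj₂ a with find a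
  ...     | d , d∈ , e = ⊥-elim (not-old (subst (d ∈_) (sym eq) (∈ₚ.∈-++⁺ˡ d∈)) e)
  zipper₁ | inj₂ (inj₂ (t , eq)) with sur (top Y)
  ... | t′ , to-t′ with all X t′
  ...   | inj₁ e = ⊥-elim (All.lookup (new Y) (subst (to (top X) ∈_) (sym eq) (∈ₚ.∈-insert (map to (root X ∷ bef X))))
                     (trans (vert-to (sym e)) (cong (vert Y) to-t′)))
  ...   | inj₂ a with find a
  ...     | d , d∈ , e = ⊥-elim (All.lookup (new Y) (subst (to d ∈_) (sym eq) (∈ₚ.∈-++⁺ˡ (∈ₚ.∈-map⁺ to d∈)))
                     (trans (vert-to (sym e)) (cong (vert Y) to-t′)))

  to-top : to (top X) ≡ top Y
  to-top = proj₂ zipper₁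

  private
    root∉ : ∀ {E} (X : OMap (flip E)) → root X ∉ top X ∷ stk X
    root∉ X r∈ = proj₂ (proj₂ (unique-++⁻ (root X ∷ bef X) (uniq X))) (here refl) r∈

    walk₂′ : Walk (φ Y) (top Y) (map to (top X ∷ stk X)) (root Y)
    walk₂′ = subst₂ (λ a b → Walk (φ Y) a (map to (top X ∷ stk X)) b) to-top to-r (walk-map to-φ (walk₂ X))

  -- Both walks end at the root, which neither list contains.
  zipper₂ : map to (top X ∷ stk X) ≡ top Y ∷ stk Y
  zipper₂ with walk-compare walk₂′ (walk₂ Y)
  ... | inj₁ (eq , _) = eq
  ... | inj₂ (inj₂ (t , eq)) = ⊥-elim (root∉ Y (subst (root Y ∈_) (sym eq) (∈ₚ.∈-insert (map to (top X ∷ stk X)))))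
  ... | inj₂ (inj₁ (t , eq)) with ∈ₚ.∈-map⁻ to (subst (root Y ∈_) (sym eq) (∈ₚ.∈-insert (top Y ∷ stk Y)))
  ...   | d , d∈ , e = ⊥-elim (root∉ X (subst (_∈ top X ∷ stk X) (sym (inj (trans to-r e))) d∈))

module _ {E E′ : ℕ} {m : Maybe (Fin (E * 2))} {c : Fin (E * 2)} (m≢c : m ≢ just c)
         {m′ : Maybe (Fin (E′ * 2))} {c′ : Fin (E′ * 2)} (m′≢c′ : m′ ≢ just c′) where

  private
    module M = Insert m c m≢c
    module M′ = Insert m′ c′ m′≢c′

  -- Fixing `e₀`, the isomorphism fixes `e₁` and so permits no mixing of old and new darts. A
  -- redirected dart is recognised by its image `e₀` or `e₁`, and its former target is read off from
  -- the images of these two.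
  strip : ∀ {σ r σ′ r′} (I : Iso (M.ins σ) (flip (suc E)) (↑ r) (M′.ins σ′) (flip (suc E′)) (↑ r′)) →
          Iso.to I e₀ ≡ e₀ → Iso σ (flip E) r σ′ (flip E′) r′
  strip {σ} {r} {σ′} {r′} I to-e₀ = record
    { to   = to′
    ; inj  = λ {x} {y} e → ↑-inj (inj (trans (to-↑ x) (trans (cong ↑ e) (sym (to-↑ y)))))
    ; sur  = sur′
    ; to-σ = to′-σ
    ; to-α = λ x → ↑-inj (trans (sym (to-↑ _)) (trans (to-α (↑ x)) (cong (flip (suc E′)) (to-↑ x))))
    ; to-r = ↑-inj (trans (sym (to-↑ r)) to-r) }
    where
    open Iso I
    to-e₁ : to e₁ ≡ e₁
    to-e₁ = trans (to-α e₀) (cong (flip (suc E′)) to-e₀)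
    lower : ∀ x → ∃ λ y → to (↑ x) ≡ ↑ y
    lower x with to (↑ x) in eq
    ... | zero        = case inj (trans eq (sym to-e₀)) of λ ()
    ... | suc zero    = case inj (trans eq (sym to-e₁)) of λ ()
    ... | suc (suc y) = y , refl
    to′ : Fin (E * 2) → Fin (E′ * 2)
    to′ x = proj₁ (lower x)
    to-↑ : ∀ x → to (↑ x) ≡ ↑ (to′ x)
    to-↑ x = proj₂ (lower x)
    sur′ : ∀ y → ∃ λ x → to′ x ≡ y
    sur′ y with sur (↑ y)
    ... | zero        , e = case trans (sym to-e₀) e of λ ()
    ... | suc zero    , e = case trans (sym to-e₁) e of λ ()
    ... | suc (suc x) , e = x , ↑-inj (trans (sym (to-↑ x)) e)
    step-σ : ∀ x → to (M.mark (σ x)) ≡ M′.mark (σ′ (to′ x))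
    step-σ x = trans (to-σ (↑ x)) (cong (M′.ins σ′) (to-↑ x))
    to′-σ : ∀ x → to′ (σ x) ≡ σ′ (to′ x)
    to′-σ x = M.mark-elim (λ y z → to z ≡ M′.mark (σ′ (to′ x)) → to′ y ≡ σ′ (to′ x)) (σ x)
      (λ e eq → ↑-inj (trans (sym (to-↑ _))
        (trans (cong (λ m → to (maybe′ ↑ e₀ m)) (sym e))
        (trans (to-σ e₀) (trans (cong (M′.ins σ′) to-e₀)
               (cong (maybe′ ↑ e₀) (M′.e₀-mark (trans (sym eq) to-e₀))))))))
      (λ e eq → ↑-inj (trans (sym (to-↑ _)) (trans (cong (to ∘ ↑) e)
        (trans (to-σ e₁) (trans (cong (M′.ins σ′) to-e₁) (cong ↑ (sym (M′.e₁-mark (trans (sym eq) to-e₁)))))))))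
      (λ _ _ eq → sym (M′.↑-mark (trans (sym eq) (to-↑ _))))
      (step-σ x)

private
  -- The index fixes the number of darts from the pointer on and the isomorphism fixes the total.
  -- This tells `pass` from the other instructions, which leave the pointer at `top`.
  same-psd : ∀ {p} (S S′ : State p) → MapIso (X S) (X S′) → length (psd S) ≡ length (psd S′)
  same-psd S S′ I = ℕₚ.+-cancelʳ-≡ _ (length (psd S)) (length (psd S′)) (begin
    length (psd S) + length (rest S′)         ≡⟨ cong (length (psd S) +_) (trans (len S′) (sym (len S))) ⟩
    length (psd S) + length (rest S)          ≡⟨ Listₚ.length-++ (psd S) ⟨
    length (psd S ++ rest S)                  ≡⟨ cong length (split S) ⟨
    length (top (X S) ∷ stk (X S))            ≡⟨ Listₚ.length-map (Iso.to I) (top (X S) ∷ stk (X S)) ⟨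
    length (map (Iso.to I) (top (X S) ∷ stk (X S))) ≡⟨ cong length (Zipper.zipper₂ (X S) (X S′) I) ⟩
    length (top (X S′) ∷ stk (X S′))          ≡⟨ cong length (split S′) ⟩
    length (psd S′ ++ rest S′)                ≡⟨ Listₚ.length-++ (psd S′) ⟩
    length (psd S′) + length (rest S′)        ∎)
    where open ≡-Reasoning

  passed : ∀ {p} (S : State (suc p)) → length (psd (passS S)) ≢ 0
  passed S e = go (rest S) (len S) (trans (sym (Listₚ.length-++ (psd S))) e)
    where
    go : ∀ {p} xs → length xs ≡ suc p → length (psd S) + length (take 1 xs) ≢ 0
    go (x ∷ xs) _ e = case trans (ℕₚ.+-comm 1 (length (psd S))) e of λ ()

  not-single : ∀ {E} (X : OMap (flip E)) → E ≢ 0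
  not-single X refl = Fₚ.¬Fin0 (root X)

  suc≢1 : ∀ {p q} (S : State p) (S′ : State q) → E S′ ≡ suc (E S) → ¬ MapIso single (X S′)
  suc≢1 S S′ refl I = not-single (X S) (sym (ℕₚ.suc-injective (ℕₚ.*-cancelʳ-≡ 1 (suc (E S)) 2 (iso-size I))))

  -- The rotation fixes `top` after attaching a leaf, but not after closing a face.
  leaf≄chord : ∀ {p q} (S : State (suc (suc p))) (S′ : State q) → ¬ MapIso (X (closeS S)) (X (growS S′))
  leaf≄chord S S′ I = case inj (trans (to-σ e₀) (trans (cong (σ (X (growS S′))) to-top) (sym to-top))) of λ ()
    where
    open Iso I
    open Zipper (X (closeS S)) (X (growS S′)) I

-- The last instruction is visible in the map with its pointer: `pass` in the position of the
-- pointer, `edge` in the number of edges, `grow` and `close` in the rotation at `top`.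
build-inj : ∀ {p} (w w′ : Word p) → MapIso (X (build w)) (X (build w′)) → w ≡ w′
build-inj edge      edge       I = refl
build-inj (pass w)  (pass w′)  I = cong pass (build-inj w w′ I)
build-inj (close w) (close w′) I = cong close (build-inj w w′
  (strip {E (build w)} {E (build w′)} (Close.m≢c (build w)) (Close.m≢c (build w′)) I
    (Zipper.to-top (X (build (close w))) (X (build (close w′))) I)))
build-inj (grow w)  (grow w′)  I = cong grow (build-inj w w′
  (strip {E (build w)} {E (build w′)} (λ ()) (λ ()) I (Zipper.to-top (X (build (grow w))) (X (build (grow w′))) I)))
build-inj (close w) (grow w′)  I = ⊥-elim (leaf≄chord (build w) (build w′) I)
build-inj (grow w)  (close w′) I = ⊥-elim (leaf≄chord (build w′) (build w) (iso-sym I))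
build-inj edge      (grow w′)  I = ⊥-elim (suc≢1 (build w′) (build (grow w′)) refl I)
build-inj edge      (close w′) I = ⊥-elim (suc≢1 (build w′) (build (close w′)) refl I)
build-inj (grow w)  edge       I = ⊥-elim (suc≢1 (build w) (build (grow w)) refl (iso-sym I))
build-inj (close w) edge       I = ⊥-elim (suc≢1 (build w) (build (close w)) refl (iso-sym I))
build-inj edge      (pass w′)  I = ⊥-elim (passed (build w′) (sym (same-psd init (passS (build w′)) I)))
build-inj (close w) (pass w′)  I = ⊥-elim (passed (build w′) (sym (same-psd (closeS (build w)) (passS (build w′)) I)))
build-inj (grow w)  (pass w′)  I = ⊥-elim (passed (build w′) (sym (same-psd (growS (build w)) (passS (build w′)) I)))
build-inj (pass w)  edge       I = ⊥-elim (passed (build w) (same-psd (passS (build w)) init I))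
build-inj (pass w)  (close w′) I = ⊥-elim (passed (build w) (same-psd (passS (build w)) (closeS (build w′)) I))
build-inj (pass w)  (grow w′)  I = ⊥-elim (passed (build w) (same-psd (passS (build w)) (growS (build w′)) I))

vertices# : ∀ {p} → Word p → ℕ
vertices# edge      = 1
vertices# (pass w)  = vertices# w
vertices# (close w) = vertices# w
vertices# (grow w)  = suc (vertices# w)

build-V : ∀ {p} (w : Word p) → V (X (build w)) ≡ suc (vertices# w)
build-V edge      = refl
build-V (pass w)  = build-V w
build-V (close w) = build-V w
build-V (grow w)  = cong suc (build-V w)

-- From labelled maps to rooted maps.

module Output {E : ℕ} (X : OMap (flip E)) (reach : ∀ x y → Reach (σ X) (flip E) x y) where

  private
    module P = Planar X

    σ⁻¹ : Fin (E * 2) → Fin (E * 2)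
    σ⁻¹ y = proj₁ (inj⇒onto (σ-inj X) y)

    σ-σ⁻¹ : ∀ y → σ X (σ⁻¹ y) ≡ y
    σ-σ⁻¹ y = proj₂ (inj⇒onto (σ-inj X) y)

    φ-inj′ : Inj (φ X)
    φ-inj′ = φ-inj {E} (σ-inj X) (conn X)

    V≤ : V X ≤ nCycles (σ X)
    V≤ = lab≤cover (vl X) (CycleReps.cover (σ-inj X))

    F≤ : F X ≤ nCycles (φ X)
    F≤ = lab≤cover (fl X) (CycleReps.cover φ-inj′)

    -- Labels bound the numbers of cycles from below and Euler's inequality bounds their sum from
    -- above by the same value.
    cycles≡ : nCycles (σ X) + nCycles (φ X) ≡ V X + F X
    cycles≡ = ℕₚ.≤-antisym
      (ℕₚ.≤-trans (euler-flip {E} (σ-inj X) (conn X) (CycleReps.cycleLab (σ-inj X)) (CycleReps.cycleLab φ-inj′))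
                   (ℕₚ.≤-reflexive (sym P.eulerE)))
      (ℕₚ.+-mono-≤ V≤ F≤)

    nCycles-σ : nCycles (σ X) ≡ V X
    nCycles-σ = ℕₚ.≤-antisym (ℕₚ.+-cancelʳ-≤ (F X) _ _ (ℕₚ.≤-trans
      (euler-flip {E} (σ-inj X) (conn X) (CycleReps.cycleLab (σ-inj X)) (fl X)) (ℕₚ.≤-reflexive (sym P.eulerE)))) V≤

  rootedMap : RootedMap
  rootedMap = record
    { N = E * 2
    ; σ = permutation (σ X) σ⁻¹ σ-σ⁻¹ (λ x → σ-inj X (σ-σ⁻¹ (σ X x)))
    ; α = flip E
    ; root = root X
    ; α-invol = flip-invol E
    ; α-fpf = flip-fpf E
    ; connected = reach
    ; planar = trans (cong (2 *_) cycles≡) (euler X) }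

  outerplanar : ∀ {n} → V X ≡ suc n → SimpleOuterplanar n rootedMap
  outerplanar eq = record
    { vertices = trans nCycles-σ eq
    ; noLoop   = λ d c → noLoop X d (lab-orb (vl X) (cycle⇒orb c))
    ; noMulti  = λ d e c c′ → noMulti X d e (lab-orb (vl X) (cycle⇒orb c)) (lab-orb (vl X) (cycle⇒orb c′))
    ; outer    = outer }
    where
    outer : ∀ d → ∃ λ e → SameCycle (σ X) d e × SameCycle (φ X) (root X) e
    outer d with all X d
    ... | inj₁ e = top X , orb⇒cycle (P.v-orb e) , orb⇒cycle (_ , walk₁ X)
    ... | inj₂ a with find a
    ...   | e , e∈ , d~e with ∈ₚ.∈-∃++ e∈
    ...     | ys , zs , eq = e , orb⇒cycle (P.v-orb d~e) ,
              orb⇒cycle (_ , proj₁ (walk-split-at ys (subst (λ xs → Walk (φ X) (root X) xs (top X)) eq (walk₁ X))))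

module _ {M M′ : RootedMap} where

  open RootedMap

  ≅⇒iso : M ≅ M′ → Iso (σf M) (α M) (RootedMap.root M) (σf M′) (α M′) (RootedMap.root M′)
  ≅⇒iso (f , f-σ , f-α , f-r) = record
    { to = Inverse.to f
    ; inj = λ {x} {y} e → trans (sym (Inverse.strictlyInverseʳ f x))
                                (trans (cong (Inverse.from f) e) (Inverse.strictlyInverseʳ f y))
    ; sur = λ y → Inverse.from f y , Inverse.strictlyInverseˡ f y
    ; to-σ = f-σ ; to-α = f-α ; to-r = f-r }

  iso⇒≅ : Iso (σf M) (α M) (RootedMap.root M) (σf M′) (α M′) (RootedMap.root M′) → M ≅ M′
  iso⇒≅ I = mk↔ₛ′ to (λ y → proj₁ (sur y)) (λ y → proj₂ (sur y)) (λ x → inj (proj₂ (sur (to x)))) , to-σ , to-α , to-r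
    where open Iso I

-- Renumbering the darts so that the involution is `flip`.

module Pairing {N : ℕ} (α : Fin N → Fin N) (invol : ∀ x → α (α x) ≡ x) (fpf : ∀ x → α x ≢ x) where

  record Partial (E : ℕ) : Set where
    field
      g      : Fin (E * 2) → Fin N
      g-inj  : Inj g
      g-flip : ∀ x → g (flip E x) ≡ α (g x)

  open Partial

  extend : ∀ {E} (P : Partial E) y → (∀ x → g P x ≢ y) → Partial (suc E)
  extend {E} P y y∉ = record { g = h ; g-inj = λ {a} {b} → h-inj a b ; g-flip = h-flip }
    where
    h : Fin (suc E * 2) → Fin N
    h zero          = y
    h (suc zero)    = α y
    h (suc (suc x)) = g P x
    αy∉ : ∀ x → g P x ≢ α y
    αy∉ x e = y∉ (flip E x) (trans (g-flip P x) (trans (cong α e) (invol y)))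
    h-inj : ∀ a b → h a ≡ h b → a ≡ b
    h-inj zero          zero          e = refl
    h-inj zero          (suc zero)    e = ⊥-elim (fpf y (sym e))
    h-inj zero          (suc (suc b)) e = ⊥-elim (y∉ b (sym e))
    h-inj (suc zero)    zero          e = ⊥-elim (fpf y e)
    h-inj (suc zero)    (suc zero)    e = refl
    h-inj (suc zero)    (suc (suc b)) e = ⊥-elim (αy∉ b (sym e))
    h-inj (suc (suc a)) zero          e = ⊥-elim (y∉ a e)
    h-inj (suc (suc a)) (suc zero)    e = ⊥-elim (αy∉ a e)
    h-inj (suc (suc a)) (suc (suc b)) e = cong ↑ (g-inj P e)
    h-flip : ∀ x → h (flip (suc E) x) ≡ α (h x)
    h-flip zero          = refl
    h-flip (suc zero)    = sym (invol y)
    h-flip (suc (suc x)) = g-flip P x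

  module _ (d : Fin N) where

    private
      Missed : ∀ {E} → Partial E → Fin N → Set
      Missed P y = y ≢ d × y ≢ α d × ¬ ∃ λ x → g P x ≡ y

      missed? : ∀ {E} (P : Partial E) y → Dec (Missed P y)
      missed? P y = ¬? (y Fₚ.≟ d) ×-dec ¬? (y Fₚ.≟ α d) ×-dec ¬? (Fₚ.any? λ x → g P x Fₚ.≟ y)

      fill : ∀ fuel {E} (P : Partial E) → (∀ x → g P x ≢ d) → N < fuel + E * 2 →
             ∃ λ E′ → Σ (Partial E′) λ P′ → (∀ x → g P′ x ≢ d) × (∀ y → ¬ Missed P′ y)
      fill zero P _ lt = ⊥-elim (ℕₚ.<⇒≱ lt (Fₚ.injective⇒≤ (g-inj P)))
      fill (suc fuel) {E} P d∉ lt with Fₚ.any? (missed? P)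
      ... | no none = E , P , d∉ , λ y m → none (y , m)
      ... | yes (y , y≢d , y≢αd , y∉) = fill fuel (extend P y λ x e → y∉ (x , e))
              (λ { zero → y≢d ; (suc zero) e → y≢αd (trans (sym (invol y)) (cong α e)) ; (suc (suc x)) → d∉ x })
              (ℕₚ.≤-trans lt (ℕₚ.≤-trans (ℕₚ.≤-reflexive (sym (ℕₚ.+-suc fuel (E * 2)))) (ℕₚ.+-monoʳ-≤ fuel (ℕₚ.n≤1+n _))))

    abstract
      -- Edges are collected greedily in any order, except that the edge of `d` is withheld until
      -- the end; being added last, `d` receives the number `e₀`.
      pairing : ∃ λ E → Σ (Partial (suc E)) λ P → (∀ y → ∃ λ x → g P x ≡ y) × g P e₀ ≡ d
      pairing with fill (suc N) {0} (record { g = λ () ; g-inj = λ {} ; g-flip = λ () }) (λ ()) (s≤s (ℕₚ.m≤m+n N 0))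
      ... | E , P , d∉ , full = E , extend P d d∉ , onto′ , refl
        where
        onto′ : ∀ y → ∃ λ x → g (extend P d d∉) x ≡ y
        onto′ y with y Fₚ.≟ d | y Fₚ.≟ α d | Fₚ.any? (λ x → g P x Fₚ.≟ y)
        ... | yes e | _     | _           = e₀ , sym e
        ... | no  _ | yes e | _           = e₁ , sym e
        ... | no  _ | no  _ | yes (x , e) = ↑ x , e
        ... | no  a | no  b | no  c       = ⊥-elim (full y (a , b , c))

-- The new `top` is the given `t` and not the preimage of the old one, so that it is `e₀` by
-- computation when `t` is.
module Conjugate {N N′ : ℕ} {α : Fin N → Fin N} {α′ : Fin N′ → Fin N′} (X : OMap α)
                 (g : Fin N′ → Fin N) (g-inj : Inj g) (g-onto : ∀ y → ∃ λ x → g x ≡ y)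
                 (g-α : ∀ x → g (α′ x) ≡ α (g x)) (t : Fin N′) (g-t : g t ≡ top X) where

  g⁻ : Fin N → Fin N′
  g⁻ y = proj₁ (g-onto y)

  g-g⁻ : ∀ y → g (g⁻ y) ≡ y
  g-g⁻ y = proj₂ (g-onto y)

  g⁻-g : ∀ x → g⁻ (g x) ≡ x
  g⁻-g x = g-inj (g-g⁻ (g x))

  g⁻-inj : Inj g⁻
  g⁻-inj {y} {z} e = trans (sym (g-g⁻ y)) (trans (cong g e) (g-g⁻ z))

  size : N′ ≡ N
  size = ℕₚ.≤-antisym (Fₚ.injective⇒≤ g-inj) (Fₚ.injective⇒≤ g⁻-inj)

  private
    σ′ = g⁻ ∘ σ X ∘ g

    t≡ : g⁻ (top X) ≡ t
    t≡ = trans (cong g⁻ (sym g-t)) (g⁻-g t)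

    g⁻-φ : ∀ x → g⁻ (φ X x) ≡ σ′ (α′ (g⁻ x))
    g⁻-φ x = cong (g⁻ ∘ σ X) (sym (trans (g-α (g⁻ x)) (cong α (g-g⁻ x))))

    vert-g⁻ : ∀ x → vert X (g (g⁻ x)) ≡ vert X x
    vert-g⁻ x = cong (vert X) (g-g⁻ x)

  conjugate : OMap α′
  conjugate .σ        = σ′
  conjugate .σ-inj e  = g-inj (σ-inj X (g⁻-inj e))
  conjugate .V        = V X
  conjugate .F        = F X
  conjugate .vl       = record
    { lab = vert X ∘ g ; inv = λ x → trans (vert-g⁻ _) (inv (vl X) (g x))
    ; onto = λ i → g⁻ (proj₁ (onto (vl X) i)) , trans (vert-g⁻ _) (proj₂ (onto (vl X) i)) }
  conjugate .fl       = record
    { lab = face X ∘ g ; inv = λ x → trans (cong (face X) (trans (g-g⁻ _) (cong (σ X) (g-α x)))) (inv (fl X) (g x))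
    ; onto = λ i → g⁻ (proj₁ (onto (fl X) i)) , trans (cong (face X) (g-g⁻ _)) (proj₂ (onto (fl X) i)) }
  conjugate .euler    = trans (euler X) (cong (_+ 4) (sym size))
  conjugate .conn κ κσ κα x y = trans (cong κ (sym (g⁻-g x))) (trans
    (conn X (κ ∘ g⁻) (λ z → trans (cong (κ ∘ g⁻ ∘ σ X) (sym (g-g⁻ z))) (κσ (g⁻ z)))
                     (λ z → trans (cong κ (trans (cong (g⁻ ∘ α) (sym (g-g⁻ z)))
                                   (trans (cong g⁻ (sym (g-α (g⁻ z)))) (g⁻-g _)))) (κα (g⁻ z))) (g x) (g y))
    (cong κ (g⁻-g y)))
  conjugate .noLoop x e = noLoop X (g x) (trans e (cong (vert X) (g-α x)))
  conjugate .noMulti x y e e′ = g-inj (noMulti X (g x) (g y) e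
    (trans (cong (vert X) (sym (g-α x))) (trans e′ (cong (vert X) (g-α y)))))
  conjugate .root     = g⁻ (root X)
  conjugate .top      = t
  conjugate .bef      = map g⁻ (bef X)
  conjugate .stk      = map g⁻ (stk X)
  conjugate .walk₁    = subst (Walk _ _ _) t≡ (walk-map g⁻-φ (walk₁ X))
  conjugate .walk₂    = subst (λ z → Walk _ z (z ∷ map g⁻ (stk X)) _) t≡ (walk-map g⁻-φ (walk₂ X))
  conjugate .uniq     = subst (λ z → Unique (map g⁻ (root X ∷ bef X) ++ z ∷ map g⁻ (stk X))) t≡
    (subst Unique (Listₚ.map-++ g⁻ (root X ∷ bef X) (top X ∷ stk X)) (Uniqueₚ.map⁺ g⁻-inj (uniq X)))
  conjugate .new      = Allₚ.map⁺ (All.map (λ {d} ne e → ne (trans (sym (vert-g⁻ d)) (trans e (cong (vert X) g-t)))) (new X))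
  conjugate .all x with all X (g x)
  ... | inj₁ e  = inj₁ (trans e (cong (vert X) (sym g-t)))
  ... | inj₂ x∈ = inj₂ (Anyₚ.map⁺ (Any.map (λ {d} e → trans e (sym (vert-g⁻ d))) x∈))

  conjugate-iso : Iso σ′ α′ (g⁻ (root X)) (σ X) α (root X)
  conjugate-iso = record
    { to = g ; inj = g-inj ; sur = g-onto ; to-σ = λ x → g-g⁻ _ ; to-α = g-α ; to-r = g-g⁻ _ }

-- Removing the edge at the last vertex.

module Last {E : ℕ} (X : OMap (flip (suc E))) (top≡ : top X ≡ e₀) where

  φ-inj′ : Inj (φ X)
  φ-inj′ = φ-inj {suc E} (σ-inj X) (conn X)

  new₀ : All (λ d → vert X d ≢ vert X e₀) (root X ∷ bef X)
  new₀ = subst (λ t → All (λ d → vert X d ≢ vert X t) (root X ∷ bef X)) top≡ (new X)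

  all₀ : ∀ x → vert X x ≡ vert X e₀ ⊎ ∃ λ d → d ∈ root X ∷ bef X × vert X x ≡ vert X d
  all₀ x with all X x
  ... | inj₁ e = inj₁ (trans e (cong (vert X) top≡))
  ... | inj₂ a = inj₂ (find a)

  walk₁₀ : Walk (φ X) (root X) (root X ∷ bef X) e₀
  walk₁₀ = subst (Walk (φ X) (root X) (root X ∷ bef X)) top≡ (walk₁ X)

  walk₂₀ : Walk (φ X) (φ X e₀) (stk X) (root X)
  walk₂₀ with subst (λ t → Walk (φ X) t (t ∷ stk X) (root X)) top≡ (walk₂ X)
  ... | step w = w

  private
    parts = unique-++⁻ (root X ∷ bef X) (subst (λ t → Unique ((root X ∷ bef X) ++ t ∷ stk X)) top≡ (uniq X))

  u-bef : Unique (root X ∷ bef X)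
  u-bef = proj₁ parts

  u-stk : Unique (e₀ ∷ stk X)
  u-stk = proj₁ (proj₂ parts)

  dis : ∀ {z} → z ∈ root X ∷ bef X → z ∈ e₀ ∷ stk X → ⊥
  dis = proj₂ (proj₂ parts)

  e₀∉stk : e₀ ∉ stk X
  e₀∉stk e₀∈ = All.lookup (AllPairs.head u-stk) e₀∈ refl

  e₀∉bef : e₀ ∉ root X ∷ bef X
  e₀∉bef e₀∈ = dis e₀∈ (here refl)

  -- If e₁ were on the outer face after the last vertex, deleting the edge {e₀ , e₁} would leave
  -- the map connected without merging faces, which violates Euler's inequality.
  module _ (σe₀≢ : σ X e₀ ≢ e₀) where

    -- The face permutation sends `e₁` to `σ X e₀`, a dart at the last vertex. None may occur before
    -- `top`, and `top` itself is excluded by `σe₀≢`.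
    e₁∉bef : e₁ ∉ root X ∷ bef X
    e₁∉bef e₁∈ with walk-next walk₁₀ e₁∈
    ... | inj₁ σe₀∈ = All.lookup new₀ σe₀∈ (inv (vl X) e₀)
    ... | inj₂ e    = σe₀≢ e

    private
      ps = shift (pairs E)

      module _ (as bs : List (Fin (suc E * 2))) (eq : stk X ≡ as ++ e₁ ∷ bs) where

        face≡ : face X e₀ ≡ face X e₁
        face≡ = lab-orb (fl X) (_ , step (proj₁ (walk-split-at as (subst (λ xs → Walk (φ X) (φ X e₀) xs (root X)) eq walk₂₀))))

        -- Without the transposition of this edge, `e₀` and `e₁` exchange their images. No label
        -- changes, as both darts lie on one face.
        fl′ : Lab (swaps (σ X) ps) (F X)
        fl′ .lab  = face X
        fl′ .inv zero          = trans (cong (face X) (swaps-shift-e₀ (σ X) (pairs E))) (trans (inv (fl X) e₁) (sym face≡))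
        fl′ .inv (suc zero)    = trans (cong (face X) (swaps-shift-e₁ (σ X) (pairs E))) (trans (inv (fl X) e₀) face≡)
        fl′ .inv (suc (suc x)) =
          trans (cong (face X) (trans (swaps-shift-↑ (σ X) (pairs E) x) (swaps-pairs E (σ X ∘ ↑) x))) (inv (fl X) (↑ x))
        fl′ .onto = onto (fl X)

        module _ (κ : Fin (suc E * 2) → ℕ) (κσ : ∀ x → κ (σ X x) ≡ κ x) (j : Joined κ ps) where

          κ-walk : ∀ {x xs y} → Walk (φ X) x xs y → e₀ ∉ xs → e₁ ∉ xs → κ x ≡ κ y
          κ-walk stop _ _ = refl
          κ-walk {zero}        (step w) a b = ⊥-elim (a (here refl))
          κ-walk {suc zero}    (step w) a b = ⊥-elim (b (here refl))
          κ-walk {suc (suc x)} (step w) a b =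
            trans (sym (trans (κσ (↑ (flip E x))) (joined-pairs E (Allₚ.map⁻ j) x))) (κ-walk w (a ∘ there) (b ∘ there))

          κ-vert : ∀ {x y} → vert X x ≡ vert X y → κ x ≡ κ y
          κ-vert e = orb-inv κσ (Planar.v-orb X e)

          u-stk′ : Unique (as ++ e₁ ∷ bs)
          u-stk′ = subst Unique eq (AllPairs.tail u-stk)

          e₁∈stk : e₁ ∈ stk X
          e₁∈stk = subst (e₁ ∈_) (sym eq) (∈ₚ.∈-insert as)

          -- After `e₁` the walk goes on from `σ X e₀`, at the last vertex, to the root without
          -- using the edge again.
          to-root : κ e₀ ≡ κ (root X)
          to-root with proj₂ (walk-split-at as (subst (λ xs → Walk (φ X) (φ X e₀) xs (root X)) eq walk₂₀))
          ... | step w = trans (sym (κσ e₀)) (κ-walk w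
            (λ e₀∈ → e₀∉stk (subst (e₀ ∈_) (sym eq) (∈ₚ.∈-++⁺ʳ as (there e₀∈))))
            (λ e₁∈ → All.lookup (AllPairs.head (proj₁ (proj₂ (unique-++⁻ as u-stk′)))) e₁∈ refl))

          -- The far end of the edge was discovered earlier, on the stretch from the root to `top`,
          -- which avoids the edge; `to-root` closes the detour.
          κ-joined : κ e₁ ≡ κ e₀
          κ-joined with all₀ e₁
          ... | inj₁ e = ⊥-elim (noLoop X e₀ (sym e))
          ... | inj₂ (d , d∈ , e) with ∈ₚ.∈-∃++ d∈
          ...   | cs , ds , eq′ = trans (κ-vert e) (sym (trans to-root (κ-walk
                  (proj₁ (walk-split-at cs (subst (λ xs → Walk (φ X) (root X) xs e₀) eq′ walk₁₀)))
                  (λ e₀∈ → e₀∉bef (subst (e₀ ∈_) (sym eq′) (∈ₚ.∈-++⁺ˡ e₀∈)))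
                  (λ e₁∈ → dis (subst (e₁ ∈_) (sym eq′) (∈ₚ.∈-++⁺ˡ e₁∈)) (there e₁∈stk)))))

          κ-const : ∀ x y → κ x ≡ κ y
          κ-const = conn X κ κσ λ where
            zero          → κ-joined
            (suc zero)    → sym κ-joined
            (suc (suc x)) → joined-pairs E (Allₚ.map⁻ j) x

    e₁∉stk : e₁ ∉ stk X
    e₁∉stk e₁∈ with ∈ₚ.∈-∃++ e₁∈
    ... | as , bs , eq = ℕₚ.<⇒≱ (ℕₚ.≤-reflexive (sym (Planar.eulerE X)))
      (subst (λ l → V X + F X ≤ 2 + l) (trans (Listₚ.length-map _ (pairs E)) (length-pairs E))
        (Euler.euler-≤ (σ-inj X) ps (vl X) (fl′ as bs eq) (κ-const as bs eq)))

unmap-unique : ∀ {N} (xs : List (Fin N)) → Unique (map ↑ xs) → Unique xs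
unmap-unique xs u = AllPairs.map (λ ne e → ne (cong ↑ e)) (AllPairsₚ.map⁻ u)

lower-list : ∀ {N} (xs : List (Fin (2 + N))) → e₀ ∉ xs → e₁ ∉ xs → ∃ λ ys → xs ≡ map ↑ ys
lower-list []                 _ _ = [] , refl
lower-list (zero ∷ xs)        a _ = ⊥-elim (a (here refl))
lower-list (suc zero ∷ xs)    _ b = ⊥-elim (b (here refl))
lower-list (suc (suc x) ∷ xs) a b with lower-list xs (a ∘ there) (b ∘ there)
... | ys , eq = x ∷ ys , cong (↑ x ∷_) eq

-- The label counts of a map are variables, not successors. The field `size` records the
-- predecessor, so that `punchOut`, and `merge` in the next record, become available without
-- rewriting the map.
record Shrink {c : ℕ} (i : Fin c) : Set where
  field
    c′       : ℕ
    size     : c ≡ suc c′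
    out      : ∀ k → i ≢ k → Fin c′
    out-cong : ∀ j k p q → j ≡ k → out j p ≡ out k q
    out-inj  : ∀ j k p q → out j p ≡ out k q → j ≡ k
    out-onto : ∀ k′ → ∃ λ k → Σ (i ≢ k) λ ne → out k ne ≡ k′

record Glue {c : ℕ} (i j : Fin c) : Set where
  field
    c′         : ℕ
    size       : c ≡ suc c′
    glue       : Fin c → Fin c′
    glued      : glue i ≡ glue j
    glue-onto  : ∀ k′ → ∃ λ k → k ≢ j × glue k ≡ k′

abstract
  shrink : ∀ {c} (i : Fin c) → Shrink i
  shrink {suc c} i = record
    { c′ = c ; size = refl ; out = λ k ne → punchOut ne ; out-cong = λ j k p q → Fₚ.punchOut-cong i
    ; out-inj = λ j k p q → Fₚ.punchOut-injective p q
    ; out-onto = λ k′ → punchIn i k′ , Fₚ.punchInᵢ≢i i k′ ∘ sym , Fₚ.punchOut-punchIn i }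

  gluing : ∀ {c} (i j : Fin c) → i ≢ j → Glue i j
  gluing {suc c} i j ne = record
    { c′ = c ; size = refl ; glue = merge i j ne ; glued = merge-identifies i j ne
    ; glue-onto = λ k′ → punchIn j k′ , Fₚ.punchInᵢ≢i j k′ , merge-punchIn i j ne k′ }

record LastNew {N V : ℕ} (v : Fin N → Fin V) (xs : List (Fin N)) : Set where
  field
    before after : List (Fin N)
    last         : Fin N
    eq           : xs ≡ before ++ last ∷ after
    fresh        : All (λ d → v d ≢ v last) before
    covered      : ∀ {d} → d ∈ xs → v d ≡ v last ⊎ Any (λ e → v d ≡ v e) before

abstract
  -- A single scan: `t` is the newest vertex so far and `mid` what follows it. An entry at an unseen
  -- vertex becomes the new candidate and sends everything scanned to the front.
  lastNew : ∀ {N V} (v : Fin N → Fin V) x xs → LastNew v (x ∷ xs)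
  lastNew {N} v x xs = go [] x [] xs [] λ { (here refl) → inj₁ refl }
    where
    go : ∀ bef t mid ys → All (λ d → v d ≢ v t) bef →
         (∀ {d} → d ∈ bef ++ t ∷ mid → v d ≡ v t ⊎ Any (λ e → v d ≡ v e) bef) → LastNew v (bef ++ t ∷ (mid ++ ys))
    go bef t mid [] fr cov = record
      { eq = refl ; fresh = fr ; covered = λ {d} d∈ → cov (subst (λ zs → d ∈ bef ++ t ∷ zs) (Listₚ.++-identityʳ mid) d∈) }
    go bef t mid (y ∷ ys) fr cov =
      subst (LastNew v) (cong (λ zs → bef ++ t ∷ zs) (Listₚ.++-assoc mid (y ∷ []) ys))
        (choose (v y Fₚ.≟ v t) (Any.any? (λ e → v y Fₚ.≟ v e) bef))
      where
      old : (v y ≡ v t ⊎ Any (λ e → v y ≡ v e) bef) → LastNew v (bef ++ t ∷ ((mid ++ y ∷ []) ++ ys))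
      old y-old = go bef t (mid ++ y ∷ []) ys fr λ {d} d∈ →
        case ∈ₚ.∈-++⁻ (bef ++ t ∷ mid) (subst (d ∈_) (sym (Listₚ.++-assoc bef (t ∷ mid) (y ∷ []))) d∈) of λ
          { (inj₁ d∈′) → cov d∈′ ; (inj₂ (here refl)) → y-old }
      choose : Dec (v y ≡ v t) → Dec (Any (λ e → v y ≡ v e) bef) → LastNew v (bef ++ t ∷ ((mid ++ y ∷ []) ++ ys))
      choose (yes e) _       = old (inj₁ e)
      choose (no _)  (yes a) = old (inj₂ a)
      choose (no ne) (no na) = subst (LastNew v)
        (trans (Listₚ.++-assoc bef (t ∷ mid) (y ∷ ys)) (cong (λ zs → bef ++ t ∷ zs) (sym (Listₚ.++-assoc mid (y ∷ []) ys))))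
        (go (bef ++ t ∷ mid) y [] ys (All.tabulate λ {d} d∈ e → differ d∈ (cov d∈) e)
          λ d∈ → case ∈ₚ.∈-++⁻ (bef ++ t ∷ mid) d∈ of λ { (inj₁ d∈′) → inj₂ (lose d∈′ refl) ; (inj₂ (here refl)) → inj₁ refl })
        where
        differ : ∀ {d} → d ∈ bef ++ t ∷ mid → v d ≡ v t ⊎ Any (λ e → v d ≡ v e) bef → v d ≢ v y
        differ _ (inj₁ e) e′ = ne (trans (sym e′) e)
        differ _ (inj₂ a) e′ = na (Any.map (trans (sym e′)) a)

orb-fixed : ∀ {A : Set} {f : A → A} {x y} → f x ≡ x → Orb f x y → y ≡ x
orb-fixed {f = f} {x} {y} e (xs , w) = go xs w
  where
  go : ∀ xs → Walk f x xs y → y ≡ x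
  go _       stop     = refl
  go (_ ∷ xs) (step w) = go xs (subst (λ z → Walk f z xs y) e w)

module Delete {E : ℕ} (X : OMap (flip (suc E))) (m : Maybe (Fin (E * 2))) (c : Fin (E * 2)) (m≢c : m ≢ just c)
              (eq₀ : σ X e₀ ≡ maybe′ ↑ e₀ m) (eq₁ : σ X e₁ ≡ ↑ c) where

  open Insert m c m≢c public

  private
    isJust : ∀ m → σ X e₀ ≡ maybe′ ↑ e₀ m → ∀ {x} → σ X (↑ x) ≡ e₀ → ∃ λ y → m ≡ just y
    isJust nothing  e e′ = case σ-inj X (trans e′ (sym e)) of λ ()
    isJust (just y) e e′ = y , refl

    abstract
      -- A value on the deleted edge is replaced by the dart that follows it in the rotation, that
      -- is by the dart in `m` or by `c`.
      del : ∀ x → ∃ λ y → σ X (↑ x) ≡ mark y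
      del x with σ X (↑ x) in eq
      ... | zero        = proj₁ (isJust m eq₀ eq) , sym (mark-e₀ (proj₂ (isJust m eq₀ eq)))
      ... | suc zero    = c , sym mark-c
      ... | suc (suc z) = z , sym (mark-↑
        (λ e → case σ-inj X (trans eq (sym (trans eq₀ (cong (maybe′ ↑ e₀) e)))) of λ ())
        (λ { refl → case σ-inj X (trans eq (sym eq₁)) of λ () }))

  σ′ : Fin (E * 2) → Fin (E * 2)
  σ′ x = proj₁ (del x)

  σ-mark : ∀ x → σ X (↑ x) ≡ mark (σ′ x)
  σ-mark x = proj₂ (del x)

  σ-ins : ∀ x → σ X x ≡ ins σ′ x
  σ-ins zero          = eq₀
  σ-ins (suc zero)    = eq₁
  σ-ins (suc (suc x)) = σ-mark x

  φ′ : Fin (E * 2) → Fin (E * 2)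
  φ′ = σ′ ∘ flip E

  φ-mark : ∀ x → φ X (↑ x) ≡ mark (φ′ x)
  φ-mark x = σ-mark (flip E x)

  σ′-inj : Inj σ′
  σ′-inj {x} {y} e = ↑-inj (σ-inj X (trans (σ-mark x) (trans (cong mark e) (sym (σ-mark y)))))

  vert-mark : ∀ x → vert X (mark x) ≡ vert X (↑ x)
  vert-mark = inv-mark {ℓ = vert X} {σ′} λ x → trans (cong (vert X) (sym (σ-ins x))) (inv (vl X) x)

  vert-σ′ : ∀ x → vert X (↑ (σ′ x)) ≡ vert X (↑ x)
  vert-σ′ x = trans (sym (vert-mark (σ′ x))) (trans (cong (vert X) (sym (σ-mark x))) (inv (vl X) (↑ x)))

  abstract
    -- An invariant of the smaller map is extended to the deleted edge by its value at `c`. It stays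
    -- invariant at `e₀` because `joins` says that the two ends remain connected.
    conn′ : (∀ (κ : Fin (E * 2) → ℕ) → (∀ x → κ (σ′ x) ≡ κ x) → (∀ x → κ (flip E x) ≡ κ x) → ∀ {a} → m ≡ just a → κ a ≡ κ c) →
            Connected σ′ (flip E)
    conn′ joins κ κσ κα x y = conn X κ⁺ κ⁺σ κ⁺α (↑ x) (↑ y)
      where
      κ⁺ : Fin (suc E * 2) → ℕ
      κ⁺ zero          = κ c
      κ⁺ (suc zero)    = κ c
      κ⁺ (suc (suc x)) = κ x
      κ⁺-m : ∀ m → (∀ {a} → m ≡ just a → κ a ≡ κ c) → κ⁺ (maybe′ ↑ e₀ m) ≡ κ c
      κ⁺-m nothing  _ = refl
      κ⁺-m (just a) h = h refl
      κ⁺σ : ∀ x → κ⁺ (σ X x) ≡ κ⁺ x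
      κ⁺σ zero          = trans (cong κ⁺ eq₀) (κ⁺-m m (joins κ κσ κα))
      κ⁺σ (suc zero)    = cong κ⁺ eq₁
      κ⁺σ (suc (suc x)) = trans (cong κ⁺ (σ-mark x)) (trans
        (mark-elim (λ y z → κ⁺ z ≡ κ y) (σ′ x) (λ e → sym (joins κ κσ κα e)) (λ e → cong κ (sym e)) (λ _ _ → refl)) (κσ x))
      κ⁺α : ∀ x → κ⁺ (flip (suc E) x) ≡ κ⁺ x
      κ⁺α zero          = refl
      κ⁺α (suc zero)    = refl
      κ⁺α (suc (suc x)) = κα x

  abstract
    untail : ∀ {r} xs → Walk (φ X) (↑ c) (map ↑ xs) (↑ r) → Walk φ′ c xs r
    untail []       stop = stop
    untail (x ∷ xs) w with walk-head w
    ... | refl with walk⁻ φ-mark xs w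
    ...   | z , v , e = subst (Walk φ′ c (c ∷ xs)) (↑-mark (sym e)) v

-- All that is needed to put the edge back. `bs` is the part of the outer walk beyond the edge, and
-- the bounds in `kind` say that the pointer, starting at the last vertex of `X′`, can get there,
-- for a chord with at least two darts hidden.
record Peel {E : ℕ} (X : OMap (flip (suc E))) : Set where
  field
    X′    : OMap (flip E)
    m     : Maybe (Fin (E * 2))
    c     : Fin (E * 2)
    m≢c   : m ≢ just c
    as bs : List (Fin (E * 2))
    σ-eq  : ∀ x → σ X x ≡ Insert.ins m c m≢c (σ X′) x
    r-eq  : root X ≡ ↑ (root X′)
    s-eq  : stk X ≡ map ↑ bs
    c-eq  : c ≡ hd bs (root X′)
    total : (root X′ ∷ bef X′) ++ top X′ ∷ stk X′ ≡ as ++ bs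
    kind  : (m ≡ nothing × length bs ≤ suc (length (stk X′))) ⊎
            (m ≡ just (top X′) × 2 + length bs ≤ suc (length (stk X′)))

hd-map : ∀ {A B : Set} (f : A → B) xs {r} → hd (map f xs) (f r) ≡ f (hd xs r)
hd-map f []      = refl
hd-map f (_ ∷ _) = refl

module _ {E : ℕ} (X : OMap (flip (suc E))) (top≡ : top X ≡ e₀) where

  open Last X top≡

  module Common (r : Fin (E * 2)) (root≡ : root X ≡ ↑ r) (bs : List (Fin (E * 2))) (stk≡ : stk X ≡ map ↑ bs) where

    c : Fin (E * 2)
    c = hd bs r

    abstract
      eq₁ : σ X e₁ ≡ ↑ c
      eq₁ = trans (walk-hd walk₂₀) (trans (cong₂ hd stk≡ root≡) (hd-map ↑ bs))

      walk-c : Walk (φ X) (↑ c) (map ↑ bs) (↑ r)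
      walk-c = subst (λ z → Walk (φ X) z (map ↑ bs) (↑ r)) eq₁ (subst₂ (Walk (φ X) (φ X e₀)) stk≡ root≡ walk₂₀)

  module LeafCase (σe₀ : σ X e₀ ≡ e₀) (r : Fin (E * 2)) (as bs : List (Fin (E * 2)))
                  (bef≡ : root X ∷ bef X ≡ map ↑ (r ∷ as) ++ e₁ ∷ []) (stk≡ : stk X ≡ map ↑ bs) where

    open Common r (Listₚ.∷-injectiveˡ bef≡) bs stk≡
    open Delete X nothing c (λ ()) σe₀ eq₁

    private
      abstract
        e₀-alone : ∀ x → vert X e₀ ≢ vert X (↑ x)
        e₀-alone x e = case orb-fixed σe₀ (Planar.v-orb X e) of λ ()

      sh : Shrink (vert X e₀)
      sh = shrink (vert X e₀)

      open Shrink sh renaming (c′ to V′)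

      v′ : Fin (E * 2) → Fin V′
      v′ x = out (vert X (↑ x)) (e₀-alone x)

      v′-cong : ∀ {x y} → vert X (↑ x) ≡ vert X (↑ y) → v′ x ≡ v′ y
      v′-cong {x} {y} = out-cong (vert X (↑ x)) (vert X (↑ y)) (e₀-alone x) (e₀-alone y)

      v′-inj : ∀ {x y} → v′ x ≡ v′ y → vert X (↑ x) ≡ vert X (↑ y)
      v′-inj {x} {y} = out-inj (vert X (↑ x)) (vert X (↑ y)) (e₀-alone x) (e₀-alone y)

      vert-e₁ : vert X e₁ ≡ vert X (↑ c)
      vert-e₁ = trans (sym (inv (vl X) e₁)) (cong (vert X) eq₁)

      abstract
        v′-onto : ∀ i → ∃ λ x → v′ x ≡ i
        v′-onto i = let k , ne , eq = out-onto i in pick k ne eq (onto (vl X) k)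
          where
          pick : ∀ k ne → out k ne ≡ i → (∃ λ x → vert X x ≡ k) → ∃ λ x → v′ x ≡ i
          pick k ne eq (zero , e)        = ⊥-elim (ne e)
          pick k ne eq (suc zero , e)    = c , trans (out-cong (vert X (↑ c)) k (e₀-alone c) ne (trans (sym vert-e₁) e)) eq
          pick k ne eq (suc (suc x) , e) = x , trans (out-cong (vert X (↑ x)) k (e₀-alone x) ne e) eq

      vl′ : Lab σ′ V′
      vl′ = record { lab = v′ ; inv = λ x → v′-cong (vert-σ′ x) ; onto = v′-onto }

      face-e₀ : face X e₀ ≡ face X (↑ c)
      face-e₀ = trans (sym (inv (fl X) e₀)) (cong (face X) eq₁)

      face-e₁ : face X e₁ ≡ face X (↑ c)
      face-e₁ = trans (sym (inv (fl X) e₁)) (trans (cong (face X) σe₀) face-e₀)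

      fl′ : Lab φ′ (F X)
      fl′ .lab x  = face X (↑ x)
      fl′ .inv x  = trans (sym (mark-elim (λ y z → face X z ≡ face X (↑ y)) (φ′ x) (λ ())
                      (λ e → trans face-e₁ (cong (face X ∘ ↑) (sym e))) (λ _ _ → refl)))
                      (trans (cong (face X) (sym (φ-mark x))) (inv (fl X) (↑ x)))
      fl′ .onto i with onto (fl X) i
      ... | zero , e        = c , trans (sym face-e₀) e
      ... | suc zero , e    = c , trans (sym face-e₁) e
      ... | suc (suc x) , e = x , e

      -- The search for the new last vertex includes one dart of `bs`: the neighbour of the leaf may
      -- have been seen before the leaf only through `e₁`, and then its first remaining dart is `c`.
      P Q : List (Fin (E * 2))
      P    = r ∷ (as ++ take 1 bs)
      Q = drop 1 bs

      full : P ++ Q ≡ (r ∷ as) ++ bs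
      full = cong (r ∷_) (trans (Listₚ.++-assoc as (take 1 bs) _) (cong (as ++_) (Listₚ.take++drop≡id 1 bs)))

      abstract
        c∈P : c ∈ P
        c∈P = go bs
          where
          go : ∀ bs → hd bs r ∈ r ∷ (as ++ take 1 bs)
          go []      = here refl
          go (_ ∷ _) = there (∈ₚ.∈-insert as)

        inP : ∀ x → ∃ λ d → d ∈ P × v′ x ≡ v′ d
        inP x = pick (all₀ (↑ x))
          where
          lowered : ∀ {d} → d ∈ map ↑ (r ∷ as) ++ e₁ ∷ [] → vert X (↑ x) ≡ vert X d →
                    ∃ λ d → d ∈ P × vert X (↑ x) ≡ vert X (↑ d)
          lowered d∈ e with ∈ₚ.∈-++⁻ (map ↑ (r ∷ as)) d∈
          ... | inj₂ (here refl) = c , c∈P , trans e vert-e₁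
          ... | inj₁ d∈′ with ∈ₚ.∈-map⁻ ↑ d∈′
          ...   | d′ , d′∈ , refl = d′ , P⊇ d′∈ , e
            where
            P⊇ : ∀ {d} → d ∈ r ∷ as → d ∈ P
            P⊇ = ∈ₚ.∈-++⁺ˡ
          pick : vert X (↑ x) ≡ vert X e₀ ⊎ (∃ λ d → d ∈ root X ∷ bef X × vert X (↑ x) ≡ vert X d) →
                 ∃ λ d → d ∈ P × v′ x ≡ v′ d
          pick (inj₁ e)            = ⊥-elim (e₀-alone x (sym e))
          pick (inj₂ (d , d∈ , e)) = let d′ , d′∈ , e′ = lowered (subst (d ∈_) bef≡ d∈) e in d′ , d′∈ , v′-cong e′

      noLoop′ : ∀ x → v′ x ≢ v′ (flip E x)
      noLoop′ x e = noLoop X (↑ x) (v′-inj e)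

      abstract
        walk-full : Walk φ′ r (P ++ Q) r
        walk-full with walk⁻ φ-mark as (subst (λ z → Walk (φ X) z (map ↑ (r ∷ as)) e₁) (Listₚ.∷-injectiveˡ bef≡)
                         (proj₁ (walk-split-at (map ↑ (r ∷ as)) (subst (λ xs → Walk (φ X) (root X) xs e₀) bef≡ walk₁₀))))
        ... | z , v , e = subst (λ xs → Walk φ′ r xs r) (sym full)
                (walk-++ (subst (Walk φ′ r (r ∷ as)) (e₁-mark (sym e)) v) (untail bs walk-c))

        u-full : Unique (P ++ Q)
        u-full = subst Unique (sym full) (Uniqueₚ.++⁺
          (unmap-unique (r ∷ as) (proj₁ (unique-++⁻ (map ↑ (r ∷ as)) (subst Unique bef≡ u-bef))))
          (unmap-unique bs (subst Unique stk≡ (AllPairs.tail u-stk)))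
          λ { {z} (p , q) → dis (subst (↑ z ∈_) (sym bef≡) (∈ₚ.∈-++⁺ˡ (∈ₚ.∈-map⁺ ↑ p)))
                            (there (subst (↑ z ∈_) (sym stk≡) (∈ₚ.∈-map⁺ ↑ q))) })

      finish : ∀ bef₀ {t mid} → P ≡ bef₀ ++ t ∷ mid → All (λ d → v′ d ≢ v′ t) bef₀ →
               (∀ {d} → d ∈ P → v′ d ≡ v′ t ⊎ Any (λ e → v′ d ≡ v′ e) bef₀) → Peel X
      -- A last vertex found at the first dart would be the only vertex, and every edge a loop.
      finish [] {t} eq fr cov = ⊥-elim (noLoop′ r (trans (same r) (sym (same (flip E r)))))
        where
        same : ∀ x → v′ x ≡ v′ t
        same x with inP x
        ... | d , d∈ , e with cov d∈
        ...   | inj₁ e′ = trans e e′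
      finish (z ∷ zs) {t} {mid} eq fr cov = record
        { X′ = Y ; m = nothing ; c = c ; m≢c = λ () ; as = r ∷ as ; bs = bs
        ; σ-eq = σ-ins ; r-eq = Listₚ.∷-injectiveˡ bef≡ ; s-eq = stk≡ ; c-eq = refl
        ; total = trans (sym eq-full) full
        ; kind = inj₁ (refl , ℕₚ.≤-trans (ℕₚ.m≤n+m∸n (length bs) 1) (s≤s (ℕₚ.≤-trans
            (ℕₚ.≤-reflexive (sym (Listₚ.length-drop 1 bs)))
            (ℕₚ.≤-trans (ℕₚ.m≤n+m _ (length mid)) (ℕₚ.≤-reflexive (sym (Listₚ.length-++ mid))))))) }
        where
        eq′ : P ≡ (r ∷ zs) ++ t ∷ mid
        eq′ = trans eq (cong (_∷ zs ++ t ∷ mid) (sym (Listₚ.∷-injectiveˡ eq)))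
        eq-full : P ++ Q ≡ (r ∷ zs) ++ t ∷ (mid ++ Q)
        eq-full = trans (cong (_++ Q) eq′) (Listₚ.++-assoc (r ∷ zs) (t ∷ mid) Q)
        walks = walk-split-at (r ∷ zs) (subst (λ xs → Walk φ′ r xs r) eq-full walk-full)
        Y : OMap (flip E)
        Y .σ       = σ′
        Y .σ-inj   = σ′-inj
        Y .V       = V′
        Y .F       = F X
        Y .vl      = vl′
        Y .fl      = fl′
        Y .euler   = euler-half {E} {V′} (ℕₚ.suc-injective (trans (cong (_+ F X) (sym size)) (Planar.eulerE X)))
        Y .conn    = conn′ λ κ κσ κα ()
        Y .noLoop  = noLoop′
        Y .noMulti x y p q = ↑-inj (noMulti X (↑ x) (↑ y) (v′-inj p) (v′-inj q))
        Y .root    = r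
        Y .top     = t
        Y .bef     = zs
        Y .stk     = mid ++ Q
        Y .walk₁   = proj₁ walks
        Y .walk₂   = proj₂ walks
        Y .uniq    = subst Unique eq-full u-full
        Y .new     = subst (λ z → All (λ d → v′ d ≢ v′ t) (z ∷ zs)) (sym (Listₚ.∷-injectiveˡ eq)) fr
        Y .all x with inP x
        ... | d , d∈ , e with cov d∈
        ...   | inj₁ e′ = inj₁ (trans e e′)
        ...   | inj₂ a  = inj₂ (subst (λ z → Any (λ d → v′ x ≡ v′ d) (z ∷ zs)) (sym (Listₚ.∷-injectiveˡ eq)) (Any.map (trans e) a))

    peel-leaf : Peel X
    peel-leaf = finish before eq fresh covered
      where open LastNew (lastNew v′ r (as ++ take 1 bs))

  module ChordCase (σe₀≢ : σ X e₀ ≢ e₀) (a : Fin (E * 2)) (eq₀ : σ X e₀ ≡ ↑ a)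
                   (r : Fin (E * 2)) (as bs : List (Fin (E * 2)))
                   (bef≡ : root X ∷ bef X ≡ map ↑ (r ∷ as)) (stk≡ : stk X ≡ map ↑ bs) where

    open Common r (Listₚ.∷-injectiveˡ bef≡) bs stk≡

    private
      m≢c : just a ≢ just c
      m≢c e = case σ-inj X (trans eq₀ (trans (cong ↑ (Maybeₚ.just-injective e)) (sym eq₁))) of λ ()

    open Delete X (just a) c m≢c eq₀ eq₁

    private
      vert-a : vert X (↑ a) ≡ vert X e₀
      vert-a = trans (cong (vert X) (sym eq₀)) (inv (vl X) e₀)

      vert-c : vert X (↑ c) ≡ vert X e₁
      vert-c = trans (cong (vert X) (sym eq₁)) (inv (vl X) e₁)

      face-a : face X (↑ a) ≡ face X e₁
      face-a = trans (cong (face X) (sym eq₀)) (inv (fl X) e₁)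

      face-c : face X (↑ c) ≡ face X e₀
      face-c = trans (cong (face X) (sym eq₁)) (inv (fl X) e₀)

      abstract
        outer-face : ∀ {z} → z ∈ map ↑ (r ∷ as) ++ map ↑ bs → face X z ≡ face X e₀
        outer-face {z} z∈ with ∈ₚ.∈-++⁻ (map ↑ (r ∷ as)) z∈
        ... | inj₁ z∈₁ with ∈ₚ.∈-∃++ (subst (z ∈_) (sym bef≡) z∈₁)
        ...   | ys , zs , eq = lab-orb (fl X) (_ , proj₂ (walk-split-at ys (subst (λ xs → Walk (φ X) (root X) xs e₀) eq walk₁₀)))
        outer-face {z} z∈ | inj₂ z∈₂ with ∈ₚ.∈-∃++ (subst (z ∈_) (sym stk≡) z∈₂)
        ...   | ys , zs , eq = sym (lab-orb (fl X) (_ , step (proj₁ (walk-split-at ys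
                                 (subst (λ xs → Walk (φ X) (φ X e₀) xs (root X)) eq walk₂₀)))))

        -- Equal labels would put `e₁` on the orbit of the root, but it occurs neither before nor
        -- after `top`.
        faces≢ : face X e₀ ≢ face X e₁
        faces≢ e = refute (orb-∈ φ-inj′ loop (orb-trans (_ , walk₁₀) (Planar.f-orb X e)))
          where
          loop : Walk (φ X) (root X) ((root X ∷ bef X) ++ e₀ ∷ stk X) (root X)
          loop = walk-++ walk₁₀ (step walk₂₀)
          refute : e₁ ∉ (root X ∷ bef X) ++ e₀ ∷ stk X
          refute e₁∈ with ∈ₚ.∈-++⁻ (root X ∷ bef X) e₁∈
          ... | inj₁ e₁∈bef         = e₁∉bef σe₀≢ e₁∈bef
          ... | inj₂ (there e₁∈stk) = e₁∉stk σe₀≢ e₁∈stk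

        -- The face of `e₁` without `e₁` is the stretch from the last vertex to `c` that the chord
        -- had hidden. It has a second dart, since a single one would be parallel to `e₀`.
        inner : ∃ λ h → ∃ λ gs → Walk φ′ a (a ∷ h ∷ gs) c × Unique (a ∷ h ∷ gs) ×
                (∀ {z} → z ∈ a ∷ h ∷ gs → face X (↑ z) ≡ face X e₁)
        inner with cycle φ-inj′ e₁
        ... | fs , step w , e₁∉ ∷ u =
          go (proj₁ low) (subst (λ xs → Walk (φ X) (σ X e₀) xs e₁) (proj₂ low) w) (subst Unique (proj₂ low) u)
          where
          low : ∃ λ gs → fs ≡ map ↑ gs
          low = lower-list fs
            (λ e₀∈ → faces≢ (sym (case ∈ₚ.∈-∃++ e₀∈ of λ { (ys , zs , eq) →
              lab-orb (fl X) (_ , step (proj₁ (walk-split-at ys (subst (λ xs → Walk (φ X) _ xs e₁) eq w)))) })))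
            (λ e₁∈ → All.lookup e₁∉ e₁∈ refl)
          go : ∀ gs → Walk (φ X) (σ X e₀) (map ↑ gs) e₁ → Unique (map ↑ gs) →
               ∃ λ h → ∃ λ gs → Walk φ′ a (a ∷ h ∷ gs) c × Unique (a ∷ h ∷ gs) ×
               (∀ {z} → z ∈ a ∷ h ∷ gs → face X (↑ z) ≡ face X e₁)
          go [] w _ = case trans (sym eq₀) (walk-stop w) of λ ()
            where
            walk-stop : ∀ {x y} → Walk (φ X) x [] y → x ≡ y
            walk-stop stop = refl
          go (g ∷ []) w _ = case same-edge of λ ()
            where
            one : ∀ {x y} → Walk (φ X) x (↑ g ∷ []) y → φ X (↑ g) ≡ y
            one (step stop) = refl
            g≡a : g ≡ a
            g≡a = ↑-inj (trans (sym (walk-head w)) eq₀)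
            same-edge : ↑ g ≡ e₀
            same-edge = noMulti X (↑ g) e₀ (trans (cong (λ x → vert X (↑ x)) g≡a) vert-a)
                          (trans (sym (inv (vl X) _)) (cong (vert X) (one w)))
          go (g ∷ h ∷ gs) w u with ↑-inj (trans (sym (walk-head w)) eq₀)
          ... | refl with walk⁻ φ-mark (h ∷ gs) (subst (λ z → Walk (φ X) z _ e₁) eq₀ w)
          ...   | z , v , e =
            h , gs , subst (Walk φ′ a (a ∷ h ∷ gs)) (e₁-mark (sym e)) v , unmap-unique (a ∷ h ∷ gs) u , on-face
            where
            on-face : ∀ {z} → z ∈ a ∷ h ∷ gs → face X (↑ z) ≡ face X e₁
            on-face z∈ with ∈ₚ.∈-∃++ (∈ₚ.∈-map⁺ ↑ z∈)
            ... | ys , zs , eq = lab-orb (fl X) (_ , proj₂ (walk-split-at ys (subst (λ xs → Walk (φ X) (σ X e₀) xs e₁) eq w)))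

      gl : Glue (face X e₀) (face X e₁)
      gl = gluing _ _ faces≢

      open Glue gl renaming (c′ to F′)

      v′ : Fin (E * 2) → Fin (V X)
      v′ x = vert X (↑ x)

      f′ : Fin (E * 2) → Fin F′
      f′ x = glue (face X (↑ x))

      abstract
        v′-onto : ∀ i → ∃ λ x → v′ x ≡ i
        v′-onto i = pick (onto (vl X) i)
          where
          pick : (∃ λ x → vert X x ≡ i) → ∃ λ x → v′ x ≡ i
          pick (zero , e)        = a , trans vert-a e
          pick (suc zero , e)    = c , trans vert-c e
          pick (suc (suc x) , e) = x , e

        f′-inv : ∀ x → f′ (φ′ x) ≡ f′ x
        f′-inv x = trans (mark-elim (λ y z → f′ y ≡ glue (face X z)) (φ′ x)
            (λ e → trans (cong f′ (sym (Maybeₚ.just-injective e))) (trans (cong glue face-a) (sym glued)))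
            (λ e → trans (cong f′ e) (trans (cong glue face-c) glued))
            (λ _ _ → refl))
          (cong glue (trans (cong (face X) (sym (φ-mark x))) (inv (fl X) (↑ x))))

        f′-onto : ∀ i → ∃ λ x → f′ x ≡ i
        f′-onto i = let k , ne , eq = glue-onto i in pick k ne eq (onto (fl X) k)
          where
          pick : ∀ k → k ≢ face X e₁ → glue k ≡ i → (∃ λ x → face X x ≡ k) → ∃ λ x → f′ x ≡ i
          pick k ne eq (zero , e)        = c , trans (cong glue (trans face-c e)) eq
          pick k ne eq (suc zero , e)    = ⊥-elim (ne (sym e))
          pick k ne eq (suc (suc x) , e) = x , trans (cong glue e) eq

        walk-bef : Walk φ′ r (r ∷ as) a
        walk-bef with walk⁻ φ-mark as (subst (λ z → Walk (φ X) z (map ↑ (r ∷ as)) e₀) (Listₚ.∷-injectiveˡ bef≡)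
                                        (subst (λ xs → Walk (φ X) (root X) xs e₀) bef≡ walk₁₀))
        ... | z , v , e = subst (Walk φ′ r (r ∷ as)) (sym (Maybeₚ.just-injective (e₀-mark (sym e)))) v

        all′ : ∀ x → v′ x ≡ v′ a ⊎ Any (λ d → v′ x ≡ v′ d) (r ∷ as)
        all′ x = pick (all₀ (↑ x))
          where
          pick : vert X (↑ x) ≡ vert X e₀ ⊎ (∃ λ d → d ∈ root X ∷ bef X × vert X (↑ x) ≡ vert X d) →
                 v′ x ≡ v′ a ⊎ Any (λ d → v′ x ≡ v′ d) (r ∷ as)
          pick (inj₁ e)            = inj₁ (trans e (sym vert-a))
          pick (inj₂ (d , d∈ , e)) =
            inj₂ (Anyₚ.map⁻ {f = ↑} {P = λ d → vert X (↑ x) ≡ vert X d} (lose (subst (d ∈_) bef≡ d∈) e))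

        new′ : All (λ d → v′ d ≢ v′ a) (r ∷ as)
        new′ = Allₚ.map⁻ (All.map (λ ne e → ne (trans e vert-a)) (subst (All _) bef≡ new₀))

      finish : ∀ h gs → Walk φ′ a (a ∷ h ∷ gs) c → Unique (a ∷ h ∷ gs) →
               (∀ {z} → z ∈ a ∷ h ∷ gs → face X (↑ z) ≡ face X e₁) → Peel X
      finish h gs w u inside = record
        { X′ = Y ; m = just a ; c = c ; m≢c = m≢c ; as = (r ∷ as) ++ a ∷ h ∷ gs ; bs = bs
        ; σ-eq = σ-ins ; r-eq = Listₚ.∷-injectiveˡ bef≡ ; s-eq = stk≡ ; c-eq = refl
        ; total = sym (Listₚ.++-assoc (r ∷ as) (a ∷ h ∷ gs) bs)
        ; kind = inj₂ (refl , s≤s (s≤s (ℕₚ.≤-trans (ℕₚ.m≤n+m _ (length gs)) (ℕₚ.≤-reflexive (sym (Listₚ.length-++ gs)))))) }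
        where
        apart : ∀ {z} → z ∈ a ∷ h ∷ gs → ↑ z ∉ map ↑ (r ∷ as) ++ map ↑ bs
        apart z∈ z∈′ = faces≢ (trans (sym (outer-face z∈′)) (inside z∈))
        u-all : Unique ((r ∷ as) ++ (a ∷ h ∷ gs) ++ bs)
        u-all = Uniqueₚ.++⁺ (unmap-unique (r ∷ as) (subst Unique bef≡ u-bef))
          (Uniqueₚ.++⁺ u (unmap-unique bs (subst Unique stk≡ (AllPairs.tail u-stk)))
            λ (p , q) → apart p (∈ₚ.∈-++⁺ʳ (map ↑ (r ∷ as)) (∈ₚ.∈-map⁺ ↑ q)))
          λ { {z} (p , q) → case ∈ₚ.∈-++⁻ (a ∷ h ∷ gs) q of λ
            { (inj₁ q₁) → apart q₁ (∈ₚ.∈-++⁺ˡ (∈ₚ.∈-map⁺ ↑ p))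
            ; (inj₂ q₂) → dis (subst (↑ z ∈_) (sym bef≡) (∈ₚ.∈-map⁺ ↑ p)) (there (subst (↑ z ∈_) (sym stk≡) (∈ₚ.∈-map⁺ ↑ q₂))) } }
        Y : OMap (flip E)
        Y .σ       = σ′
        Y .σ-inj   = σ′-inj
        Y .V       = V X
        Y .F       = F′
        Y .vl      = record { lab = v′ ; inv = vert-σ′ ; onto = v′-onto }
        Y .fl      = record { lab = f′ ; inv = f′-inv ; onto = f′-onto }
        Y .euler   = euler-half {E} {V X} (ℕₚ.suc-injective (trans (sym (ℕₚ.+-suc (V X) F′))
                       (trans (cong (V X +_) (sym size)) (Planar.eulerE X))))
        -- The ends of the chord stay connected along the rest of the former inner face.
        Y .conn    = conn′ λ κ κσ κα e → trans (cong κ (sym (Maybeₚ.just-injective e)))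
                       (orb-inv {f = φ′} (λ x → trans (κσ (flip E x)) (κα x)) (_ , w))
        Y .noLoop x    = noLoop X (↑ x)
        Y .noMulti x y p q = ↑-inj (noMulti X (↑ x) (↑ y) p q)
        Y .root    = r
        Y .top     = a
        Y .bef     = as
        Y .stk     = (h ∷ gs) ++ bs
        Y .walk₁   = walk-bef
        Y .walk₂   = walk-++ w (untail bs walk-c)
        Y .uniq    = u-all
        Y .new     = new′
        Y .all     = all′

    peel-chord : Peel X
    peel-chord = let h , gs , w , u , inside = inner in finish h gs w u inside

-- Every labelled map is built by a word.

suffix-unique : ∀ {A : Set} (xs : List A) {ys} as {bs} → xs ++ ys ≡ as ++ bs → length ys ≡ length bs → ys ≡ bs
suffix-unique xs {ys} as {bs} eq len = go xs as eq
  (ℕₚ.+-cancelʳ-≡ (length ys) (length xs) (length as)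
    (trans (sym (Listₚ.length-++ xs)) (trans (cong length eq) (trans (Listₚ.length-++ as) (cong (length as +_) (sym len))))))
  where
  go : ∀ xs as → xs ++ ys ≡ as ++ bs → length xs ≡ length as → ys ≡ bs
  go []       []       eq _   = eq
  go (_ ∷ xs) (_ ∷ as) eq len = go xs as (Listₚ.∷-injectiveʳ eq) (ℕₚ.suc-injective len)

module _ {E E′ : ℕ} (m : Maybe (Fin (E * 2))) (c : Fin (E * 2)) (m≢c : m ≢ just c)
         (m′ : Maybe (Fin (E′ * 2))) (c′ : Fin (E′ * 2)) (m′≢c′ : m′ ≢ just c′) where

  private
    module M = Insert m c m≢c
    module M′ = Insert m′ c′ m′≢c′

  -- The converse of `strip`: once the places of insertion correspond, so do the redirected darts,
  -- and `e₀`, `e₁` can be matched with themselves.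
  unstrip : ∀ {σ r σ′ r′} (I : Iso σ (flip E) r σ′ (flip E′) r′) →
            Maybe.map (Iso.to I) m ≡ m′ → Iso.to I c ≡ c′ → ∀ {σ″ r″} → (∀ x → σ″ x ≡ M′.ins σ′ x) → r″ ≡ ↑ r′ →
            Iso (M.ins σ) (flip (suc E)) (↑ r) σ″ (flip (suc E′)) r″
  unstrip {σ} {r} {σ′} {r′} I to-m to-c {σ″} {r″} σ-eq r-eq = record
    { to = to⁺ ; inj = λ {x} {y} → inj⁺ x y ; sur = sur⁺ ; to-σ = λ x → trans (to⁺-σ x) (sym (σ-eq (to⁺ x)))
    ; to-α = to⁺-α ; to-r = trans (cong ↑ to-r) (sym r-eq) }
    where
    open Iso I
    to⁺ : Fin (suc E * 2) → Fin (suc E′ * 2)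
    to⁺ zero          = e₀
    to⁺ (suc zero)    = e₁
    to⁺ (suc (suc x)) = ↑ (to x)
    inj⁺ : ∀ x y → to⁺ x ≡ to⁺ y → x ≡ y
    inj⁺ zero          zero          e  = refl
    inj⁺ zero          (suc zero)    ()
    inj⁺ zero          (suc (suc _)) ()
    inj⁺ (suc zero)    zero          ()
    inj⁺ (suc zero)    (suc zero)    e  = refl
    inj⁺ (suc zero)    (suc (suc _)) ()
    inj⁺ (suc (suc _)) zero          ()
    inj⁺ (suc (suc _)) (suc zero)    ()
    inj⁺ (suc (suc x)) (suc (suc y)) e  = cong ↑ (inj (↑-inj e))
    sur⁺ : ∀ y → ∃ λ x → to⁺ x ≡ y
    sur⁺ zero          = e₀ , refl
    sur⁺ (suc zero)    = e₁ , refl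
    sur⁺ (suc (suc y)) = ↑ (proj₁ (sur y)) , cong ↑ (proj₂ (sur y))
    to⁺-α : ∀ x → to⁺ (flip (suc E) x) ≡ flip (suc E′) (to⁺ x)
    to⁺-α zero          = refl
    to⁺-α (suc zero)    = refl
    to⁺-α (suc (suc x)) = cong ↑ (to-α x)
    not-m : ∀ m {y} → m ≢ just y → Maybe.map to m ≢ just (to y)
    not-m (just z) ne e = ne (cong just (inj (Maybeₚ.just-injective e)))
    to⁺-mark : ∀ y → to⁺ (M.mark y) ≡ M′.mark (to y)
    to⁺-mark y = M.mark-elim (λ y z → to⁺ z ≡ M′.mark (to y)) y
      (λ e → sym (M′.mark-e₀ (trans (sym to-m) (cong (Maybe.map to) e))))
      (λ { refl → sym (trans (cong M′.mark to-c) M′.mark-c) })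
      (λ ne₀ ne₁ → sym (M′.mark-↑ (λ e → not-m m ne₀ (trans to-m e)) (λ e → ne₁ (inj (trans e (sym to-c))))))
    to⁺-m : ∀ m → to⁺ (maybe′ ↑ e₀ m) ≡ maybe′ ↑ e₀ (Maybe.map to m)
    to⁺-m nothing  = refl
    to⁺-m (just _) = refl
    to⁺-σ : ∀ x → to⁺ (M.ins σ x) ≡ M′.ins σ′ (to⁺ x)
    to⁺-σ zero          = trans (to⁺-m m) (cong (maybe′ ↑ e₀) to-m)
    to⁺-σ (suc zero)    = cong ↑ to-c
    to⁺-σ (suc (suc x)) = trans (to⁺-mark (σ x)) (cong M′.mark (to-σ x))

pass* : ∀ k {p} → Word (k + p) → Word p
pass* zero    w = w
pass* (suc k) w = pass* k (pass w)

pass*-iso : ∀ k {p} (w : Word (k + p)) {E} (Y : OMap (flip E)) → MapIso (X (build w)) Y → MapIso (X (build (pass* k w))) Y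
pass*-iso zero    w Y I = I
pass*-iso (suc k) w Y I = pass*-iso k (pass w) Y I

Realised : ∀ {E} → OMap (flip E) → ℕ → Set
Realised Y p = ∃ λ (w : Word p) → MapIso (X (build w)) Y

-- `pass` moves only the pointer, so a word for one position yields a word for every later one.
descend : ∀ {E p q} (Y : OMap (flip E)) → p ≤ q → Realised Y q → Realised Y p
descend {p = p} {q} Y p≤q R with subst (Realised Y) (sym (ℕₚ.m∸n+n≡m p≤q)) R
... | w , I = pass* (q ∸ p) w , pass*-iso (q ∸ p) w Y I

module _ {E : ℕ} {Y : OMap (flip (suc E))} (P : Peel Y)
         (IH : ∀ (Z : OMap (flip E)) → Realised Z (suc (length (stk Z)))) where

  open Peel P

  private
    -- Both places are given by their distance from the end of the outer walk, and the isomorphism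
    -- matches the outer walks.
    to-suffix : ∀ {p} (S : State p) (I : MapIso (X S) X′) ps {zs} → top (X S) ∷ stk (X S) ≡ ps ++ zs →
                length zs ≡ length bs → Iso.to I (hd zs (root (X S))) ≡ c
    to-suffix S I ps {zs} eq len = trans (sym (hd-map to zs)) (trans (cong₂ hd same to-r) (sym c-eq))
      where
      open Iso I
      same : map to zs ≡ bs
      same = suffix-unique (map to ((root (X S) ∷ bef (X S)) ++ ps)) as (begin
        map to ((root (X S) ∷ bef (X S)) ++ ps) ++ map to zs     ≡⟨ Listₚ.map-++ to ((root (X S) ∷ bef (X S)) ++ ps) zs ⟨
        map to (((root (X S) ∷ bef (X S)) ++ ps) ++ zs)          ≡⟨ cong (map to) (Listₚ.++-assoc (root (X S) ∷ bef (X S)) ps zs) ⟩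
        map to ((root (X S) ∷ bef (X S)) ++ (ps ++ zs))          ≡⟨ cong (λ xs → map to ((root (X S) ∷ bef (X S)) ++ xs)) eq ⟨
        map to ((root (X S) ∷ bef (X S)) ++ top (X S) ∷ stk (X S)) ≡⟨ Listₚ.map-++ to (root (X S) ∷ bef (X S)) _ ⟩
        map to (root (X S) ∷ bef (X S)) ++ map to (top (X S) ∷ stk (X S))
          ≡⟨ cong₂ _++_ (proj₁ (Zipper.zipper₁ (X S) X′ I)) (Zipper.zipper₂ (X S) X′ I) ⟩
        (root X′ ∷ bef X′) ++ top X′ ∷ stk X′                    ≡⟨ total ⟩
        as ++ bs                                                 ∎)
        (trans (Listₚ.length-map to zs) len)
        where open ≡-Reasoning

  realise : Realised Y (suc (length (stk Y)))
  realise = subst (Realised Y) (cong suc (sym (trans (cong length s-eq) (Listₚ.length-map ↑ bs)))) (go kind)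
    where
    go : (m ≡ nothing × length bs ≤ suc (length (stk X′))) ⊎ (m ≡ just (top X′) × 2 + length bs ≤ suc (length (stk X′))) →
         Realised Y (suc (length bs))
    go (inj₁ (m≡ , le)) with descend X′ le (IH X′)
    ... | w , I = grow w , unstrip {State.E (build w)} {E} nothing
                    (Pointer.c (X S) (psd S) (rest S) (split S) (dist S)) (λ ()) m c m≢c I
                    (sym m≡) (to-suffix S I (psd S) (split S) (len S)) σ-eq r-eq
      where S = build w
    go (inj₂ (m≡ , le)) with descend X′ le (IH X′)
    ... | w , I = close w , unstrip {State.E (build w)} {E} (just (top (X S))) _ (Close.m≢c S) m c m≢c I
                    (trans (cong just (Zipper.to-top (X S) X′ I)) (sym m≡))
                    (to-suffix S I (psd S ++ take 2 (rest S))
                      (trans (split S) (trans (cong (psd S ++_) (sym (Listₚ.take++drop≡id 2 (rest S))))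
                        (sym (Listₚ.++-assoc (psd S) (take 2 (rest S)) _))))
                      (trans (Listₚ.length-drop 2 (rest S)) (cong (_∸ 2) (len S)))) σ-eq r-eq
      where S = build w

module _ {E : ℕ} (Y : OMap (flip (suc E))) (top≡ : top Y ≡ e₀) where

  open Last Y top≡

  -- When only the root precedes `top` there are two vertices, and simplicity leaves a single edge
  -- between them.
  module EdgeCase (bef≡ : bef Y ≡ []) where

    private
      all₂ : ∀ x → vert Y x ≡ vert Y e₀ ⊎ vert Y x ≡ vert Y (root Y)
      all₂ x with all₀ x
      ... | inj₁ e = inj₁ e
      ... | inj₂ (d , d∈ , e) with subst (λ bs → d ∈ root Y ∷ bs) bef≡ d∈
      ...   | here refl = inj₂ e

      e₁~root : vert Y e₁ ≡ vert Y (root Y)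
      e₁~root with all₂ e₁
      ... | inj₁ e = ⊥-elim (noLoop Y e₀ (sym e))
      ... | inj₂ e = e

      opposite : ∀ x → vert Y x ≡ vert Y (root Y) → vert Y (flip (suc E) x) ≡ vert Y e₀
      opposite x e with all₂ (flip (suc E) x)
      ... | inj₁ e′ = e′
      ... | inj₂ e′ = ⊥-elim (noLoop Y x (trans e (sym e′)))

      opposite′ : ∀ x → vert Y x ≡ vert Y e₀ → vert Y (flip (suc E) x) ≡ vert Y (root Y)
      opposite′ x e with all₂ (flip (suc E) x)
      ... | inj₁ e′ = ⊥-elim (noLoop Y x (trans e (sym e′)))
      ... | inj₂ e′ = e′

      root≡ : root Y ≡ e₁
      root≡ = noMulti Y (root Y) e₁ (sym e₁~root) (opposite (root Y) refl)

      two : ∀ x → x ≡ e₀ ⊎ x ≡ e₁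
      two x with all₂ x
      ... | inj₁ e = inj₁ (noMulti Y x e₀ e (trans (opposite′ x e) (sym e₁~root)))
      ... | inj₂ e = inj₂ (noMulti Y x e₁ (trans e (sym e₁~root)) (opposite x e))

      stk≡ : stk Y ≡ []
      stk≡ = empty (stk Y) e₀∉stk (λ e₁∈ → dis (here (sym root≡)) (there e₁∈))
        where
        empty : ∀ xs → e₀ ∉ xs → e₁ ∉ xs → xs ≡ []
        empty []       _ _ = refl
        empty (x ∷ xs) a b with two x
        ... | inj₁ refl = ⊥-elim (a (here refl))
        ... | inj₂ refl = ⊥-elim (b (here refl))

      fixed : ∀ x → σ Y x ≡ x
      fixed x with two x | two (σ Y x)
      ... | inj₁ refl | inj₁ e = e
      ... | inj₂ refl | inj₂ e = e
      ... | inj₁ refl | inj₂ e = ⊥-elim (noLoop Y e₀ (trans (sym (inv (vl Y) e₀)) (cong (vert Y) e)))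
      ... | inj₂ refl | inj₁ e = ⊥-elim (noLoop Y e₀ (trans (sym (cong (vert Y) e)) (inv (vl Y) e₁)))

    edge-case : Realised Y (suc (length (stk Y)))
    edge-case = subst (Realised Y) (cong (suc ∘ length) (sym stk≡)) (edge , record
      { to = to ; inj = λ {x} {y} → to-inj x y ; sur = to-sur ; to-σ = λ x → sym (fixed (to x))
      ; to-α = λ { zero → refl ; (suc zero) → refl } ; to-r = sym root≡ })
      where
      to : Fin 2 → Fin (suc E * 2)
      to zero       = e₀
      to (suc zero) = e₁
      to-inj : ∀ x y → to x ≡ to y → x ≡ y
      to-inj zero       zero       _ = refl
      to-inj (suc zero) (suc zero) _ = refl
      to-inj zero       (suc zero) ()
      to-inj (suc zero) zero       ()
      to-sur : ∀ y → ∃ λ x → to x ≡ y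
      to-sur y with two y
      ... | inj₁ e = e₀ , sym e
      ... | inj₂ e = e₁ , sym e

  private
    -- `e₁` is sent to `σ Y e₀`, here `e₀`, so by injectivity it is the dart just before `top`.
    leaf-shape : σ Y e₀ ≡ e₀ → bef Y ≢ [] → Peel Y
    leaf-shape σe₀ ne with walk-last walk₁₀
    ... | l , l∈ , e with ∈ₚ.∈-∃++ (subst (_∈ root Y ∷ bef Y) (φ-inj′ {y = e₁} (trans e (sym σe₀))) l∈)
    ... | ys , zs , eq = go ys zs eq (proj₂ (walk-split-at ys (subst (λ xs → Walk (φ Y) (root Y) xs e₀) eq walk₁₀)))
                           (subst Unique eq u-bef)
      where
      e₁∈ : e₁ ∈ root Y ∷ bef Y
      e₁∈ = subst (e₁ ∈_) (sym eq) (∈ₚ.∈-insert ys)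
      low₂ = lower-list (stk Y) e₀∉stk (λ e₁∈stk → dis e₁∈ (there e₁∈stk))
      go : ∀ ys zs → root Y ∷ bef Y ≡ ys ++ e₁ ∷ zs → Walk (φ Y) e₁ (e₁ ∷ zs) e₀ → Unique (ys ++ e₁ ∷ zs) → Peel Y
      go ys (z ∷ zs) eq (step w) u = ⊥-elim (e₀∉bef (subst (e₀ ∈_) (sym eq)
        (∈ₚ.∈-++⁺ʳ ys (there (here (trans (sym σe₀) (walk-head w)))))))
      go [] [] eq w u = ⊥-elim (ne (Listₚ.∷-injectiveʳ eq))
      go (y ∷ ys) [] eq w u = shape (proj₁ low) (proj₂ low)
        where
        low = lower-list (y ∷ ys) (λ e₀∈ → e₀∉bef (subst (e₀ ∈_) (sym eq) (∈ₚ.∈-++⁺ˡ e₀∈)))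
          (λ e₁∈ → proj₂ (proj₂ (unique-++⁻ (y ∷ ys) u)) e₁∈ (here refl))
        shape : ∀ as → y ∷ ys ≡ map ↑ as → Peel Y
        shape (r ∷ as) eq′ = LeafCase.peel-leaf Y top≡ σe₀ r as (proj₁ low₂) (trans eq (cong (_++ e₁ ∷ []) eq′)) (proj₂ low₂)

    chord-shape : σ Y e₀ ≢ e₀ → Peel Y
    chord-shape σe₀≢ = shape (σ Y e₀) refl (proj₁ low) (proj₂ low)
      where
      low  = lower-list (root Y ∷ bef Y) e₀∉bef (e₁∉bef σe₀≢)
      low₂ = lower-list (stk Y) e₀∉stk (e₁∉stk σe₀≢)
      shape : ∀ x → σ Y e₀ ≡ x → ∀ as → root Y ∷ bef Y ≡ map ↑ as → Peel Y
      shape zero          e _        _  = ⊥-elim (σe₀≢ e)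
      shape (suc zero)    e _        _  = ⊥-elim (noLoop Y e₀ (trans (sym (inv (vl Y) e₀)) (cong (vert Y) e)))
      shape (suc (suc a)) e (r ∷ as) eq = ChordCase.peel-chord Y top≡ σe₀≢ a e r as (proj₁ low₂) eq (proj₂ low₂)

  realise-top : (∀ (Z : OMap (flip E)) → Realised Z (suc (length (stk Z)))) → Realised Y (suc (length (stk Y)))
  realise-top IH = go (bef Y) refl (σ Y e₀ Fₚ.≟ e₀)
    where
    go : ∀ bs → bef Y ≡ bs → Dec (σ Y e₀ ≡ e₀) → Realised Y (suc (length (stk Y)))
    go []      eq _        = EdgeCase.edge-case eq
    go (_ ∷ _) eq (yes σ≡) = realise (leaf-shape σ≡ (λ e → case trans (sym e) eq of λ ())) IH
    go (_ ∷ _) eq (no σ≢)  = realise (chord-shape σ≢) IH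

-- Induction on the number of edges. Each time the darts are renumbered so that the edge to be
-- removed is {`e₀`, `e₁`}.
realise-all : ∀ E (Y : OMap (flip E)) → Realised Y (suc (length (stk Y)))
realise-all zero    Y = ⊥-elim (Fₚ.¬Fin0 (root Y))
realise-all (suc E) Y with Pairing.pairing (flip (suc E)) (flip-invol (suc E)) (flip-fpf (suc E)) (top Y)
... | E′ , P , onto′ , ge₀ = subst (Realised Y) (cong suc (Listₚ.length-map C.g⁻ (stk Y)))
        (proj₁ R , iso-trans (proj₂ R) C.conjugate-iso)
  where
  open Pairing.Partial P
  module C = Conjugate Y g g-inj onto′ g-flip e₀ ge₀
  E′≡E : E′ ≡ E
  E′≡E = ℕₚ.suc-injective (ℕₚ.*-cancelʳ-≡ (suc E′) (suc E) 2 C.size)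
  R : Realised C.conjugate (suc (length (stk C.conjugate)))
  R = realise-top C.conjugate refl
        (subst (λ E → ∀ (Z : OMap (flip E)) → Realised Z (suc (length (stk Z)))) (sym E′≡E) (realise-all E))

-- From rooted outerplanar maps to words.

-- The vertex labels of `Z`, pulled back, label `Y`; beside the `F Y` faces Euler's inequality
-- leaves room for only `V Y` of them.
iso-V : ∀ {E E′} (Y : OMap (flip E)) (Z : OMap (flip E′)) → MapIso Y Z → V Z ≤ V Y
iso-V {E} Y Z I = ℕₚ.+-cancelʳ-≤ (F Y) (V Z) (V Y) (ℕₚ.≤-trans
  (euler-flip {E} (σ-inj Y) (conn Y)
    (record { lab = vert Z ∘ to ; inv = λ x → trans (cong (vert Z) (to-σ x)) (inv (vl Z) (to x))
            ; onto = λ i → let z , e = onto (vl Z) i ; y , e′ = sur z in y , trans (cong (vert Z) e′) e })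
    (fl Y))
  (ℕₚ.≤-reflexive (sym (Planar.eulerE Y))))
  where open Iso I

module Input {n : ℕ} (M : OuterplanarMap n) where

  private
    module S = SimpleOuterplanar (proj₂ M)
    module M = RootedMap (proj₁ M)

    σ-inj′ : Inj M.σf
    σ-inj′ {x} {y} e = trans (sym (Inverse.strictlyInverseʳ M.σ x))
                         (trans (cong (Inverse.from M.σ) e) (Inverse.strictlyInverseʳ M.σ y))

    φ-inj″ : Inj M.φ
    φ-inj″ {x} {y} e = trans (sym (M.α-invol x)) (trans (cong M.α (σ-inj′ e)) (M.α-invol y))

    vl″ : Lab M.σf M.nVertices
    vl″ = CycleReps.cycleLab σ-inj′

    v : Fin M.N → Fin M.nVertices
    v = lab vl″

    v-same : ∀ {x y} → v x ≡ v y → SameCycle M.σf x y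
    v-same e = orb⇒cycle (CycleReps.cycleLab-tight σ-inj′ e)

    conn″ : Connected M.σf M.α
    conn″ κ κσ κα x y = go (M.connected x y)
      where
      go : ∀ {x y} → Reach M.σf M.α x y → κ x ≡ κ y
      go here     = refl
      go (viaσ r) = trans (sym (κσ _)) (go r)
      go (viaα r) = trans (sym (κα _)) (go r)

    outerWalk : ∃ λ xs → Walk M.φ M.root (M.root ∷ xs) M.root × Unique (M.root ∷ xs)
    outerWalk = cycle φ-inj″ M.root

    xs = proj₁ outerWalk

    visited : ∀ x → ∃ λ d → d ∈ M.root ∷ xs × v x ≡ v d
    visited x = let e , x~e , r~e = S.outer x in
      e , orb-∈ φ-inj″ (proj₁ (proj₂ outerWalk)) (cycle⇒orb r~e) , lab-orb vl″ (cycle⇒orb x~e)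

    finish : ∀ bef₀ {t mid} → M.root ∷ xs ≡ bef₀ ++ t ∷ mid → All (λ d → v d ≢ v t) bef₀ →
             (∀ {d} → d ∈ M.root ∷ xs → v d ≡ v t ⊎ Any (λ e → v d ≡ v e) bef₀) →
             Σ (OMap M.α) λ Y → root Y ≡ M.root × (∀ x → σ Y x ≡ M.σf x) × V Y ≡ M.nVertices
    finish [] {t} eq fr cov = ⊥-elim (S.noLoop M.root (v-same (trans (same M.root) (sym (same (M.α M.root))))))
      where
      same : ∀ x → v x ≡ v t
      same x = let d , d∈ , e = visited x in trans e (only (cov d∈))
        where
        only : ∀ {d} → v d ≡ v t ⊎ Any (λ e → v d ≡ v e) [] → v d ≡ v t
        only (inj₁ e) = e
    finish (z ∷ zs) {t} {mid} eq fr cov = Y , sym (Listₚ.∷-injectiveˡ eq) , (λ _ → refl) , refl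
      where
      loop : Walk M.φ z ((z ∷ zs) ++ t ∷ mid) z
      loop = subst (λ r → Walk M.φ r ((z ∷ zs) ++ t ∷ mid) r) (Listₚ.∷-injectiveˡ eq)
               (subst (λ ys → Walk M.φ M.root ys M.root) eq (proj₁ (proj₂ outerWalk)))
      all″ : ∀ x → v x ≡ v t ⊎ Any (λ d → v x ≡ v d) (z ∷ zs)
      all″ x = let d , d∈ , e = visited x in [ (λ e′ → inj₁ (trans e e′)) , (λ a → inj₂ (Any.map (trans e) a)) ]′ (cov d∈)
      Y : OMap M.α
      Y .σ       = M.σf
      Y .σ-inj   = σ-inj′
      Y .V       = M.nVertices
      Y .F       = M.nFaces
      Y .vl      = vl″
      Y .fl      = CycleReps.cycleLab φ-inj″
      Y .euler   = M.planar
      Y .conn    = conn″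
      Y .noLoop x e = S.noLoop x (v-same e)
      Y .noMulti x y e e′ = S.noMulti x y (v-same e) (v-same e′)
      Y .root    = z
      Y .top     = t
      Y .bef     = zs
      Y .stk     = mid
      Y .walk₁   = proj₁ (walk-split-at (z ∷ zs) loop)
      Y .walk₂   = proj₂ (walk-split-at (z ∷ zs) loop)
      Y .uniq    = subst Unique eq (proj₂ (proj₂ outerWalk))
      Y .new     = fr
      Y .all     = all″

  abstract
    asOMap : Σ (OMap M.α) λ Y → root Y ≡ M.root × (∀ x → σ Y x ≡ M.σf x) × V Y ≡ M.nVertices
    asOMap = finish before eq fresh covered
      where open LastNew (lastNew v M.root xs)

  private
    Realises : Word 0 → Set
    Realises w = vertices# w ≡ n × Iso (σ (X (build w))) (flip (E (build w))) (root (X (build w))) M.σf M.α M.root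

    module _ (Y : OMap M.α) (root≡ : root Y ≡ M.root) (σ≡ : ∀ x → σ Y x ≡ M.σf x) (V≡ : V Y ≡ M.nVertices)
             {E′ : ℕ} (P : Pairing.Partial M.α M.α-invol M.α-fpf (suc E′))
             (onto′ : ∀ y → ∃ λ x → Pairing.Partial.g P x ≡ y) (ge₀ : Pairing.Partial.g P e₀ ≡ top Y) where

      open Pairing.Partial P

      module C = Conjugate Y g g-inj onto′ g-flip e₀ ge₀

      realises : (R : Realised C.conjugate 0) → Realises (proj₁ R)
      realises (w , I) =
        ℕₚ.suc-injective (trans (sym (build-V w)) (trans sameV (trans V≡ S.vertices))) ,
        iso-trans (iso-trans I C.conjugate-iso)
          (record { to = id ; inj = id ; sur = λ y → y , refl ; to-σ = σ≡ ; to-α = λ _ → refl ; to-r = root≡ })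
        where
        sameV : V (X (build w)) ≡ V Y
        sameV = ℕₚ.≤-antisym (iso-V C.conjugate (X (build w)) (iso-sym I)) (iso-V (X (build w)) C.conjugate I)

      realisedY : ∃ Realises
      realisedY = let R = descend C.conjugate z≤n (realise-all (suc E′) C.conjugate) in proj₁ R , realises R

  abstract
    realised : ∃ λ (w : Word 0) → vertices# w ≡ n ×
               Iso (σ (X (build w))) (flip (E (build w))) (root (X (build w))) M.σf M.α M.root
    realised = let Y , root≡ , σ≡ , V≡ = asOMap
                   E′ , P , onto′ , ge₀ = Pairing.pairing M.α M.α-invol M.α-fpf (top Y)
               in realisedY Y root≡ σ≡ V≡ P onto′ ge₀

wordMap : ∀ {n} → (∃ λ (w : Word 0) → vertices# w ≡ n) → OuterplanarMap n
wordMap (w , e) = Output.rootedMap (X (build w)) (reach (build w)) ,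
                  Output.outerplanar (X (build w)) (reach (build w)) (trans (build-V w) (cong suc e))

wordMap-surjective : ∀ {n} (M : OuterplanarMap n) → ∃ λ w → proj₁ (wordMap w) ≅ proj₁ M
wordMap-surjective M = let w , e , I = Input.realised M in (w , e) , iso⇒≅ {proj₁ (wordMap (w , e))} {proj₁ M} I

wordMap-injective : ∀ {n} (w w′ : ∃ λ (w : Word 0) → vertices# w ≡ n) → proj₁ (wordMap w) ≅ proj₁ (wordMap w′) → w ≡ w′
wordMap-injective (w , e) (w′ , e′) iso =
  same (build-inj w w′ (≅⇒iso {proj₁ (wordMap (w , e))} {proj₁ (wordMap (w′ , e′))} iso)) e e′
  where
  same : ∀ {n} {w w′ : Word 0} → w ≡ w′ → (e : vertices# w ≡ n) (e′ : vertices# w′ ≡ n) → (w , e) ≡ (w′ , e′)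
  same refl e e′ = cong (_ ,_) (ℕₚ.≡-irrelevant e e′)

-- Colored Dyck paths as trees.

-- Schröder paths whose north and diagonal steps carry a forest each: Ground is a path on the diagonal,
-- Aloft a stretch of path above it up to the next return to its own height. blk k g l is a block whose
-- j = 1 + riseG g descents are preceded by k and by the forests in g, followed by l.
mutual
  data Forest : Set where
    ∅   : Forest
    blk : Forest → Ground → Forest → Forest

  data Ground : Set where
    nilᵍ   : Ground
    northᵍ : Forest → Aloft → Ground → Ground

  data Aloft : Set where
    nilᵃ   : Aloft
    diagᵃ  : Forest → Aloft → Aloft
    northᵃ : Forest → Aloft → Aloft → Aloft

mutual
  -- Each unit is one level of some block: two of its up-steps, and one of the down-steps written
  -- outside blocks.
  sizeF : Forest → ℕ
  sizeF ∅           = 0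
  sizeF (blk k g l) = suc (sizeF k + sizeG g + sizeF l)

  sizeG : Ground → ℕ
  sizeG nilᵍ           = 0
  sizeG (northᵍ k a g) = suc (sizeF k + sizeA a + sizeG g)

  sizeA : Aloft → ℕ
  sizeA nilᵃ           = 0
  sizeA (diagᵃ k a)    = suc (sizeF k + sizeA a)
  sizeA (northᵃ k a b) = suc (sizeF k + sizeA a + sizeA b)

-- The advance in each coordinate and also the number of forests carried, since both are counted by
-- `north` and `diag` steps. Hence a color from s_(j-1) has room for exactly the j - 1 descents
-- after the first.
riseA : Aloft → ℕ
riseA nilᵃ           = 0
riseA (diagᵃ _ a)    = suc (riseA a)
riseA (northᵃ _ a b) = suc (riseA a + riseA b)

riseG : Ground → ℕ
riseG nilᵍ           = 0
riseG (northᵍ _ a g) = suc (riseA a + riseG g)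

shapeA : Aloft → List LStep → List LStep
shapeA nilᵃ           s = s
shapeA (diagᵃ _ a)    s = diag ∷ shapeA a s
shapeA (northᵃ _ a b) s = north ∷ shapeA a (east ∷ shapeA b s)

shapeG : Ground → List LStep
shapeG nilᵍ           = []
shapeG (northᵍ _ a g) = north ∷ shapeA a (east ∷ shapeG g)

shapeA-valid : ∀ {m x y} a {s} → x < y → SValid m (riseA a + x) (riseA a + y) s → SValid m x y (shapeA a s)
shapeA-valid nilᵃ lt v = v
shapeA-valid {m} {x} {y} (diagᵃ _ a) {s} lt v = fromWitnessFalse (ℕₚ.<⇒≢ lt) ,
  shapeA-valid a (s≤s lt) (subst₂ (λ i j → SValid m i j s) (sym (ℕₚ.+-suc (riseA a) x)) (sym (ℕₚ.+-suc (riseA a) y)) v)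
shapeA-valid {m} {x} {y} (northᵃ _ a b) {s} lt v = shapeA-valid a (ℕₚ.<-trans lt (ℕₚ.n<1+n y))
  ( ℕₚ.<⇒≤ below
  , shapeA-valid b below (subst₂ (λ i j → SValid m i j s) (eqx (riseA a) (riseA b) x) (eqy (riseA a) (riseA b) y) v))
  where
  open +-*-Solver
  below : suc (riseA a + x) < riseA a + suc y
  below = ℕₚ.≤-trans (s≤s (ℕₚ.+-monoʳ-< (riseA a) lt)) (ℕₚ.≤-reflexive (sym (ℕₚ.+-suc (riseA a) y)))
  eqx : ∀ p q x → suc (p + q + x) ≡ q + suc (p + x)
  eqx = solve 3 (λ p q x → con 1 :+ (p :+ q :+ x) := q :+ (con 1 :+ (p :+ x))) refl
  eqy : ∀ p q y → suc (p + q + y) ≡ q + (p + suc y)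
  eqy = solve 3 (λ p q y → con 1 :+ (p :+ q :+ y) := q :+ (p :+ (con 1 :+ y))) refl

shapeG-valid : ∀ {m x} g → riseG g + x ≡ m → SValid m x x (shapeG g)
shapeG-valid nilᵍ e = e , e
shapeG-valid {m} {x} (northᵍ _ a g) e = shapeA-valid a (ℕₚ.n<1+n x)
  ( ℕₚ.≤-reflexive (sym (ℕₚ.+-suc (riseA a) x))
  , subst (λ j → SValid m (suc (riseA a + x)) j (shapeG g)) (sym (ℕₚ.+-suc (riseA a) x))
      (shapeG-valid g (trans (eq (riseA a) (riseG g) x) e)))
  where
  open +-*-Solver
  eq : ∀ p q x → q + suc (p + x) ≡ suc (p + q + x)
  eq = solve 3 (λ p q x → q :+ (con 1 :+ (p :+ x)) := con 1 :+ (p :+ q :+ x)) refl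

color : (g : Ground) → SchröderPath (riseG g)
color g = shapeG g , shapeG-valid g (ℕₚ.+-identityʳ (riseG g))

mutual
  flatF : Forest → List DStep → List DStep
  flatF ∅           w = w
  flatF (blk k g l) w = block (riseG g) (color g) ∷ flatF k (dn ∷ flatG g (flatF l w))

  flatG : Ground → List DStep → List DStep
  flatG nilᵍ           w = w
  flatG (northᵍ k a g) w = flatF k (dn ∷ flatA a (flatG g w))

  flatA : Aloft → List DStep → List DStep
  flatA nilᵃ           w = w
  flatA (diagᵃ k a)    w = flatF k (dn ∷ flatA a w)
  flatA (northᵃ k a b) w = flatF k (dn ∷ flatA a (flatA b w))

dyck-block : ∀ h {k c w} → DyckFrom (h + suc k) w → DyckFrom h (block k c ∷ w)
dyck-block zero    d = d
dyck-block (suc h) d = d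

dyck-unblock : ∀ h {k c w} → DyckFrom h (block k c ∷ w) → DyckFrom (h + suc k) w
dyck-unblock zero    d = d
dyck-unblock (suc h) d = d

dyck-level : ∀ {h h′} w → h ≡ h′ → DyckFrom h w → DyckFrom h′ w
dyck-level w refl d = d

mutual
  dyckF : ∀ k h w → DyckFrom h w → DyckFrom h (flatF k w)
  dyckF ∅           h w d = d
  dyckF (blk k g l) h w d = dyck-block h (dyck-level (flatF k (dn ∷ flatG g (flatF l w)))
    (trans (cong suc (ℕₚ.+-comm (riseG g) h)) (sym (ℕₚ.+-suc h (riseG g))))
    (dyckF k (suc (riseG g + h)) (dn ∷ flatG g (flatF l w)) (dyckG g h (flatF l w) (dyckF l h w d))))

  dyckG : ∀ g h w → DyckFrom h w → DyckFrom (riseG g + h) (flatG g w)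
  dyckG nilᵍ           h w d = d
  dyckG (northᵍ k a g) h w d = dyckF k (suc (riseA a + riseG g) + h) (dn ∷ flatA a (flatG g w))
    (dyck-level (flatA a (flatG g w)) (sym (ℕₚ.+-assoc (riseA a) (riseG g) h))
      (dyckA a (riseG g + h) (flatG g w) (dyckG g h w d)))

  dyckA : ∀ a h w → DyckFrom h w → DyckFrom (riseA a + h) (flatA a w)
  dyckA nilᵃ           h w d = d
  dyckA (diagᵃ k a)    h w d = dyckF k (suc (riseA a) + h) (dn ∷ flatA a w) (dyckA a h w d)
  dyckA (northᵃ k a b) h w d = dyckF k (suc (riseA a + riseA b) + h) (dn ∷ flatA a (flatA b w))
    (dyck-level (flatA a (flatA b w)) (sym (ℕₚ.+-assoc (riseA a) (riseA b) h))
      (dyckA a (riseA b + h) (flatA b w) (dyckA b h w d)))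

two-parts : ∀ r s k a b {t} u v z → t ≡ 2 * k + u → 2 * r + u ≡ 2 * a + v → 2 * s + v ≡ 2 * b + z →
            2 * suc (r + s) + t ≡ 2 * suc (k + a + b) + z
two-parts r s k a b {t} u v z e₁ e₂ e₃ = begin
  2 * suc (r + s) + t                   ≡⟨ cong (2 * suc (r + s) +_) e₁ ⟩
  2 * suc (r + s) + (2 * k + u)
    ≡⟨ solve 4 (λ r s k u → con 2 :* (con 1 :+ (r :+ s)) :+ (con 2 :* k :+ u)
               := con 2 :+ con 2 :* k :+ con 2 :* s :+ (con 2 :* r :+ u)) refl r s k u ⟩
  2 + 2 * k + 2 * s + (2 * r + u)       ≡⟨ cong (2 + 2 * k + 2 * s +_) e₂ ⟩
  2 + 2 * k + 2 * s + (2 * a + v)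
    ≡⟨ solve 4 (λ k s a v → con 2 :+ con 2 :* k :+ con 2 :* s :+ (con 2 :* a :+ v)
               := con 2 :+ con 2 :* k :+ con 2 :* a :+ (con 2 :* s :+ v)) refl k s a v ⟩
  2 + 2 * k + 2 * a + (2 * s + v)       ≡⟨ cong (2 + 2 * k + 2 * a +_) e₃ ⟩
  2 + 2 * k + 2 * a + (2 * b + z)
    ≡⟨ solve 4 (λ k a b z → con 2 :+ con 2 :* k :+ con 2 :* a :+ (con 2 :* b :+ z)
               := con 2 :* (con 1 :+ (k :+ a :+ b)) :+ z) refl k a b z ⟩
  2 * suc (k + a + b) + z               ∎
  where
  open ≡-Reasoning
  open +-*-Solver using (solve; _:+_; _:*_; _:=_; con)

mutual
  upsF : ∀ k w → ups (flatF k w) ≡ 2 * sizeF k + ups w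
  upsF ∅           w = refl
  upsF (blk k g l) w = begin
    2 * suc (riseG g) + ups (flatF k (dn ∷ flatG g (flatF l w)))  ≡⟨ cong (2 * suc (riseG g) +_) (upsF k _) ⟩
    2 * suc (riseG g) + (2 * sizeF k + ups (flatG g (flatF l w)))
      ≡⟨ rearrange (riseG g) (sizeF k) (ups (flatG g (flatF l w))) ⟩
    2 + 2 * sizeF k + (2 * riseG g + ups (flatG g (flatF l w)))
      ≡⟨ cong (2 + 2 * sizeF k +_) (trans (upsG g _) (cong (2 * sizeG g +_) (upsF l w))) ⟩
    2 + 2 * sizeF k + (2 * sizeG g + (2 * sizeF l + ups w))       ≡⟨ collect (sizeF k) (sizeG g) (sizeF l) (ups w) ⟩
    2 * sizeF (blk k g l) + ups w                                 ∎
    where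
    open ≡-Reasoning
    open +-*-Solver using (solve; _:+_; _:*_; _:=_; con)
    rearrange : ∀ r k u → 2 * suc r + (2 * k + u) ≡ 2 + 2 * k + (2 * r + u)
    rearrange = solve 3 (λ r k u → con 2 :* (con 1 :+ r) :+ (con 2 :* k :+ u)
                                := con 2 :+ con 2 :* k :+ (con 2 :* r :+ u)) refl
    collect : ∀ k g l u → 2 + 2 * k + (2 * g + (2 * l + u)) ≡ 2 * suc (k + g + l) + u
    collect = solve 4 (λ k g l u → con 2 :+ con 2 :* k :+ (con 2 :* g :+ (con 2 :* l :+ u))
                                := con 2 :* (con 1 :+ (k :+ g :+ l)) :+ u) refl

  -- A block writes all its up-steps before the path that colors it, so they appear here as a debt
  -- of twice the rise.
  upsG : ∀ g w → 2 * riseG g + ups (flatG g w) ≡ 2 * sizeG g + ups w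
  upsG nilᵍ           w = refl
  upsG (northᵍ k a g) w =
    two-parts (riseA a) (riseG g) (sizeF k) (sizeA a) (sizeG g) _ _ (ups w) (upsF k _) (upsA a _) (upsG g w)

  upsA : ∀ a w → 2 * riseA a + ups (flatA a w) ≡ 2 * sizeA a + ups w
  upsA nilᵃ           w = refl
  upsA (diagᵃ k a)    w = begin
    2 * suc (riseA a) + ups (flatF k (dn ∷ flatA a w))      ≡⟨ cong (2 * suc (riseA a) +_) (upsF k _) ⟩
    2 * suc (riseA a) + (2 * sizeF k + ups (flatA a w))     ≡⟨ rearrange (riseA a) (sizeF k) _ ⟩
    2 + 2 * sizeF k + (2 * riseA a + ups (flatA a w))       ≡⟨ cong (2 + 2 * sizeF k +_) (upsA a w) ⟩
    2 + 2 * sizeF k + (2 * sizeA a + ups w)                 ≡⟨ collect (sizeF k) (sizeA a) (ups w) ⟩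
    2 * suc (sizeF k + sizeA a) + ups w                     ∎
    where
    open ≡-Reasoning
    open +-*-Solver using (solve; _:+_; _:*_; _:=_; con)
    rearrange : ∀ r k u → 2 * suc r + (2 * k + u) ≡ 2 + 2 * k + (2 * r + u)
    rearrange = solve 3 (λ r k u → con 2 :* (con 1 :+ r) :+ (con 2 :* k :+ u)
                                := con 2 :+ con 2 :* k :+ (con 2 :* r :+ u)) refl
    collect : ∀ k a u → 2 + 2 * k + (2 * a + u) ≡ 2 * suc (k + a) + u
    collect = solve 3 (λ k a u → con 2 :+ con 2 :* k :+ (con 2 :* a :+ u) := con 2 :* (con 1 :+ (k :+ a)) :+ u) refl
  upsA (northᵃ k a b) w =
    two-parts (riseA a) (riseA b) (sizeF k) (sizeA a) (sizeA b) _ _ (ups w) (upsF k _) (upsA a _) (upsA b w)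

-- This is how the end of a forest is recognised: what follows it is a down-step or the end of the
-- word.
data NoBlock : List DStep → Set where
  end  : NoBlock []
  down : ∀ {w} → NoBlock (dn ∷ w)

stepShape : DStep → List LStep
stepShape dn          = []
stepShape (block _ c) = proj₁ c

mutual
  flatF-inj : ∀ k k′ {w w′} → NoBlock w → NoBlock w′ → flatF k w ≡ flatF k′ w′ → k ≡ k′ × w ≡ w′
  flatF-inj ∅           ∅              _    _    e = refl , e
  flatF-inj ∅           (blk _ _ _)    end  _    ()
  flatF-inj ∅           (blk _ _ _)    down _    ()
  flatF-inj (blk _ _ _) ∅              _    end  ()
  flatF-inj (blk _ _ _) ∅              _    down ()
  flatF-inj (blk k g l) (blk k′ g′ l′) nb   nb′  e
    with flatF-inj k k′ down down (Listₚ.∷-injectiveʳ e)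
  ... | refl , e₁ with flatG-inj g g′ (cong stepShape (Listₚ.∷-injectiveˡ e)) (Listₚ.∷-injectiveʳ e₁)
  ... | refl , e₂ with flatF-inj l l′ nb nb′ e₂
  ... | refl , e₃ = refl , e₃

  flatG-inj : ∀ g g′ {w w′} → shapeG g ≡ shapeG g′ → flatG g w ≡ flatG g′ w′ → g ≡ g′ × w ≡ w′
  flatG-inj nilᵍ           nilᵍ              s e = refl , e
  flatG-inj nilᵍ           (northᵍ _ _ _)    () e
  flatG-inj (northᵍ _ _ _) nilᵍ              () e
  flatG-inj (northᵍ k a g) (northᵍ k′ a′ g′) s e with flatF-inj k k′ down down e
  ... | refl , e₁ with flatA-inj a a′ (Listₚ.∷-injectiveʳ s) (Listₚ.∷-injectiveʳ e₁)
  ... | refl , s₁ , e₂ with flatG-inj g g′ s₁ e₂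
  ... | refl , e₃ = refl , e₃

  -- The `east` step marks where the stretch ends: `diag` and `north` continue it at its own level.
  flatA-inj : ∀ a a′ {s s′ w w′} → shapeA a (east ∷ s) ≡ shapeA a′ (east ∷ s′) → flatA a w ≡ flatA a′ w′ →
              a ≡ a′ × s ≡ s′ × w ≡ w′
  flatA-inj nilᵃ           nilᵃ              s e = refl , Listₚ.∷-injectiveʳ s , e
  flatA-inj nilᵃ           (diagᵃ _ _)       () e
  flatA-inj nilᵃ           (northᵃ _ _ _)    () e
  flatA-inj (diagᵃ _ _)    nilᵃ              () e
  flatA-inj (diagᵃ _ _)    (northᵃ _ _ _)    () e
  flatA-inj (northᵃ _ _ _) nilᵃ              () e
  flatA-inj (northᵃ _ _ _) (diagᵃ _ _)       () e
  flatA-inj (diagᵃ k a)    (diagᵃ k′ a′)     s e with flatF-inj k k′ down down e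
  ... | refl , e₁ with flatA-inj a a′ (Listₚ.∷-injectiveʳ s) (Listₚ.∷-injectiveʳ e₁)
  ... | refl , s₁ , e₂ = refl , s₁ , e₂
  flatA-inj (northᵃ k a b) (northᵃ k′ a′ b′) s e with flatF-inj k k′ down down e
  ... | refl , e₁ with flatA-inj a a′ (Listₚ.∷-injectiveʳ s) (Listₚ.∷-injectiveʳ e₁)
  ... | refl , s₁ , e₂ with flatA-inj b b′ s₁ e₂
  ... | refl , s₂ , e₃ = refl , s₂ , e₃

kidsA : Aloft → List Forest → List Forest
kidsA nilᵃ           ks = ks
kidsA (diagᵃ k a)    ks = k ∷ kidsA a ks
kidsA (northᵃ k a b) ks = k ∷ kidsA a (kidsA b ks)

kidsG : Ground → List Forest
kidsG nilᵍ           = []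
kidsG (northᵍ k a g) = k ∷ kidsA a (kidsG g)

flatKids : List Forest → List DStep → List DStep
flatKids []       w = w
flatKids (k ∷ ks) w = flatF k (dn ∷ flatKids ks w)

flatKids-++ : ∀ ks {ls} w → flatKids (ks ++ ls) w ≡ flatKids ks (flatKids ls w)
flatKids-++ []       w = refl
flatKids-++ (k ∷ ks) w = cong (λ v → flatF k (dn ∷ v)) (flatKids-++ ks w)

flatA-kids : ∀ a ks w → flatKids (kidsA a ks) w ≡ flatA a (flatKids ks w)
flatA-kids nilᵃ           ks w = refl
flatA-kids (diagᵃ k a)    ks w = cong (λ v → flatF k (dn ∷ v)) (flatA-kids a ks w)
flatA-kids (northᵃ k a b) ks w = cong (λ v → flatF k (dn ∷ v)) (trans (flatA-kids a _ w) (cong (flatA a) (flatA-kids b ks w)))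

flatG-kids : ∀ g w → flatKids (kidsG g) w ≡ flatG g w
flatG-kids nilᵍ           w = refl
flatG-kids (northᵍ k a g) w = cong (λ v → flatF k (dn ∷ v)) (trans (flatA-kids a _ w) (cong (flatA a) (flatG-kids g w)))

length-kidsA : ∀ a ks → length (kidsA a ks) ≡ riseA a + length ks
length-kidsA nilᵃ           ks = refl
length-kidsA (diagᵃ k a)    ks = cong suc (length-kidsA a ks)
length-kidsA (northᵃ k a b) ks = cong suc (trans (length-kidsA a _)
  (trans (cong (riseA a +_) (length-kidsA b ks)) (sym (ℕₚ.+-assoc (riseA a) _ _))))

length-kidsG : ∀ g → length (kidsG g) ≡ riseG g
length-kidsG nilᵍ           = refl
length-kidsG (northᵍ k a g) = cong suc (trans (length-kidsA a _) (cong (riseA a +_) (length-kidsG g)))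

-- The rest of a path that begins above the diagonal: one stretch for each level, ended by the
-- `east` step that leaves that level.
shapeS : List Aloft → Ground → List LStep
shapeS []       g = shapeG g
shapeS (a ∷ as) g = shapeA a (east ∷ shapeS as g)

kidsS : List Aloft → Ground → List Forest
kidsS []       g = kidsG g
kidsS (a ∷ as) g = kidsA a (kidsS as g)

record Assembled (t : ℕ) (c : List LStep) (ks : List Forest) : Set where
  constructor assembled
  field
    as      : List Aloft
    g       : Ground
    height  : length as ≡ t
    shape≡  : c ≡ shapeS as g
    kids≡   : ks ≡ kidsS as g

svalid-≤ : ∀ {m} x y c → SValid m x y c → y ≤ m
svalid-≤ x y []          (_ , refl) = ℕₚ.≤-refl
svalid-≤ x y (east ∷ c)  (_ , v)    = svalid-≤ (suc x) y c v
svalid-≤ x y (north ∷ c) v          = ℕₚ.≤-trans (ℕₚ.n≤1+n y) (svalid-≤ x (suc y) c v)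
svalid-≤ x y (diag ∷ c)  (_ , v)    = ℕₚ.≤-trans (ℕₚ.n≤1+n y) (svalid-≤ (suc x) (suc y) c v)

-- `t` is the height above the diagonal. The tail is cut first; then `diag` prolongs the topmost
-- stretch, while `north` fuses it with what lies below. The condition on `ks` provides one forest
-- for each `north` or `diag` step to come, as these are the steps that raise the second coordinate.
assemble : ∀ {m} t x c ks → SValid m x (t + x) c → length ks + (t + x) ≡ m → Assembled t c ks
assemble zero    x [] []       (refl , e) len = assembled [] nilᵍ refl refl refl
assemble zero    x [] (k ∷ ks) (refl , e) len = ⊥-elim (ℕₚ.m≢1+n+m x (sym len))
assemble (suc t) x [] ks       (refl , e) len = ⊥-elim (ℕₚ.m≢1+n+m x (sym e))
assemble zero x (east ∷ c) ks (lt , v) len = ⊥-elim (ℕₚ.<-irrefl refl lt)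
assemble {m} (suc t) x (east ∷ c) ks (_ , v) len
  with assembled as g h s k ← assemble t (suc x) c ks (subst (λ y → SValid m (suc x) y c) (sym (ℕₚ.+-suc t x)) v)
                                (trans (cong (length ks +_) (ℕₚ.+-suc t x)) len)
  = assembled (nilᵃ ∷ as) g (cong suc h) (cong (east ∷_) s) k
assemble t x (north ∷ c) [] v refl = ⊥-elim (ℕₚ.<-irrefl refl (svalid-≤ x (suc (t + x)) c v))
assemble t x (north ∷ c) (k ∷ ks) v len
  with assemble (suc t) x c ks v (trans (ℕₚ.+-suc (length ks) (t + x)) len)
... | assembled (a ∷ []) g refl s e = assembled [] (northᵍ k a g) refl (cong (north ∷_) s) (cong (k ∷_) e)
... | assembled (a ∷ b ∷ as) g refl s e = assembled (northᵃ k a b ∷ as) g refl (cong (north ∷_) s) (cong (k ∷_) e)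
assemble zero x (diag ∷ c) ks (x≢x , v) len = ⊥-elim (toWitnessFalse x≢x refl)
assemble t@(suc _) x (diag ∷ c) [] (_ , v) refl = ⊥-elim (ℕₚ.<-irrefl refl (svalid-≤ (suc x) (suc (t + x)) c v))
assemble {m} t@(suc t′) x (diag ∷ c) (k ∷ ks) (_ , v) len
  with assemble t (suc x) c ks (subst (λ y → SValid m (suc x) y c) (sym (ℕₚ.+-suc t x)) v)
         (trans (cong (length ks +_) (ℕₚ.+-suc t x)) (trans (ℕₚ.+-suc (length ks) (t + x)) len))
... | assembled (a ∷ as) g h s e = assembled (diagᵃ k a ∷ as) g h (cong (diag ∷_) s) (cong (k ∷_) e)

svalid-irrelevant : ∀ {m} x y c (v v′ : SValid m x y c) → v ≡ v′
svalid-irrelevant x y []          (a , b) (a′ , b′) = cong₂ _,_ (ℕₚ.≡-irrelevant a a′) (ℕₚ.≡-irrelevant b b′)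
svalid-irrelevant x y (east ∷ c)  (a , v) (a′ , v′) = cong₂ _,_ (ℕₚ.≤-irrelevant a a′) (svalid-irrelevant (suc x) y c v v′)
svalid-irrelevant x y (north ∷ c) v       v′        = svalid-irrelevant x (suc y) c v v′
svalid-irrelevant x y (diag ∷ c)  (a , v) (a′ , v′) = cong₂ _,_ (T-irrelevant a a′) (svalid-irrelevant (suc x) (suc y) c v v′)

dyck-irrelevant : ∀ h w (d d′ : DyckFrom h w) → d ≡ d′
dyck-irrelevant h       []              d d′ = ℕₚ.≡-irrelevant d d′
dyck-irrelevant (suc h) (dn ∷ w)        d d′ = dyck-irrelevant h w d d′
dyck-irrelevant zero    (block k c ∷ w) d d′ = dyck-irrelevant (suc k) w d d′
dyck-irrelevant (suc h) (block k c ∷ w) d d′ = dyck-irrelevant (suc h + suc k) w d d′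

split-length : ∀ {A : Set} n {m} (xs : List A) → length xs ≡ n + m →
               ∃ λ ys → ∃ λ zs → xs ≡ ys ++ zs × length ys ≡ n × length zs ≡ m
split-length zero    xs       e = [] , xs , refl , refl , e
split-length (suc n) (x ∷ xs) e with split-length n xs (ℕₚ.suc-injective e)
... | ys , zs , refl , e₁ , e₂ = x ∷ ys , zs , refl , cong suc e₁ , e₂

block-color : ∀ {j} (c : SchröderPath j) g → riseG g ≡ j → proj₁ c ≡ shapeG g → block j c ≡ block (riseG g) (color g)
block-color (c , v) g refl refl = cong (λ v → block (riseG g) (shapeG g , v)) (svalid-irrelevant 0 0 (shapeG g) v _)

-- From height `h` there are `h` forests, each followed by a down-step, and one at the bottom. A
-- block claims the first `suc j` of them: one becomes its `k` and the others are spread along its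
-- color. The next forest continues the level on which the block stands.
unflatten : ∀ w h → DyckFrom h w → ∃ λ ks → ∃ λ k → length ks ≡ h × w ≡ flatKids ks (flatF k [])
unflatten [] h d = [] , ∅ , sym d , refl
unflatten (dn ∷ w) (suc h) d with unflatten w h d
... | ks , k , e , refl = ∅ ∷ ks , k , cong suc e , refl
unflatten (block j c ∷ w) h d with unflatten w (h + suc j) (dyck-unblock h d)
... | ks , k , e , refl with split-length (suc j) ks (trans e (ℕₚ.+-comm h (suc j)))
... | k₁ ∷ kids , zs , refl , e₁ , e₂
  with assemble 0 0 (proj₁ c) kids (proj₂ c) (trans (ℕₚ.+-identityʳ _) (ℕₚ.suc-injective e₁))
... | assembled [] g _ s refl = finish zs e₂
  where
  start : block j c ≡ block (riseG g) (color g)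
  start = block-color c g (trans (sym (length-kidsG g)) (ℕₚ.suc-injective e₁)) s
  onBlock : List Forest → List DStep → List DStep
  onBlock ks v = block j c ∷ flatF k₁ (dn ∷ flatKids ks v)
  body : ∀ zs v → onBlock (kidsG g ++ zs) v ≡ flatF (blk k₁ g ∅) (flatKids zs v)
  body zs v = cong₂ _∷_ start (cong (λ u → flatF k₁ (dn ∷ u)) (trans (flatKids-++ (kidsG g) v) (flatG-kids g _)))
  finish : ∀ zs → length zs ≡ h → ∃ λ ks → ∃ λ l → length ks ≡ h ×
           onBlock (kidsG g ++ zs) (flatF k []) ≡ flatKids ks (flatF l [])
  finish []       e = [] , blk k₁ g k , e , body [] (flatF k [])
  finish (z ∷ zs) e = blk k₁ g z ∷ zs , k , e , body (z ∷ zs) (flatF k [])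

toDyck : ∀ {n} → (∃ λ k → sizeF k ≡ n) → ColoredDyck n
toDyck (k , refl) = flatF k [] , trans (upsF k []) (ℕₚ.+-identityʳ _) , dyckF k 0 [] refl

colored≡ : ∀ {n} {p q : ColoredDyck n} → proj₁ p ≡ proj₁ q → p ≡ q
colored≡ {p = w , e , d} {.w , e′ , d′} refl = cong (w ,_) (cong₂ _,_ (ℕₚ.≡-irrelevant e e′) (dyck-irrelevant 0 w d d′))

toDyck-word : ∀ {n} (K : ∃ λ k → sizeF k ≡ n) → proj₁ (toDyck K) ≡ flatF (proj₁ K) []
toDyck-word (k , refl) = refl

toDyck-injective : ∀ {n} (K K′ : ∃ λ k → sizeF k ≡ n) → toDyck K ≡ toDyck K′ → proj₁ K ≡ proj₁ K′
toDyck-injective K K′ e = proj₁ (flatF-inj (proj₁ K) (proj₁ K′) end end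
  (trans (sym (toDyck-word K)) (trans (cong proj₁ e) (toDyck-word K′))))

toDyck-surjective : ∀ {n} (p : ColoredDyck n) → ∃ λ K → toDyck K ≡ p
toDyck-surjective {n} (w , e , d) with unflatten w 0 d
... | [] , k , _ , w≡ = (k , size≡) ,
  colored≡ {n} {toDyck (k , size≡)} {w , e , d} (trans (toDyck-word (k , size≡)) (sym w≡))
  where
  size≡ : sizeF k ≡ n
  size≡ = ℕₚ.*-cancelˡ-≡ (sizeF k) n 2 (trans (sym (ℕₚ.+-identityʳ _)) (trans (sym (upsF k [])) (trans (cong ups (sym w≡)) e)))

-- Words as trees.

-- Forest × Ground ≅ Aloft: with q = k g, the first two equations give q = 1 + t k q + t k a q, which is the
-- equation of a if q = a.
join : Forest → Ground → Aloft
join ∅           nilᵍ           = nilᵃ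
join (blk k g l) nilᵍ           = diagᵃ l (join k g)
join k           (northᵍ l a g) = northᵃ k a (join l g)

unjoin : Aloft → Forest × Ground
unjoin nilᵃ           = ∅ , nilᵍ
unjoin (diagᵃ l a)    = blk (proj₁ (unjoin a)) (proj₂ (unjoin a)) l , nilᵍ
unjoin (northᵃ k a b) = k , northᵍ (proj₁ (unjoin b)) a (proj₂ (unjoin b))

unjoin-join : ∀ k g → unjoin (join k g) ≡ (k , g)
unjoin-join ∅           nilᵍ           = refl
unjoin-join (blk k g l) nilᵍ           = cong (λ p → blk (proj₁ p) (proj₂ p) l , nilᵍ) (unjoin-join k g)
unjoin-join ∅           (northᵍ l a g) = cong (λ p → ∅ , northᵍ (proj₁ p) a (proj₂ p)) (unjoin-join l g)
unjoin-join k@(blk _ _ _) (northᵍ l a g) = cong (λ p → k , northᵍ (proj₁ p) a (proj₂ p)) (unjoin-join l g)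

join-north : ∀ k l a g → join k (northᵍ l a g) ≡ northᵃ k a (join l g)
join-north ∅           l a g = refl
join-north (blk _ _ _) l a g = refl

join-unjoin : ∀ a → join (proj₁ (unjoin a)) (proj₂ (unjoin a)) ≡ a
join-unjoin nilᵃ           = refl
join-unjoin (diagᵃ l a)    = cong (diagᵃ l) (join-unjoin a)
join-unjoin (northᵃ k a b) = trans (join-north k _ a _) (cong (northᵃ k a) (join-unjoin b))

size-join : ∀ k g → sizeA (join k g) ≡ sizeF k + sizeG g
size-join ∅           nilᵍ           = refl
size-join (blk k g l) nilᵍ           = trans (cong (λ s → suc (sizeF l + s)) (size-join k g))
  (solve 3 (λ k g l → con 1 :+ (l :+ (k :+ g)) := con 1 :+ (k :+ g :+ l) :+ con 0) refl (sizeF k) (sizeG g) (sizeF l))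
  where open +-*-Solver
size-join k           (northᵍ l a g) = trans (cong sizeA (join-north k l a g))
  (trans (cong (λ s → suc (sizeF k + sizeA a + s)) (size-join l g))
  (solve 4 (λ k a l g → con 1 :+ (k :+ a :+ (l :+ g)) := k :+ (con 1 :+ (l :+ a :+ g))) refl (sizeF k) (sizeA a) (sizeF l) (sizeG g)))
  where open +-*-Solver

-- A word read from the right leaves one closed part for each level above 0 and a forest at level 0.
Stack : ℕ → Set
Stack zero    = Forest
Stack (suc h) = (Forest × Ground) × Stack h

sizeS : ∀ h → Stack h → ℕ
sizeS zero    k             = sizeF k
sizeS (suc h) ((k , g) , s) = sizeF k + sizeG g + sizeS h s

passT : ∀ {h} → Stack (suc h) → Stack h
passT {zero}  ((k , g) , l)           = blk k g l
passT {suc h} ((k , g) , (l , u) , s) = (blk k g l , u) , s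

-- The topmost part has to become a single stretch of path, hence `join`. The last instruction
-- remains visible: above level 0, `pass` leaves a nonempty forest on top, `close` an empty one over
-- a nonempty ground, and `grow` leaves both empty.
closeT : ∀ {h} → Stack (suc (suc h)) → Stack (suc h)
closeT ((k , g) , (l , u) , s) = (∅ , northᵍ l (join k g) u) , s

parse : ∀ {h} → Word h → Stack h
parse edge      = (∅ , nilᵍ) , ∅
parse (pass w)  = passT (parse w)
parse (close w) = closeT (parse w)
parse (grow w)  = (∅ , nilᵍ) , parse w

parse-size : ∀ {h} (w : Word h) → vertices# w ≡ h + sizeS h (parse w)
parse-size edge = refl
parse-size {zero} (pass w) = trans (parse-size w) (cong suc refl)
parse-size {suc h} (pass w) = trans (parse-size w) (eq (parse w))
  where
  open +-*-Solver
  eq : ∀ s → suc (suc h) + sizeS (suc (suc h)) s ≡ suc h + sizeS (suc h) (passT s)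
  eq ((k , g) , (l , u) , s) = solve 6
    (λ h k g l u s → con 2 :+ h :+ (k :+ g :+ (l :+ u :+ s)) := con 1 :+ h :+ (con 1 :+ (k :+ g :+ l) :+ u :+ s))
    refl h (sizeF k) (sizeG g) (sizeF l) (sizeG u) (sizeS h s)
parse-size {suc h} (close w) = trans (parse-size w) (eq (parse w))
  where
  open +-*-Solver
  eq : ∀ s → suc (suc h) + sizeS (suc (suc h)) s ≡ suc h + sizeS (suc h) (closeT s)
  eq ((k , g) , (l , u) , s) = trans
    (solve 6 (λ h k g l u s → con 2 :+ h :+ (k :+ g :+ (l :+ u :+ s)) := con 1 :+ h :+ (con 1 :+ (l :+ (k :+ g) :+ u) :+ s))
      refl h (sizeF k) (sizeG g) (sizeF l) (sizeG u) (sizeS h s))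
    (cong (λ j → suc h + (suc (sizeF l + j + sizeG u) + sizeS h s)) (sym (size-join k g)))
parse-size (grow w) = cong suc (parse-size w)

passT-inj : ∀ {h} (s t : Stack (suc h)) → passT s ≡ passT t → s ≡ t
passT-inj {zero}  _ _ refl = refl
passT-inj {suc h} _ _ refl = refl

closeT-inj : ∀ {h} (s t : Stack (suc (suc h))) → closeT s ≡ closeT t → s ≡ t
closeT-inj ((k , g) , (l , u) , s) ((k′ , g′) , (l′ , u′) , s′) e
  with north-inj (cong (proj₂ ∘ proj₁) e) | cong proj₂ e
  where
  north-inj : ∀ {l a u l′ a′ u′} → northᵍ l a u ≡ northᵍ l′ a′ u′ → l ≡ l′ × a ≡ a′ × u ≡ u′
  north-inj refl = refl , refl , refl
... | refl , a≡ , refl | refl =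
  cong (λ q → q , (l , u) , s) (trans (sym (unjoin-join k g)) (trans (cong unjoin a≡) (unjoin-join k′ g′)))

passT≢∅ : ∀ {h} (s : Stack (suc (suc h))) → proj₁ (proj₁ (passT s)) ≢ ∅
passT≢∅ ((k , g) , (l , u) , s) ()

-- The empty forest at level 0 is thus free to stand below `edge`, which parses like a `grow`. It is
-- also why the empty path, of semilength 0, has to be excluded.
parse₀≢∅ : (w : Word 0) → parse w ≢ ∅
parse₀≢∅ (pass w) ()

parse-inj : ∀ {h} (w w′ : Word h) → parse w ≡ parse w′ → w ≡ w′
parse-inj edge              edge              e = refl
parse-inj (pass w)          (pass w′)         e = cong pass (parse-inj w w′ (passT-inj (parse w) (parse w′) e))
parse-inj (close w)         (close w′)        e = cong close (parse-inj w w′ (closeT-inj (parse w) (parse w′) e))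
parse-inj (grow w)          (grow w′)         e = cong grow (parse-inj w w′ (cong proj₂ e))
parse-inj edge              (grow w′)         e = ⊥-elim (parse₀≢∅ w′ (sym (cong proj₂ e)))
parse-inj (grow w)          edge              e = ⊥-elim (parse₀≢∅ w (cong proj₂ e))
parse-inj edge              (pass w′)         e = ⊥-elim (passT≢∅ (parse w′) (sym (cong (proj₁ ∘ proj₁) e)))
parse-inj (pass w)          edge              e = ⊥-elim (passT≢∅ (parse w) (cong (proj₁ ∘ proj₁) e))
parse-inj {suc h} (pass w)  (close w′)        e = ⊥-elim (passT≢∅ (parse w) (cong (proj₁ ∘ proj₁) e))
parse-inj {suc h} (close w) (pass w′)         e = ⊥-elim (passT≢∅ (parse w′) (sym (cong (proj₁ ∘ proj₁) e)))
parse-inj {suc h} (pass w)  (grow w′)         e = ⊥-elim (passT≢∅ (parse w) (cong (proj₁ ∘ proj₁) e))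
parse-inj {suc h} (grow w)  (pass w′)         e = ⊥-elim (passT≢∅ (parse w′) (sym (cong (proj₁ ∘ proj₁) e)))
parse-inj edge              (close w′)        ()
parse-inj (close w)         edge              ()
parse-inj (close w)         (grow w′)         ()
parse-inj (grow w)          (close w′)        ()

mutual
  unparseF : ∀ {h} → Forest → Word (suc h) → Word (suc h)
  unparseF ∅           w = w
  unparseF (blk k g l) w = pass (unparseF k (unparseG g (grow (unparseF l w))))

  unparseG : ∀ {h} → Ground → Word (suc h) → Word (suc h)
  unparseG nilᵍ           w = w
  unparseG (northᵍ k a g) w = close (unparseA a (grow (unparseF k (unparseG g w))))

  unparseA : ∀ {h} → Aloft → Word (suc h) → Word (suc h)
  unparseA nilᵃ           w = w
  unparseA (diagᵃ k a)    w = pass (unparseA a (grow (unparseF k w)))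
  unparseA (northᵃ k a b) w = unparseF k (close (unparseA a (grow (unparseA b w))))

mutual
  parse-unparseF : ∀ {h} k (w : Word (suc h)) {g s} → parse w ≡ ((∅ , g) , s) → parse (unparseF k w) ≡ ((k , g) , s)
  parse-unparseF ∅           w e = e
  parse-unparseF (blk k g l) w e =
    cong passT (parse-unparseF k _ (parse-unparseG g _ (cong ((∅ , nilᵍ) ,_) (parse-unparseF l w e))))

  parse-unparseG : ∀ {h} g (w : Word (suc h)) {s} → parse w ≡ ((∅ , nilᵍ) , s) → parse (unparseG g w) ≡ ((∅ , g) , s)
  parse-unparseG nilᵍ           w e = e
  parse-unparseG (northᵍ k a g) w {s} e = trans
    (cong closeT (parse-unparseA a _ (cong ((∅ , nilᵍ) ,_) (parse-unparseF k _ (parse-unparseG g w e)))))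
    (cong (λ b → (∅ , northᵍ k b g) , s) (join-unjoin a))

  -- A stretch is written as the pair `unjoin a`, which the enclosing `close` turns back into `a`.
  parse-unparseA : ∀ {h} a (w : Word (suc h)) {s} → parse w ≡ ((∅ , nilᵍ) , s) → parse (unparseA a w) ≡ (unjoin a , s)
  parse-unparseA nilᵃ           w e = e
  parse-unparseA (diagᵃ k a)    w e = cong passT (parse-unparseA a _ (cong ((∅ , nilᵍ) ,_) (parse-unparseF k w e)))
  parse-unparseA (northᵃ k a b) w {s} e = parse-unparseF k _ (trans
    (cong closeT (parse-unparseA a _ (cong ((∅ , nilᵍ) ,_) (parse-unparseA b w e))))
    (cong (λ c → (∅ , northᵍ (proj₁ (unjoin b)) c (proj₂ (unjoin b))) , s) (join-unjoin a)))

-- Takes the place of `grow (unparseF k w)` at the bottom, where there is no word `w` for the empty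
-- forest and `edge` has to begin.
unparse₁ : Forest → Word 1
unparse₁ ∅           = edge
unparse₁ (blk k g l) = grow (pass (unparseF k (unparseG g (unparse₁ l))))

parse-unparse₁ : ∀ k → parse (unparse₁ k) ≡ ((∅ , nilᵍ) , k)
parse-unparse₁ ∅           = refl
parse-unparse₁ (blk k g l) = cong (λ s → (∅ , nilᵍ) , passT s)
  (parse-unparseF k _ (parse-unparseG g _ (parse-unparse₁ l)))

parse₀-surjective : ∀ k → k ≢ ∅ → ∃ λ (w : Word 0) → parse w ≡ k
parse₀-surjective ∅           ne = ⊥-elim (ne refl)
parse₀-surjective (blk k g l) _  = pass (unparseF k (unparseG g (unparse₁ l))) ,
  cong passT (parse-unparseF k _ (parse-unparseG g _ (parse-unparse₁ l)))

module _ {n : ℕ} where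

  wordDyck : (∃ λ (w : Word 0) → vertices# w ≡ n) → ColoredDyck n
  wordDyck (w , e) = toDyck (parse w , trans (sym (parse-size w)) e)

  wordDyck-injective : ∀ w w′ → wordDyck w ≡ wordDyck w′ → w ≡ w′
  wordDyck-injective (w , e) (w′ , e′) eq with parse-inj w w′ (toDyck-injective _ _ eq)
  ... | refl = cong (w ,_) (ℕₚ.≡-irrelevant e e′)

  wordDyck-surjective : 1 ≤ n → ∀ p → ∃ λ w → wordDyck w ≡ p
  wordDyck-surjective 1≤n p =
    let (k , size≡) , k↦p = toDyck-surjective p
        w , w↦k = parse₀-surjective k (nonempty k size≡)
    in (w , trans (parse-size w) (trans (cong sizeF w↦k) size≡)) , trans (same w↦k) k↦p
    where
    nonempty : ∀ k → sizeF k ≡ n → k ≢ ∅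
    nonempty ∅ e refl = case subst (1 ≤_) (sym e) 1≤n of λ ()
    same : ∀ {k k′} {e : sizeF k ≡ n} {e′ : sizeF k′ ≡ n} → k ≡ k′ → toDyck (k , e) ≡ toDyck (k′ , e′)
    same {k} refl = cong (λ e → toDyck (k , e)) (ℕₚ.≡-irrelevant _ _)

-- The bijection between colored Dyck paths and isomorphism classes of maps.

theorem5p1 : (n : ℕ) → 1 ≤ n →
    Σ (ColoredDyck n → OuterplanarMap n) λ f →
    (∀ (M : OuterplanarMap n) → ∃ λ p → proj₁ (f p) ≅ proj₁ M)
    × (∀ (p q : ColoredDyck n) → proj₁ (f p) ≅ proj₁ (f q) → p ≡ q)
theorem5p1 n 1≤n = f , surjective , injective
  where
  word : ColoredDyck n → ∃ λ (w : Word 0) → vertices# w ≡ n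
  word p = proj₁ (wordDyck-surjective 1≤n p)
  word-dyck : ∀ p → wordDyck (word p) ≡ p
  word-dyck p = proj₂ (wordDyck-surjective 1≤n p)
  f : ColoredDyck n → OuterplanarMap n
  f p = wordMap (word p)
  surjective : ∀ M → ∃ λ p → proj₁ (f p) ≅ proj₁ M
  surjective M = let w , iso = wordMap-surjective M in
    wordDyck w , subst (λ v → proj₁ (wordMap v) ≅ proj₁ M)
      (sym (wordDyck-injective (word (wordDyck w)) w (word-dyck (wordDyck w)))) iso
  injective : ∀ p q → proj₁ (f p) ≅ proj₁ (f q) → p ≡ q
  injective p q iso = trans (sym (word-dyck p))
    (trans (cong wordDyck (wordMap-injective (word p) (word q) iso)) (word-dyck q))
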